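{- Let $m$ be a positive integer and let $C$ be an extremal binary doubly even self-dual $[24m,12m,4m+4]$ code. Then the support design $D$ of the minimum weight $4m+4$ of $C$ is not an $8$-design.
   Context: A binary linear code is self-dual if $C=C^\perp$ with respect to the standard inner product, and doubly even if all weights are divisible by $4$. An extremal binary doubly even self-dual $[24m,12m,4m+4]$ code has length $24m$, dimension $12m$ and minimum weight $4m+4$. The support of a codeword $c$ is the set of indices of its nonzero coordinates. The support design of $C$ for weight $w$ has the $24m$ coordinate indices as points and the supports of all codewords of weight $w$ as blocks. A $t$-design is a pair $(X,\mathcal{B})$ of a point set and a collection of $k$-subsets (blocks) such that every $t$-subset of $X$ lies in the same number $\lambda$ of blocks. -}

module Defs where

open import Data.Bool using (Bool; true; false; _xor_; _∧_; if_then_else_)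
open import Data.Nat using (ℕ; zero; suc; _+_; _*_; _≤_)
open import Data.Nat.Divisibility using (_∣_)
open import Data.Vec using (Vec; []; _∷_; zipWith; replicate; foldr)
open import Data.List using (List; []; _∷_; map; _++_; filterᵇ; length)
open import Data.Product using (Σ; _×_; ∃)
open import Data.Fin.Subset using (Subset; _⊆_; ∣_∣)
open import Data.Fin.Subset.Properties using (_⊆?_)
open import Relation.Nullary using (¬_)
open import Relation.Nullary.Decidable using (⌊_⌋)
open import Relation.Binary.PropositionalEquality using (_≡_)
open import Function.Bundles using (_⇔_)

Word : ℕ → Set
Word n = Vec Bool n

zeroWord : ∀ {n} → Word n
zeroWord = replicate _ false

_⊕_ : ∀ {n} → Word n → Word n → Word n
_⊕_ = zipWith _xor_

⟨_,_⟩ : ∀ {n} → Word n → Word n → Bool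
⟨ x , y ⟩ = foldr _ _xor_ false (zipWith _∧_ x y)

-- Support of a word, as a subset of the coordinate set Fin n
-- (Data.Fin.Subset n = Vec Bool n, inside = true).
supp : ∀ {n} → Word n → Subset n
supp c = c

wt : ∀ {n} → Word n → ℕ
wt c = ∣ supp c ∣

allWords : (n : ℕ) → List (Word n)
allWords zero = [] ∷ []
allWords (suc n) = map (false ∷_) (allWords n) ++ map (true ∷_) (allWords n)

Code : ℕ → Set
Code n = Word n → Bool

_∈C_ : ∀ {n} → Word n → Code n → Set
c ∈C C = C c ≡ true

IsLinear : ∀ {n} → Code n → Set
IsLinear C = (zeroWord ∈C C) × (∀ x y → x ∈C C → y ∈C C → (x ⊕ y) ∈C C)

_∈Dual_ : ∀ {n} → Word n → Code n → Set
x ∈Dual C = ∀ c → c ∈C C → ⟨ x , c ⟩ ≡ false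

IsSelfDual : ∀ {n} → Code n → Set
IsSelfDual C = ∀ x → (x ∈C C) ⇔ (x ∈Dual C)

IsDoublyEven : ∀ {n} → Code n → Set
IsDoublyEven C = ∀ c → c ∈C C → 4 ∣ wt c

size : ∀ {n} → Code n → ℕ
size {n} C = length (filterᵇ C (allWords n))

-- Dimension k: as C is linear over GF(2), dim C = k iff |C| = 2^k.
HasDimension : ∀ {n} → Code n → ℕ → Set
HasDimension C k = size C ≡ 2 Data.Nat.^ k

HasMinWeight : ∀ {n} → Code n → ℕ → Set
HasMinWeight C d =
  (∃ λ c → c ∈C C × ¬ (c ≡ zeroWord) × wt c ≡ d) ×
  (∀ c → c ∈C C → ¬ (c ≡ zeroWord) → d ≤ wt c)

IsExtremalDESD : (m : ℕ) → Code (24 * m) → Set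
IsExtremalDESD m C =
  IsLinear C × IsSelfDual C × IsDoublyEven C ×
  HasDimension C (12 * m) × HasMinWeight C (4 * m + 4)

-- Blocks of the support design of C for weight w: supports of all
-- codewords of weight w (distinct codewords have distinct supports).
supportBlocks : ∀ {n} → Code n → ℕ → List (Subset n)
supportBlocks {n} C w =
  map supp (filterᵇ (λ c → C c ∧ ⌊ wt c Data.Nat.≟ w ⌋) (allWords n))

blocksContaining : ∀ {n} → List (Subset n) → Subset n → ℕ
blocksContaining B T = length (filterᵇ (λ b → ⌊ T ⊆? b ⌋) B)

IsTDesign : ∀ {n} → ℕ → List (Subset n) → Set
IsTDesign t B = ∃ λ lam → ∀ T → ∣ T ∣ ≡ t → blocksContaining B T ≡ lam

{-# OPTIONS --safe #-}
module Submission where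

-- Let W(x, y) be the weight enumerator of C and A_w its coefficients. It is invariant under y ↦ i y and, by
-- MacWilliams, under (x, y) ↦ (x + y, x - y)/√2. For a semi-invariant Q of degree 24(M - m) + 4 with the opposite sign,
-- the form W Q dy / (y (1 - y⁴))^(4M+1) has the same residue at each of its six poles 0, ∞ and y⁴ = 1, so this residue
-- vanishes: Σ_w A_w [y^(4M-w)] Q (1 - y⁴)^(-4M-1) = 0. For M = m + 1 this determines A = A_(4m+4), for M = m + 2 it
-- determines A_(4m+8), which turns out to be negative for m ≥ 154.
--
-- If the words of weight d = 4m + 4 form an 8-design, then λ C(24m, 8) = A C(d, 8), and for m ≤ 153 this quotient λ is an
-- integer only for m = 8, 42, 63, 75, 130. For a codeword c of weight w, counting pairs of a block b and an 8-subset of b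
-- that meets c in j points gives Σ_b C(i_b, j) C(d - i_b, 8 - j) = λ C(w, j) C(24m - w, 8 - j), where i_b = |b ∩ c| is
-- even by self-duality. In the remaining cases this is impossible 2-adically, with w = 4m + 4, or w = 4m + 8 if m = 63.

open import Defs
open import Algebra.Bundles using (CommutativeMonoid; CommutativeRing; CommutativeSemiring)
open import Algebra.Solver.Ring.AlmostCommutativeRing using (fromCommutativeRing; _-Raw-AlmostCommutative⟶_)
import Algebra.Solver.Ring
open import Algebra.Structures using (IsCommutativeRing)
open import Data.Bool using (Bool; true; false; _xor_; _∧_; not)
import Data.Bool.Properties as 𝔹ₚ
open import Data.Empty using (⊥; ⊥-elim)
open import Data.Fin.Subset using (∣_∣)
open import Data.Fin.Subset.Properties using (_⊆?_; ⊆⊤)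
open import Data.Integer as ℤ using (ℤ; +_; -[1+_]; 0ℤ; 1ℤ)
import Data.Integer.Properties as ℤₚ
import Data.Integer.Tactic.RingSolver as ℤSolver
open import Data.List as List using (List; []; _∷_; _∷ʳ_; _++_; filterᵇ; length; reverse; upTo)
open import Data.List.Membership.Propositional using (_∈_)
open import Data.List.Membership.Propositional.Properties using (∈-upTo⁺)
import Data.List.Properties as Listₚ
open import Data.List.Relation.Unary.All as All using (All; []; _∷_)
open import Data.List.Relation.Unary.Any using (here; there)
open import Data.Maybe as Maybe using (Maybe)
open import Data.Nat as ℕ using (ℕ; zero; suc; z≤n; s≤s; _∸_; _≤_; _<_)
open import Data.Nat.Combinatorics using (k>n⇒nCk≡0; nCk+nC[k+1]≡[n+1]C[k+1]; nCn≡1) renaming (_C_ to _choose_)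
open import Data.Nat.Divisibility using (_∣_; _∣?_; _∣0; divides; *-monoˡ-∣; ∣m∣n⇒∣m+n)
open import Data.Nat.DivMod using (m*n/n≡m)
import Data.Nat.Properties as ℕₚ
import Data.Nat.Tactic.RingSolver as ℕSolver
open import Data.Product using (∃; _,_; _×_; proj₁; proj₂)
open import Data.Sum using (_⊎_; inj₁; inj₂; [_,_]′)
open import Data.Unit using (⊤; tt)
open import Data.Vec as Vec using ([]; _∷_; foldr; zipWith)
open import Function using (_∘_; id)
open import Function.Bundles using (Equivalence)
open import Level using (0ℓ)
open import Relation.Binary.PropositionalEquality using (_≡_; _≢_; refl; sym; trans; cong; cong₂; subst; subst₂; module ≡-Reasoning)
open import Relation.Nullary using (¬_; Dec; yes; no; does; ¬?; _×-dec_; _⊎-dec_)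
open import Relation.Nullary.Decidable as Dec using (⌊_⌋; dec-true; dec⇒maybe; from-yes; isYes≗does)
open import Data.List.Membership.DecPropositional ℕ._≟_ using (_∈?_)
open import Algebra.Properties.CommutativeSemigroup
  (CommutativeMonoid.commutativeSemigroup (CommutativeRing.+-commutativeMonoid 𝔹ₚ.xor-∧-commutativeRing)) using (interchange)

-- The six poles are the zeros of xy(x⁴ - y⁴), the vertices of an octahedron, and the two
-- substitutions permute them transitively. The second has determinant -1: it fixes xy(x⁴ - y⁴) and
-- changes the sign of x dy - y dx, which is why Q has to change sign. The exponent 4M + 1 makes the
-- form invariant under y ↦ i y. Residues are treated formally. In the coordinate s with y = (1 -
-- s)/(1 + s), the residue at y = 1 is a coefficient of a power series over ℤ. MacWilliams evaluates
-- it for the whole code; for a single word the coordinate 1 - y⁴ turns it into binomial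
-- coefficients, which stand for the poles 0 and ∞. For the five exceptional m the integrality of λ
-- gives no contradiction, and the evenness of i = |b ∩ c| is used instead. A polynomial such as
-- C(i/2, 8) is an integer at even i although its coefficients in the basis C(i, j) C(d - i, 8 - j)
-- have even denominators. Summed over the blocks it must give an integer, and the design equations
-- express this sum through λ and the weight of c, where integrality fails.

module PowerSeries where
  open import Data.Integer using (_+_; _*_; -_)

  Ser : Set
  Ser = ℕ → ℤ

  infix 4 _≐_
  _≐_ : Ser → Ser → Set
  f ≐ g = ∀ n → f n ≡ g n

  infixl 6 _⊕ˢ_
  infixl 7 _⊛_

  _⊕ˢ_ _⊛_ : Ser → Ser → Ser
  (f ⊕ˢ g) n = f n + g n
  (f ⊛ g) zero = f 0 * g 0
  (f ⊛ g) (suc n) = f 0 * g (suc n) + (f ∘ suc ⊛ g) n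

  ⊖_ : Ser → Ser
  (⊖ f) n = - f n

  constant : ℤ → Ser
  constant z zero = z
  constant z (suc _) = 0ℤ

  shift : Ser → Ser
  shift f zero = 0ℤ
  shift f (suc n) = f n

  ⊛-cong : ∀ {f f′ g g′} → f ≐ f′ → g ≐ g′ → f ⊛ g ≐ f′ ⊛ g′
  ⊛-cong p q zero = cong₂ _*_ (p 0) (q 0)
  ⊛-cong p q (suc n) = cong₂ _+_ (cong₂ _*_ (p 0) (q (suc n))) (⊛-cong (p ∘ suc) q n)

  ⊛-distribʳ : ∀ h f g → (f ⊕ˢ g) ⊛ h ≐ f ⊛ h ⊕ˢ g ⊛ h
  ⊛-distribʳ h f g zero = ℤₚ.*-distribʳ-+ (h 0) (f 0) (g 0)
  ⊛-distribʳ h f g (suc n) = trans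
    (cong (λ x → (f 0 + g 0) * h (suc n) + x) (⊛-distribʳ h (f ∘ suc) (g ∘ suc) n))
    (lemma (f 0) (g 0) (h (suc n)) _ _)
    where
    lemma : ∀ a b c x y → (a + b) * c + (x + y) ≡ a * c + x + (b * c + y)
    lemma = ℤSolver.solve-∀

  ⊛-scaleˡ : ∀ z f g → (λ n → z * f n) ⊛ g ≐ λ n → z * (f ⊛ g) n
  ⊛-scaleˡ z f g zero = ℤₚ.*-assoc z (f 0) (g 0)
  ⊛-scaleˡ z f g (suc n) = trans (cong (λ x → z * f 0 * g (suc n) + x) (⊛-scaleˡ z (f ∘ suc) g n))
    (lemma z (f 0) (g (suc n)) _)
    where
    lemma : ∀ z a b x → z * a * b + z * x ≡ z * (a * b + x)
    lemma = ℤSolver.solve-∀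

  ⊛-sucʳ : ∀ f g n → (f ⊛ g) (suc n) ≡ (f ⊛ g ∘ suc) n + f (suc n) * g 0
  ⊛-sucʳ f g zero = refl
  ⊛-sucʳ f g (suc n) = trans (cong (λ x → f 0 * g (suc (suc n)) + x) (⊛-sucʳ (f ∘ suc) g n))
    (sym (ℤₚ.+-assoc (f 0 * g (suc (suc n))) ((f ∘ suc ⊛ g ∘ suc) n) _))

  ⊛-comm : ∀ f g → f ⊛ g ≐ g ⊛ f
  ⊛-comm f g zero = ℤₚ.*-comm (f 0) (g 0)
  ⊛-comm f g (suc n) = trans
    (cong₂ _+_ (ℤₚ.*-comm (f 0) (g (suc n))) (⊛-comm (f ∘ suc) g n))
    (trans (ℤₚ.+-comm _ ((g ⊛ f ∘ suc) n)) (sym (⊛-sucʳ g f n)))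

  ⊛-assoc : ∀ f g h → (f ⊛ g) ⊛ h ≐ f ⊛ (g ⊛ h)
  ⊛-assoc f g h zero = ℤₚ.*-assoc (f 0) (g 0) (h 0)
  ⊛-assoc f g h (suc n) = begin
    f 0 * g 0 * h (suc n) + ((f ⊛ g) ∘ suc ⊛ h) n
      ≡⟨ cong (λ x → f 0 * g 0 * h (suc n) + x)
           (trans (⊛-distribʳ h (λ k → f 0 * g (suc k)) (f ∘ suc ⊛ g) n)
             (cong₂ _+_ (⊛-scaleˡ (f 0) (g ∘ suc) h n) (⊛-assoc (f ∘ suc) g h n))) ⟩
    f 0 * g 0 * h (suc n) + (f 0 * (g ∘ suc ⊛ h) n + (f ∘ suc ⊛ (g ⊛ h)) n)
      ≡⟨ lemma (f 0) (g 0) (h (suc n)) _ _ ⟩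
    f 0 * (g 0 * h (suc n) + (g ∘ suc ⊛ h) n) + (f ∘ suc ⊛ (g ⊛ h)) n ∎
    where
    open ≡-Reasoning
    lemma : ∀ a b c x y → a * b * c + (a * x + y) ≡ a * (b * c + x) + y
    lemma = ℤSolver.solve-∀

  zero-⊛ : ∀ g → (λ _ → 0ℤ) ⊛ g ≐ λ _ → 0ℤ
  zero-⊛ g zero = ℤₚ.*-zeroˡ (g 0)
  zero-⊛ g (suc n) = cong₂ _+_ (ℤₚ.*-zeroˡ (g (suc n))) (zero-⊛ g n)

  constant-⊛ : ∀ z g → constant z ⊛ g ≐ λ n → z * g n
  constant-⊛ z g zero = refl
  constant-⊛ z g (suc n) = trans (cong (λ x → z * g (suc n) + x) (zero-⊛ g n)) (ℤₚ.+-identityʳ _)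

  shift-⊛ : ∀ f g → shift f ⊛ g ≐ shift (f ⊛ g)
  shift-⊛ f g zero = ℤₚ.*-zeroˡ (g 0)
  shift-⊛ f g (suc n) = trans (cong (_+ (f ⊛ g) n) (ℤₚ.*-zeroˡ (g (suc n)))) (ℤₚ.+-identityˡ _)

  ⊛-identityˡ : ∀ g → constant 1ℤ ⊛ g ≐ g
  ⊛-identityˡ g n = trans (constant-⊛ 1ℤ g n) (ℤₚ.*-identityˡ (g n))

  constant-0 : constant 0ℤ ≐ λ _ → 0ℤ
  constant-0 zero = refl
  constant-0 (suc _) = refl

  -- The derivation s d/ds, which, unlike d/ds, keeps the index of a coefficient.
  θ′ : Ser → Ser
  θ′ f n = + n * f n

  θ′-⊛ : ∀ f g → θ′ (f ⊛ g) ≐ θ′ f ⊛ g ⊕ˢ f ⊛ θ′ g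
  θ′-⊛ f g zero = lemma (f 0) (g 0)
    where
    lemma : ∀ x y → 0ℤ * (x * y) ≡ 0ℤ * x * y + x * (0ℤ * y)
    lemma = ℤSolver.solve-∀
  θ′-⊛ f g (suc n) = begin
    + suc n * (f 0 * g (suc n) + (f ∘ suc ⊛ g) n)
      ≡⟨ lemma₁ (+ n) (f 0) (g (suc n)) _ ⟩
    f 0 * (+ suc n * g (suc n)) + (θ′ (f ∘ suc ⊛ g) n + (f ∘ suc ⊛ g) n)
      ≡⟨ cong (λ x → f 0 * (+ suc n * g (suc n)) + (x + (f ∘ suc ⊛ g) n)) (θ′-⊛ (f ∘ suc) g n) ⟩
    f 0 * (+ suc n * g (suc n)) +
      ((θ′ (f ∘ suc) ⊛ g) n + (f ∘ suc ⊛ θ′ g) n + (f ∘ suc ⊛ g) n)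
      ≡⟨ lemma₂ (f 0 * (+ suc n * g (suc n))) ((θ′ (f ∘ suc) ⊛ g) n) ((f ∘ suc ⊛ θ′ g) n) _ (f 0) (g (suc n)) ⟩
    0ℤ * f 0 * g (suc n) + ((θ′ (f ∘ suc) ⊛ g) n + (f ∘ suc ⊛ g) n) +
      (f 0 * (+ suc n * g (suc n)) + (f ∘ suc ⊛ θ′ g) n)
      ≡⟨ cong (λ x → 0ℤ * f 0 * g (suc n) + x + (f 0 * (+ suc n * g (suc n)) + (f ∘ suc ⊛ θ′ g) n))
           (trans (sym (⊛-distribʳ g (θ′ (f ∘ suc)) (f ∘ suc) n))
             (⊛-cong {g = g} (λ k → lemma₃ (+ k) (f (suc k))) (λ _ → refl) n)) ⟩
    (θ′ f ⊛ g) (suc n) + (f ⊛ θ′ g) (suc n) ∎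
    where
    open ≡-Reasoning
    lemma₁ : ∀ k a b c → (1ℤ + k) * (a * b + c) ≡ a * ((1ℤ + k) * b) + (k * c + c)
    lemma₁ = ℤSolver.solve-∀
    lemma₂ : ∀ a x y z f g → a + (x + y + z) ≡ 0ℤ * f * g + (x + z) + (a + y)
    lemma₂ = ℤSolver.solve-∀
    lemma₃ : ∀ k x → k * x + x ≡ (1ℤ + k) * x
    lemma₃ = ℤSolver.solve-∀

  isCommutativeRing : IsCommutativeRing _≐_ _⊕ˢ_ _⊛_ ⊖_ (λ _ → 0ℤ) (constant 1ℤ)
  isCommutativeRing = record
    { isRing = record
      { +-isAbelianGroup = record
        { isGroup = record
          { isMonoid = record
            { isSemigroup = record
              { isMagma = record
                { isEquivalence = record
                  { refl = λ _ → refl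
                  ; sym = λ p n → sym (p n)
                  ; trans = λ p q n → trans (p n) (q n) }
                ; ∙-cong = λ p q n → cong₂ _+_ (p n) (q n) }
              ; assoc = λ f g h n → ℤₚ.+-assoc (f n) (g n) (h n) }
            ; identity = (λ f n → ℤₚ.+-identityˡ (f n)) , λ f n → ℤₚ.+-identityʳ (f n) }
          ; inverse = (λ f n → ℤₚ.+-inverseˡ (f n)) , λ f n → ℤₚ.+-inverseʳ (f n)
          ; ⁻¹-cong = λ p n → cong -_ (p n) }
        ; comm = λ f g n → ℤₚ.+-comm (f n) (g n) }
      ; *-cong = λ {f} {f′} {g} {g′} → ⊛-cong {f} {f′} {g} {g′}
      ; *-assoc = ⊛-assoc
      ; *-identity = ⊛-identityˡ , λ f n → trans (⊛-comm f (constant 1ℤ) n) (⊛-identityˡ f n)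
      ; distrib = (λ f g h n → trans (⊛-comm f (g ⊕ˢ h) n)
                    (trans (⊛-distribʳ f g h n) (cong₂ _+_ (⊛-comm g f n) (⊛-comm h f n))))
                , ⊛-distribʳ }
    ; *-comm = ⊛-comm }

-- The ring of power series with opaque operations

module Series where
  open PowerSeries

  abstract
    ℤ⟦s⟧ : CommutativeRing 0ℓ 0ℓ
    ℤ⟦s⟧ = record { isCommutativeRing = isCommutativeRing }

  open CommutativeRing ℤ⟦s⟧ public hiding (zero; distrib) renaming (refl to ≈-refl; sym to ≈-sym; trans to ≈-trans; reflexive to ≈-reflexive)

  abstract
    series : (ℕ → ℤ) → Carrier
    series f = f

    infixl 9 _[_]
    _[_] : Carrier → ℕ → ℤ
    f [ n ] = f n

    s : Carrier
    s = shift (constant 1ℤ)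

    ι : ℤ → Carrier
    ι = constant

    θ : Carrier → Carrier
    θ = θ′

    series-[] : ∀ f n → series f [ n ] ≡ f n
    series-[] f n = refl

    ext : ∀ {f g} → (∀ n → f [ n ] ≡ g [ n ]) → f ≈ g
    ext p = p

    []-cong : ∀ {f g} → f ≈ g → ∀ n → f [ n ] ≡ g [ n ]
    []-cong p = p

    []-+ : ∀ f g n → (f + g) [ n ] ≡ f [ n ] ℤ.+ g [ n ]
    []-+ f g n = refl

    []-neg : ∀ f n → (- f) [ n ] ≡ ℤ.- f [ n ]
    []-neg f n = refl

    []-0# : ∀ n → 0# [ n ] ≡ 0ℤ
    []-0# n = refl

    []-1# : ∀ n → 1# [ suc n ] ≡ 0ℤ
    []-1# n = refl

    [0]-1# : 1# [ 0 ] ≡ 1ℤ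
    [0]-1# = refl

    [0]-* : ∀ f g → (f * g) [ 0 ] ≡ f [ 0 ] ℤ.* g [ 0 ]
    [0]-* f g = refl

    []-ι* : ∀ z f n → (ι z * f) [ n ] ≡ z ℤ.* f [ n ]
    []-ι* = constant-⊛

    [0]-s* : ∀ f → (s * f) [ 0 ] ≡ 0ℤ
    [0]-s* f = shift-⊛ (constant 1ℤ) f 0

    []-s* : ∀ f n → (s * f) [ suc n ] ≡ f [ n ]
    []-s* f n = trans (shift-⊛ (constant 1ℤ) f (suc n)) (⊛-identityˡ f n)

    ι-+ : ∀ x y → ι (x ℤ.+ y) ≈ ι x + ι y
    ι-+ x y zero = refl
    ι-+ x y (suc n) = refl

    ι-* : ∀ x y → ι (x ℤ.* y) ≈ ι x * ι y
    ι-* x y zero = refl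
    ι-* x y (suc n) = sym (trans (constant-⊛ x (constant y) (suc n)) (ℤₚ.*-zeroʳ x))

    ι-neg : ∀ x → ι (ℤ.- x) ≈ - ι x
    ι-neg x zero = refl
    ι-neg x (suc n) = refl

    ι-0 : ι 0ℤ ≈ 0#
    ι-0 = constant-0

    ι-1 : ι 1ℤ ≈ 1#
    ι-1 n = refl

    θ-cong : ∀ {f g} → f ≈ g → θ f ≈ θ g
    θ-cong p n = cong (+ n ℤ.*_) (p n)

    θ-+ : ∀ f g → θ (f + g) ≈ θ f + θ g
    θ-+ f g n = ℤₚ.*-distribˡ-+ (+ n) (f n) (g n)

    θ-* : ∀ f g → θ (f * g) ≈ θ f * g + f * θ g
    θ-* = θ′-⊛

    θ-ι : ∀ z → θ (ι z) ≈ 0#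
    θ-ι z zero = ℤₚ.*-zeroˡ z
    θ-ι z (suc n) = ℤₚ.*-zeroʳ (+ suc n)

    θ-s : θ s ≈ s
    θ-s zero = refl
    θ-s (suc zero) = refl
    θ-s (suc (suc n)) = ℤₚ.*-zeroʳ (+ suc (suc n))

    []-θ : ∀ f n → θ f [ n ] ≡ + n ℤ.* f [ n ]
    []-θ f n = refl

-- The coordinate s at y = 1 and the residues of u^(-n-1) du

module Residue where
  open Series
  open import Algebra.Properties.CommutativeSemiring.Exp commutativeSemiring using (_^_; ^-congˡ)
  open import Relation.Binary.Reasoning.Setoid setoid

  ι-morphism : CommutativeRing.rawRing ℤₚ.+-*-commutativeRing -Raw-AlmostCommutative⟶ fromCommutativeRing ℤ⟦s⟧
  ι-morphism = record
    { ⟦_⟧ = ι ; +-homo = ι-+ ; *-homo = ι-* ; -‿homo = ι-neg ; 0-homo = ι-0 ; 1-homo = ι-1 }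

  ι≟ : ∀ x y → Maybe (ι x ≈ ι y)
  ι≟ x y = Maybe.map (λ p → ≈-reflexive (cong ι p)) (dec⇒maybe (x ℤ.≟ y))

  open Algebra.Solver.Ring (CommutativeRing.rawRing ℤₚ.+-*-commutativeRing) (fromCommutativeRing ℤ⟦s⟧) ι-morphism ι≟
    using (solve; con; var; _:=_; _:+_; _:*_; _:-_; :-_; _:^_; Polynomial) public

  :1 : ∀ {n} → Polynomial n
  :1 = con 1ℤ

  1+s 1-s 1+s² : Carrier
  1+s = ι 1ℤ + s
  1-s = ι 1ℤ - s
  1+s² = ι 1ℤ + s * s

  alternating evenAlternating : ℕ → ℤ
  alternating zero = 1ℤ
  alternating (suc n) = ℤ.- alternating n
  evenAlternating zero = 1ℤ
  evenAlternating (suc zero) = 0ℤ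
  evenAlternating (suc (suc n)) = ℤ.- evenAlternating n

  -- The reciprocals of 1 + s, 1 - s and 1 + s², so that I I′ J is the reciprocal of 1 - s⁴.
  I I′ J : Carrier
  I = series alternating
  I′ = series (λ _ → 1ℤ)
  J = series evenAlternating

  ι1*-[] : ∀ f n → (ι 1ℤ * f) [ n ] ≡ f [ n ]
  ι1*-[] f n = trans ([]-ι* 1ℤ f n) (ℤₚ.*-identityˡ _)

  [1+g]*-[] : ∀ f g n → ((ι 1ℤ + g) * f) [ n ] ≡ f [ n ] ℤ.+ (g * f) [ n ]
  [1+g]*-[] f g n = trans ([]-cong (distribʳ f (ι 1ℤ) g) n)
    (trans ([]-+ _ _ n) (cong (ℤ._+ (g * f) [ n ]) (ι1*-[] f n)))

  ι1-[0] : ι 1ℤ [ 0 ] ≡ 1ℤ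
  ι1-[0] = trans ([]-cong ι-1 0) [0]-1#

  ι1-[suc] : ∀ n → ι 1ℤ [ suc n ] ≡ 0ℤ
  ι1-[suc] n = trans ([]-cong ι-1 (suc n)) ([]-1# n)

  1+s-inverse : 1+s * I ≈ ι 1ℤ
  1+s-inverse = ext λ
    { zero → trans ([1+g]*-[] I s 0) (trans (cong₂ ℤ._+_ (series-[] alternating 0) ([0]-s* I)) (sym ι1-[0]))
    ; (suc n) → trans ([1+g]*-[] I s (suc n))
        (trans (cong₂ ℤ._+_ (series-[] alternating (suc n)) (trans ([]-s* I n) (series-[] alternating n)))
          (trans (ℤₚ.+-inverseˡ (alternating n)) (sym (ι1-[suc] n)))) }

  -s*-[0] : ∀ f → (- s * f) [ 0 ] ≡ 0ℤ
  -s*-[0] f = trans ([]-cong (solve 2 (λ s f → :- s :* f := :- (s :* f)) ≈-refl s f) 0)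
    (trans ([]-neg _ 0) (cong ℤ.-_ ([0]-s* f)))

  -s*-[suc] : ∀ f n → (- s * f) [ suc n ] ≡ ℤ.- f [ n ]
  -s*-[suc] f n = trans ([]-cong (solve 2 (λ s f → :- s :* f := :- (s :* f)) ≈-refl s f) (suc n))
    (trans ([]-neg _ (suc n)) (cong ℤ.-_ ([]-s* f n)))

  1-s-inverse : 1-s * I′ ≈ ι 1ℤ
  1-s-inverse = ext λ
    { zero → trans ([1+g]*-[] I′ (- s) 0) (trans (cong₂ ℤ._+_ (series-[] _ 0) (-s*-[0] I′)) (sym ι1-[0]))
    ; (suc n) → trans ([1+g]*-[] I′ (- s) (suc n))
        (trans (cong₂ ℤ._+_ (series-[] _ (suc n)) (trans (-s*-[suc] I′ n) (cong ℤ.-_ (series-[] _ n))))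
          (sym (ι1-[suc] n))) }

  s*s*-[suc²] : ∀ f n → (s * s * f) [ suc (suc n) ] ≡ f [ n ]
  s*s*-[suc²] f n = trans ([]-cong (*-assoc s s f) _) (trans ([]-s* _ (suc n)) ([]-s* f n))

  1+s²-inverse : 1+s² * J ≈ ι 1ℤ
  1+s²-inverse = ext λ
    { zero → trans ([1+g]*-[] J (s * s) 0)
        (trans (cong₂ ℤ._+_ (series-[] _ 0) (trans ([]-cong (*-assoc s s J) 0) ([0]-s* _))) (sym ι1-[0]))
    ; (suc zero) → trans ([1+g]*-[] J (s * s) 1)
        (trans (cong₂ ℤ._+_ (series-[] _ 1) (trans ([]-cong (*-assoc s s J) 1) (trans ([]-s* _ 0) ([0]-s* J)))) (sym (ι1-[suc] 0)))
    ; (suc (suc n)) → trans ([1+g]*-[] J (s * s) (suc (suc n)))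
        (trans (cong₂ ℤ._+_ (series-[] evenAlternating (suc (suc n))) (trans (s*s*-[suc²] J n) (series-[] evenAlternating n)))
          (trans (ℤₚ.+-inverseˡ (evenAlternating n)) (sym (ι1-[suc] (suc n))))) }

  -- t is y⁴ after the substitution y = (1 - s)/(1 + s), and t̄ is its inverse. In terms of u = 1 - t,
  -- H = 8 s / u and ρ = s u′ / u.
  t t̄ U H ρ E : Carrier
  t = (1-s * I) ^ 4
  t̄ = (1+s * I′) ^ 4
  U = 1+s ^ 4
  H = U * J
  ρ = 1-s ^ 3 * I * J
  E = I * I′ * J

  -- An identity of rational functions becomes a polynomial identity once suitable powers of
  -- products x y = 1 are inserted; k is the number of cancellations it uses.
  cancel : ∀ {x y z} k → x * y ≈ ι 1ℤ → z * (x * y) ^ k ≈ z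
  cancel {x} {y} {z} k p = ≈-trans (*-congˡ (≈-trans (^-congˡ k p) (one k))) (solve 1 (λ z → z :* :1 := z) ≈-refl z)
    where
    one : ∀ k → ι 1ℤ ^ k ≈ ι 1ℤ
    one zero = ≈-sym ι-1
    one (suc k) = ≈-trans (*-congˡ (one k)) (solve 0 (:1 :* :1 := :1) ≈-refl)

  t*t̄ : t * t̄ ≈ ι 1ℤ
  t*t̄ = begin
    t * t̄ ≈⟨ solve 4 (λ a b I I′ → (b :* I) :^ 4 :* (a :* I′) :^ 4 := :1 :* (a :* I) :^ 4 :* (b :* I′) :^ 4) ≈-refl 1+s 1-s I I′ ⟩
    ι 1ℤ * (1+s * I) ^ 4 * (1-s * I′) ^ 4 ≈⟨ cancel 4 1-s-inverse ⟩
    ι 1ℤ * (1+s * I) ^ 4 ≈⟨ cancel 4 1+s-inverse ⟩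
    ι 1ℤ ∎

  t*U : t * U ≈ 1-s ^ 4
  t*U = begin
    t * U ≈⟨ solve 3 (λ a b I → (b :* I) :^ 4 :* a :^ 4 := b :^ 4 :* (a :* I) :^ 4) ≈-refl 1+s 1-s I ⟩
    1-s ^ 4 * (1+s * I) ^ 4 ≈⟨ cancel 4 1+s-inverse ⟩
    1-s ^ 4 ∎

  U*E : U * E ≈ t̄ * ρ
  U*E = begin
    U * E ≈⟨ ≈-sym (cancel 3 1-s-inverse) ⟩
    U * E * (1-s * I′) ^ 3 ≈⟨ solve 5 (λ a b I I′ J → a :^ 4 :* (I :* I′ :* J) :* (b :* I′) :^ 3 := (a :* I′) :^ 4 :* (b :^ 3 :* I :* J)) ≈-refl 1+s 1-s I I′ J ⟩
    t̄ * ρ ∎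

  -- Code and semi-invariant together contribute U^(6M+1), so with E^(4M+1) the form at y = 1
  -- contains (U E) (U⁶ E⁴)^M. This identity and `U*E` express that product in the coordinate u = 1
  -- - t, as t̄^(M+1) ρ H^(4M).
  U⁶*E⁴ : U ^ 6 * E ^ 4 ≈ t̄ * H ^ 4
  U⁶*E⁴ = begin
    U ^ 6 * E ^ 4 ≈⟨ solve 5 (λ a b I I′ J → (a :^ 4) :^ 6 :* (I :* I′ :* J) :^ 4 := (a :* I′) :^ 4 :* (a :^ 4 :* J) :^ 4 :* (a :* I) :^ 4) ≈-refl 1+s 1-s I I′ J ⟩
    t̄ * H ^ 4 * (1+s * I) ^ 4 ≈⟨ cancel 4 1+s-inverse ⟩
    t̄ * H ^ 4 ∎

  [1-t]*H : (ι 1ℤ - t) * H ≈ ι (+ 8) * s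
  [1-t]*H = begin
    (ι 1ℤ - t) * H ≈⟨ solve 3 (λ t U J → (:1 :- t) :* (U :* J) := (U :- t :* U) :* J) ≈-refl t U J ⟩
    (U - t * U) * J ≈⟨ *-congʳ (+-congˡ (-‿cong t*U)) ⟩
    (U - 1-s ^ 4) * J ≈⟨ solve 2 (λ s J → ((:1 :+ s) :^ 4 :- (:1 :- s) :^ 4) :* J := con (+ 8) :* s :* ((:1 :+ s :* s) :* J) :^ 1) ≈-refl s J ⟩
    ι (+ 8) * s * (1+s² * J) ^ 1 ≈⟨ cancel 1 1+s²-inverse ⟩
    ι (+ 8) * s ∎

  -- The logarithmic derivative θ H / H of H = (1 + s)⁴ / (1 + s²).
  dlog : Carrier
  dlog = ι (+ 4) * s * I - ι (+ 2) * s * s * J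

  -- As u = 8 s / H, the logarithmic derivative of u with respect to θ is 1 minus that of H.
  1-dlog : ι 1ℤ - dlog ≈ ρ
  1-dlog = begin
    ι 1ℤ - dlog
      ≈⟨ +-cong (≈-trans (≈-sym (cancel {x = 1+s} 1 1+s-inverse)) (≈-sym (cancel 1 1+s²-inverse)))
           (-‿cong (+-cong (≈-sym (cancel 1 1+s²-inverse)) (-‿cong (≈-sym (cancel 1 1+s-inverse))))) ⟩
    ι 1ℤ * (1+s * I) ^ 1 * (1+s² * J) ^ 1
      - (ι (+ 4) * s * I * (1+s² * J) ^ 1 - ι (+ 2) * s * s * J * (1+s * I) ^ 1)
      ≈⟨ solve 3 (λ s I J →
           :1 :* ((:1 :+ s) :* I) :^ 1 :* ((:1 :+ s :* s) :* J) :^ 1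
             :- (con (+ 4) :* s :* I :* ((:1 :+ s :* s) :* J) :^ 1 :- con (+ 2) :* s :* s :* J :* ((:1 :+ s) :* I) :^ 1)
           := (:1 :- s) :^ 3 :* I :* J) ≈-refl s I J ⟩
    ρ ∎

  θ-1+s : θ 1+s ≈ s
  θ-1+s = ≈-trans (θ-+ _ _) (≈-trans (+-cong (θ-ι 1ℤ) θ-s) (+-identityˡ s))

  θ-inverse : ∀ {f g} → f * g ≈ ι 1ℤ → θ g ≈ - (g * g * θ f)
  θ-inverse {f} {g} p = begin
    θ g ≈⟨ ≈-sym (cancel 1 p) ⟩
    θ g * (f * g) ^ 1 ≈⟨ solve 4 (λ f g x y → y :* (f :* g) :^ 1 := g :* (x :* g :+ f :* y) :- g :* g :* x) ≈-refl f g (θ f) (θ g) ⟩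
    g * (θ f * g + f * θ g) - g * g * θ f ≈⟨ +-congʳ (*-congˡ (≈-trans (≈-sym (θ-* f g)) (≈-trans (θ-cong p) (θ-ι 1ℤ)))) ⟩
    g * 0# - g * g * θ f ≈⟨ +-congʳ (zeroʳ g) ⟩
    0# - g * g * θ f ≈⟨ +-identityˡ _ ⟩
    - (g * g * θ f) ∎

  θ-^ : ∀ f n → θ (f ^ n) * f ≈ ι (+ n) * (f ^ n * θ f)
  θ-^ f zero = begin
    θ 1# * f ≈⟨ *-congʳ (≈-trans (θ-cong (≈-sym ι-1)) (θ-ι 1ℤ)) ⟩
    0# * f ≈⟨ zeroˡ f ⟩
    0# ≈⟨ ≈-sym (zeroˡ _) ⟩
    0# * (1# * θ f) ≈⟨ *-congʳ (≈-sym ι-0) ⟩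
    ι 0ℤ * (1# * θ f) ∎
  θ-^ f (suc n) = begin
    θ (f * f ^ n) * f ≈⟨ *-congʳ (θ-* f (f ^ n)) ⟩
    (θ f * f ^ n + f * θ (f ^ n)) * f ≈⟨ solve 4 (λ f g x y → (x :* g :+ f :* y) :* f := f :* g :* x :+ f :* (y :* f)) ≈-refl f (f ^ n) (θ f) (θ (f ^ n)) ⟩
    f * f ^ n * θ f + f * (θ (f ^ n) * f) ≈⟨ +-congˡ (*-congˡ (θ-^ f n)) ⟩
    f * f ^ n * θ f + f * (ι (+ n) * (f ^ n * θ f)) ≈⟨ solve 4 (λ f g x k → f :* g :* x :+ f :* (k :* (g :* x)) := (:1 :+ k) :* (f :* g :* x)) ≈-refl f (f ^ n) (θ f) (ι (+ n)) ⟩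
    (ι 1ℤ + ι (+ n)) * (f * f ^ n * θ f) ≈⟨ *-congʳ (≈-sym (ι-+ 1ℤ (+ n))) ⟩
    ι (+ suc n) * (f ^ suc n * θ f) ∎

  θ-1+s⁴ : θ U ≈ ι (+ 4) * 1+s ^ 3 * s
  θ-1+s⁴ = begin
    θ U ≈⟨ ≈-sym (cancel 1 1+s-inverse) ⟩
    θ U * (1+s * I) ^ 1 ≈⟨ solve 3 (λ u a I → u :* (a :* I) :^ 1 := u :* a :* I) ≈-refl (θ U) 1+s I ⟩
    θ U * 1+s * I ≈⟨ *-congʳ (≈-trans (θ-^ 1+s 4) (*-congˡ (*-congˡ θ-1+s))) ⟩
    ι (+ 4) * (1+s ^ 4 * s) * I ≈⟨ solve 3 (λ a s I → con (+ 4) :* (a :^ 4 :* s) :* I := con (+ 4) :* a :^ 3 :* s :* (a :* I) :^ 1) ≈-refl 1+s s I ⟩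
    ι (+ 4) * 1+s ^ 3 * s * (1+s * I) ^ 1 ≈⟨ cancel 1 1+s-inverse ⟩
    ι (+ 4) * 1+s ^ 3 * s ∎

  θ-1+s² : θ 1+s² ≈ ι (+ 2) * s * s
  θ-1+s² = begin
    θ 1+s² ≈⟨ ≈-trans (θ-+ _ _) (≈-trans (+-cong (θ-ι 1ℤ) (θ-* s s)) (+-identityˡ _)) ⟩
    θ s * s + s * θ s ≈⟨ +-cong (*-congʳ θ-s) (*-congˡ θ-s) ⟩
    s * s + s * s ≈⟨ solve 1 (λ s → s :* s :+ s :* s := con (+ 2) :* s :* s) ≈-refl s ⟩
    ι (+ 2) * s * s ∎

  θ-H : θ H ≈ H * dlog
  θ-H = begin
    θ H ≈⟨ θ-* U J ⟩
    θ U * J + U * θ J ≈⟨ +-cong (*-congʳ θ-1+s⁴) (*-congˡ (≈-trans (θ-inverse 1+s²-inverse) (-‿cong (*-congˡ θ-1+s²)))) ⟩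
    ι (+ 4) * 1+s ^ 3 * s * J + U * - (J * J * (ι (+ 2) * s * s)) ≈⟨ +-congʳ (≈-sym (cancel 1 1+s-inverse)) ⟩
    ι (+ 4) * 1+s ^ 3 * s * J * (1+s * I) ^ 1 + U * - (J * J * (ι (+ 2) * s * s))
      ≈⟨ solve 4 (λ a s I J → con (+ 4) :* a :^ 3 :* s :* J :* (a :* I) :^ 1 :+ a :^ 4 :* :- (J :* J :* (con (+ 2) :* s :* s))
           := a :^ 4 :* J :* (con (+ 4) :* s :* I :- con (+ 2) :* s :* s :* J)) ≈-refl 1+s s I J ⟩
    H * dlog ∎

  H⁻¹ : Carrier
  H⁻¹ = I ^ 4 * 1+s²

  H-inverse : H * H⁻¹ ≈ ι 1ℤ
  H-inverse = begin
    H * H⁻¹ ≈⟨ solve 4 (λ a c I J → a :^ 4 :* J :* (I :^ 4 :* c) := :1 :* (a :* I) :^ 4 :* (c :* J) :^ 1) ≈-refl 1+s 1+s² I J ⟩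
    ι 1ℤ * (1+s * I) ^ 4 * (1+s² * J) ^ 1 ≈⟨ cancel 1 1+s²-inverse ⟩
    ι 1ℤ * (1+s * I) ^ 4 ≈⟨ cancel 4 1+s-inverse ⟩
    ι 1ℤ ∎

  θ-H^ : ∀ n → θ (H ^ n) ≈ ι (+ n) * (H ^ n * dlog)
  θ-H^ n = begin
    θ (H ^ n) ≈⟨ ≈-sym (cancel 1 H-inverse) ⟩
    θ (H ^ n) * (H * H⁻¹) ^ 1 ≈⟨ solve 3 (λ u a I → u :* (a :* I) :^ 1 := u :* a :* I) ≈-refl (θ (H ^ n)) H H⁻¹ ⟩
    θ (H ^ n) * H * H⁻¹ ≈⟨ *-congʳ (≈-trans (θ-^ H n) (*-congˡ (*-congˡ θ-H))) ⟩
    ι (+ n) * (H ^ n * (H * dlog)) * H⁻¹ ≈⟨ solve 5 (λ n G H d H⁻¹ → n :* (G :* (H :* d)) :* H⁻¹ := n :* (G :* d) :* (H :* H⁻¹) :^ 1) ≈-refl (ι (+ n)) (H ^ n) H dlog H⁻¹ ⟩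
    ι (+ n) * (H ^ n * dlog) * (H * H⁻¹) ^ 1 ≈⟨ cancel 1 H-inverse ⟩
    ι (+ n) * (H ^ n * dlog) ∎

  -- Up to a power of 8 this is the residue of u^(-n-1) du at s = 0, and for n > 0 the form is exact.
  residue-suc : ∀ n → (ρ * H ^ suc n) [ suc n ] ≡ 0ℤ
  residue-suc n = ℤₚ.*-cancelˡ-≡ (+ suc n) _ _ (trans (sym lemma) (sym (ℤₚ.*-zeroʳ (+ suc n))))
    where
    G = H ^ suc n
    lemma : 0ℤ ≡ + suc n ℤ.* (ρ * G) [ suc n ]
    lemma = ≡-Reasoning.begin
      0ℤ ≡-Reasoning.≡⟨ sym (ℤₚ.+-inverseʳ (+ suc n ℤ.* G [ suc n ])) ⟩
      + suc n ℤ.* G [ suc n ] ℤ.- + suc n ℤ.* G [ suc n ]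
        ≡-Reasoning.≡⟨ cong₂ ℤ._+_ (sym ([]-ι* (+ suc n) G (suc n))) (trans (cong ℤ.-_ (sym ([]-θ G (suc n)))) (sym ([]-neg _ (suc n)))) ⟩
      (ι (+ suc n) * G) [ suc n ] ℤ.+ (- θ G) [ suc n ]
        ≡-Reasoning.≡⟨ sym ([]-+ _ _ (suc n)) ⟩
      (ι (+ suc n) * G - θ G) [ suc n ]
        ≡-Reasoning.≡⟨ []-cong (+-congˡ (-‿cong (θ-H^ (suc n)))) (suc n) ⟩
      (ι (+ suc n) * G - ι (+ suc n) * (G * dlog)) [ suc n ]
        ≡-Reasoning.≡⟨ []-cong (solve 3 (λ k G d → k :* G :- k :* (G :* d) := k :* ((:1 :- d) :* G)) ≈-refl (ι (+ suc n)) G dlog) (suc n) ⟩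
      (ι (+ suc n) * ((ι 1ℤ - dlog) * G)) [ suc n ]
        ≡-Reasoning.≡⟨ []-cong (*-congˡ (*-congʳ 1-dlog)) (suc n) ⟩
      (ι (+ suc n) * (ρ * G)) [ suc n ]
        ≡-Reasoning.≡⟨ []-ι* (+ suc n) (ρ * G) (suc n) ⟩
      + suc n ℤ.* (ρ * G) [ suc n ] ≡-Reasoning.∎

  residue-zero : (ρ * H ^ 0) [ 0 ] ≡ 1ℤ
  residue-zero = trans ([]-cong (*-identityʳ ρ) 0)
    (trans ([0]-* _ J) (cong₂ ℤ._*_ (trans ([0]-* _ I) (cong₂ ℤ._*_ [0]-1-s³ (series-[] _ 0))) (series-[] _ 0)))
    where
    [0]-1-s : 1-s [ 0 ] ≡ 1ℤ
    [0]-1-s = trans ([]-cong (solve 1 (λ s → :1 :- s := (:1 :+ s :* :- :1)) ≈-refl s) 0)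
      (trans ([]-+ _ _ 0) (cong₂ ℤ._+_ ι1-[0] ([0]-s* _)))
    [0]-1-s³ : (1-s ^ 3) [ 0 ] ≡ 1ℤ
    [0]-1-s³ = trans ([0]-* 1-s _) (cong₂ ℤ._*_ [0]-1-s (trans ([0]-* 1-s _) (cong₂ ℤ._*_ [0]-1-s (trans ([0]-* 1-s _) (cong₂ ℤ._*_ [0]-1-s [0]-1#)))))

-- Residues as binomial coefficients

module Coefficients where
  open Series
  open Residue
  open import Algebra.Properties.CommutativeSemiring.Exp commutativeSemiring using (_^_; ^-congˡ; ^-congʳ; ^-homo-*; ^-distrib-*)

  1-t : ι 1ℤ - t ≈ ι (+ 8) * s * H⁻¹
  1-t = ≈-trans (≈-sym (cancel 1 H-inverse))
    (≈-trans (solve 3 (λ t H H⁻¹ → (:1 :- t) :* (H :* H⁻¹) :^ 1 := (:1 :- t) :* H :* H⁻¹) ≈-refl t H H⁻¹)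
      (*-congʳ [1-t]*H))

  [1-t]*-[0] : ∀ F → ((ι 1ℤ - t) * F) [ 0 ] ≡ 0ℤ
  [1-t]*-[0] F = trans ([]-cong (≈-trans (*-congʳ 1-t)
      (solve 3 (λ s H⁻¹ F → con (+ 8) :* s :* H⁻¹ :* F := s :* (con (+ 8) :* H⁻¹ :* F)) ≈-refl s H⁻¹ F)) 0)
    ([0]-s* _)

  -- Since (1 - t) H = 8 s, a factor u = 1 - t turns one factor H into 8 s and lowers n by one.
  [1-t]*-[suc] : ∀ G n → ((ι 1ℤ - t) * (G * (ρ * H ^ suc n))) [ suc n ] ≡ + 8 ℤ.* (G * (ρ * H ^ n)) [ n ]
  [1-t]*-[suc] G n = trans
    ([]-cong (≈-trans
      (solve 5 (λ t G ρ H K → (:1 :- t) :* (G :* (ρ :* (H :* K))) := (:1 :- t) :* H :* (G :* (ρ :* K))) ≈-refl t G ρ H (H ^ n))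
      (≈-trans (*-congʳ [1-t]*H) (*-assoc _ _ _))) (suc n))
    (trans ([]-ι* (+ 8) _ (suc n)) (cong (+ 8 ℤ.*_) ([]-s* _ n)))

  []-split : ∀ {F G D : Carrier} n → F ≈ G + D → F [ n ] ≡ G [ n ] ℤ.+ D [ n ]
  []-split n p = trans ([]-cong p n) ([]-+ _ _ n)

  -- Because ρ ds/s = du/u and H = 8 s / u, this coefficient is 8ⁿ times that of uⁿ in (1 - u)^b.
  -- The induction on b writes t = 1 - u and ends in Pascal's rule.
  residue-t^ : ∀ b n → (t ^ b * (ρ * H ^ n)) [ n ] ≡ -[1+ 7 ] ℤ.^ n ℤ.* + (b choose n)
  residue-t^ zero zero = trans ([]-cong (*-identityˡ _) 0) residue-zero
  residue-t^ zero (suc n) = trans ([]-cong (*-identityˡ _) (suc n))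
    (trans (residue-suc n) (sym (ℤₚ.*-zeroʳ (-[1+ 7 ] ℤ.^ suc n))))
  residue-t^ (suc b) n = trans ([]-split n step) (lemma n)
    where
    F : ℕ → Carrier
    F n = t ^ b * (ρ * H ^ n)
    step : t * t ^ b * (ρ * H ^ n) ≈ F n + - ((ι 1ℤ - t) * F n)
    step = solve 3 (λ t T F → t :* T :* F := T :* F :+ :- ((:1 :- t) :* (T :* F))) ≈-refl t (t ^ b) (ρ * H ^ n)
    lemma : ∀ n → F n [ n ] ℤ.+ (- ((ι 1ℤ - t) * F n)) [ n ] ≡ -[1+ 7 ] ℤ.^ n ℤ.* + (suc b choose n)
    lemma zero = cong₂ ℤ._+_ (residue-t^ b 0) (trans ([]-neg _ 0) (cong ℤ.-_ ([1-t]*-[0] (F 0))))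
    lemma (suc n) = trans
      (cong₂ ℤ._+_ (residue-t^ b (suc n)) (trans ([]-neg _ (suc n)) (cong ℤ.-_ (trans ([1-t]*-[suc] (t ^ b) n) (cong (+ 8 ℤ.*_) (residue-t^ b n))))))
      (trans (scale-+ (-[1+ 7 ] ℤ.^ n) (+ (b choose suc n)) (+ (b choose n)))
        (cong (λ x → -[1+ 7 ] ℤ.^ suc n ℤ.* + x) (nCk+nC[k+1]≡[n+1]C[k+1] b n)))
      where
      scale-+ : ∀ e x y → -[1+ 7 ] ℤ.* e ℤ.* x ℤ.- + 8 ℤ.* (e ℤ.* y) ≡ -[1+ 7 ] ℤ.* e ℤ.* (y ℤ.+ x)
      scale-+ = ℤSolver.solve-∀

  -- The function expanded in u is now (1 - u)^(-b-1). From t t̄ = 1 comes t̄ = 1 + u t̄, which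
  -- lowers b in one term and n in the other.
  residue-t̄^ : ∀ b n → (t̄ ^ suc b * (ρ * H ^ n)) [ n ] ≡ (+ 8) ℤ.^ n ℤ.* + ((b ℕ.+ n) choose n)
  residue-t̄^ b n = trans ([]-split n step) (lemma b n)
    where
    step : t̄ * t̄ ^ b * (ρ * H ^ n) ≈ t̄ ^ b * (ρ * H ^ n) + (ι 1ℤ - t) * (t̄ ^ suc b * (ρ * H ^ n))
    step = ≈-trans
      (solve 4 (λ t̄ t T F → t̄ :* T :* F := T :* F :* (t :* t̄) :^ 1 :+ (t̄ :* T :* F :- T :* F :* (t :* t̄) :^ 1))
        ≈-refl t̄ t (t̄ ^ b) (ρ * H ^ n))
      (+-cong (cancel 1 t*t̄)
        (solve 4 (λ t̄ t T F → t̄ :* T :* F :- T :* F :* (t :* t̄) :^ 1 := (:1 :- t) :* (t̄ :* T :* F))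
          ≈-refl t̄ t (t̄ ^ b) (ρ * H ^ n)))
    lemma : ∀ b n → (t̄ ^ b * (ρ * H ^ n)) [ n ] ℤ.+ ((ι 1ℤ - t) * (t̄ ^ suc b * (ρ * H ^ n))) [ n ]
      ≡ (+ 8) ℤ.^ n ℤ.* + ((b ℕ.+ n) choose n)
    lemma zero zero = cong₂ ℤ._+_ (residue-t^ 0 0) ([1-t]*-[0] _)
    lemma (suc b) zero = cong₂ ℤ._+_ (residue-t̄^ b 0) ([1-t]*-[0] _)
    lemma zero (suc n) = trans
      (cong₂ ℤ._+_ (trans (residue-t^ 0 (suc n)) (ℤₚ.*-zeroʳ (-[1+ 7 ] ℤ.^ suc n)))
        (trans ([1-t]*-[suc] _ n) (cong (+ 8 ℤ.*_) (residue-t̄^ 0 n))))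
      (trans (ℤₚ.+-identityˡ _) (trans (sym (ℤₚ.*-assoc (+ 8) ((+ 8) ℤ.^ n) (+ (n choose n))))
        (cong (λ x → (+ 8) ℤ.^ suc n ℤ.* + x) (trans (nCn≡1 n) (sym (nCn≡1 (suc n)))))))
    lemma (suc b) (suc n) = trans
      (cong₂ ℤ._+_ (residue-t̄^ b (suc n)) (trans ([1-t]*-[suc] _ n) (cong (+ 8 ℤ.*_) (residue-t̄^ (suc b) n))))
      (trans (scale-+ ((+ 8) ℤ.^ n) (+ ((b ℕ.+ suc n) choose suc n)) (+ ((suc b ℕ.+ n) choose n)))
        (cong (λ x → (+ 8) ℤ.^ suc n ℤ.* + x)
          (trans (cong (λ k → (suc b ℕ.+ n) choose n ℕ.+ k choose suc n) (ℕₚ.+-suc b n))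
            (trans (nCk+nC[k+1]≡[n+1]C[k+1] (suc b ℕ.+ n) n) (cong (λ k → suc k choose suc n) (sym (ℕₚ.+-suc b n)))))))
      where
      scale-+ : ∀ e x y → + 8 ℤ.* e ℤ.* x ℤ.+ + 8 ℤ.* (e ℤ.* y) ≡ + 8 ℤ.* e ℤ.* (y ℤ.+ x)
      scale-+ = ℤSolver.solve-∀

  -- For y^(4k) dy / (y (1 - y⁴))^(4M+1) these are the contributions of the poles 0 and ∞: ψ M k is
  -- the coefficient of z^(M-k) in (1 - z)^(-4M-1). For M ≥ 1 truncated subtraction gives the right
  -- default, namely ψ = 0 for k > M and ω = 0 for k ≤ M.
  ψ ω : ℕ → ℕ → ℕ
  ψ M k = (M ℕ.* 5 ∸ k) choose (M ℕ.* 4)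
  ω M k = (k ∸ suc M) choose (M ℕ.* 4)

  M*5 : ∀ M → M ℕ.* 5 ≡ M ℕ.+ M ℕ.* 4
  M*5 M = ℕₚ.*-suc M 4

  ψ-≤ : ∀ M k → k ≤ M → ψ M k ≡ (M ∸ k ℕ.+ M ℕ.* 4) choose (M ℕ.* 4)
  ψ-≤ M k k≤M = cong (_choose (M ℕ.* 4)) (trans (cong (_∸ k) (M*5 M)) (ℕₚ.+-∸-comm (M ℕ.* 4) k≤M))

  0<M*4 : ∀ M → 1 ≤ M → 0 < M ℕ.* 4
  0<M*4 (suc M) _ = s≤s z≤n

  ψ-> : ∀ M k → 1 ≤ M → M < k → ψ M k ≡ 0
  ψ-> M k 1≤M M<k = k>n⇒nCk≡0 (ℕₚ.m<n+o⇒m∸n<o (M ℕ.* 5) k {{ℕ.>-nonZero (0<M*4 M 1≤M)}}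
    (subst (ℕ._< k ℕ.+ M ℕ.* 4) (sym (M*5 M)) (ℕₚ.+-monoˡ-< (M ℕ.* 4) M<k)))

  ω-≤ : ∀ M k → 1 ≤ M → k ≤ M → ω M k ≡ 0
  ω-≤ M k 1≤M k≤M = trans (cong (_choose (M ℕ.* 4)) (ℕₚ.m≤n⇒m∸n≡0 (ℕₚ.m≤n⇒m≤1+n k≤M))) (k>n⇒nCk≡0 (0<M*4 M 1≤M))

  -- ψ and ω are exchanged by k ↦ 6M + 1 - k, which reflects weights.
  ψ-reflect : ∀ M k l → k ℕ.+ l ≡ M ℕ.* 5 ℕ.+ suc M → ψ M k ≡ ω M l
  ψ-reflect M k l e = cong (_choose (M ℕ.* 4)) (lemma (ℕₚ.≤-total k (M ℕ.* 5)))
    where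
    lemma : _ → M ℕ.* 5 ∸ k ≡ l ∸ suc M
    lemma (inj₁ k≤) = begin
      M ℕ.* 5 ∸ k ≡⟨ sym (ℕₚ.m+n∸n≡m (M ℕ.* 5 ∸ k) (suc M)) ⟩
      M ℕ.* 5 ∸ k ℕ.+ suc M ∸ suc M ≡⟨ cong (_∸ suc M) (sym (ℕₚ.+-∸-comm (suc M) k≤)) ⟩
      M ℕ.* 5 ℕ.+ suc M ∸ k ∸ suc M ≡⟨ cong (λ x → x ∸ k ∸ suc M) (sym e) ⟩
      k ℕ.+ l ∸ k ∸ suc M ≡⟨ cong (_∸ suc M) (ℕₚ.m+n∸m≡n k l) ⟩
      l ∸ suc M ∎
      where open ≡-Reasoning
    lemma (inj₂ 5M≤k) = trans (ℕₚ.m≤n⇒m∸n≡0 5M≤k) (sym (ℕₚ.m≤n⇒m∸n≡0 (ℕₚ.+-cancelˡ-≤ k l (suc M)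
      (subst (ℕ._≤ k ℕ.+ suc M) (sym e) (ℕₚ.+-monoˡ-≤ (suc M) 5M≤k)))))

  [-8]^4M : ∀ M → -[1+ 7 ] ℤ.^ (M ℕ.* 4) ≡ (+ 8) ℤ.^ (M ℕ.* 4)
  [-8]^4M M = trans (cong (λ n → -[1+ 7 ] ℤ.^ n) (ℕₚ.*-comm M 4))
    (trans (sym (ℤₚ.^-*-assoc -[1+ 7 ] 4 M)) (trans (ℤₚ.^-*-assoc (+ 8) 4 M) (cong (λ n → (+ 8) ℤ.^ n) (ℕₚ.*-comm 4 M))))

  t^*t̄^ : ∀ k b → t ^ k * t̄ ^ (k ℕ.+ b) ≈ t̄ ^ b
  t^*t̄^ k b = ≈-trans (*-congˡ (^-homo-* t̄ k b)) (≈-trans (solve 3 (λ x y z → x :* (y :* z) := z :* (x :* y)) ≈-refl (t ^ k) (t̄ ^ k) (t̄ ^ b))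
    (≈-trans (*-congˡ (≈-sym (^-distrib-* t t̄ k))) (≈-trans (*-congˡ (^-congˡ k (≈-trans t*t̄ ι-1))) (lemma k))))
    where
    lemma : ∀ k → t̄ ^ b * 1# ^ k ≈ t̄ ^ b
    lemma zero = *-identityʳ _
    lemma (suc k) = ≈-trans (*-congˡ (*-identityˡ _)) (lemma k)

  t^*t̄^′ : ∀ k b → t ^ (k ℕ.+ b) * t̄ ^ k ≈ t ^ b
  t^*t̄^′ k b = ≈-trans (*-congʳ (^-homo-* t k b)) (≈-trans (solve 3 (λ x y z → x :* z :* y := z :* (x :* y)) ≈-refl (t ^ k) (t̄ ^ k) (t ^ b))
    (≈-trans (*-congˡ (≈-trans (*-congˡ (≈-sym (≈-reflexive (cong (t̄ ^_) (ℕₚ.+-identityʳ k))))) (t^*t̄^ k 0))) (*-identityʳ _)))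

  -- The exponent of t is k - M - 1. If it is negative, the expansion of a power of t̄ gives ψ;
  -- otherwise that of a power of t gives ω, with sign (-1)^(4M) = 1. The other summand vanishes in
  -- each case.
  residue-word : ∀ M k → 1 ≤ M →
    (t ^ k * (t̄ ^ suc M * (ρ * H ^ (M ℕ.* 4)))) [ M ℕ.* 4 ] ≡ (+ 8) ℤ.^ (M ℕ.* 4) ℤ.* + (ψ M k ℕ.+ ω M k)
  residue-word M k 1≤M with ℕₚ.≤-<-connex k M
  ... | inj₁ k≤M = trans
    ([]-cong (≈-trans (≈-sym (*-assoc _ _ _)) (*-congʳ
      (≈-trans (*-congˡ (^-congʳ t̄ (trans (sym (ℕₚ.m+[n∸m]≡n (ℕₚ.m≤n⇒m≤1+n k≤M))) (cong (k ℕ.+_) (ℕₚ.+-∸-assoc 1 k≤M)))))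
        (t^*t̄^ k (suc (M ∸ k)))))) (M ℕ.* 4))
    (trans (residue-t̄^ (M ∸ k) (M ℕ.* 4)) (cong (λ x → (+ 8) ℤ.^ (M ℕ.* 4) ℤ.* + x)
      (sym (trans (cong (ψ M k ℕ.+_) (ω-≤ M k 1≤M k≤M)) (trans (ℕₚ.+-identityʳ _) (ψ-≤ M k k≤M))))))
  ... | inj₂ M<k = trans
    ([]-cong (≈-trans (≈-sym (*-assoc _ _ _)) (*-congʳ
      (≈-trans (*-congʳ (^-congʳ t (sym (ℕₚ.m+[n∸m]≡n M<k)))) (t^*t̄^′ (suc M) (k ∸ suc M))))) (M ℕ.* 4))
    (trans (residue-t^ (k ∸ suc M) (M ℕ.* 4)) (cong₂ ℤ._*_ ([-8]^4M M)
      (cong +_ (sym (cong (ℕ._+ ω M k) (ψ-> M k 1≤M M<k))))))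

  s⁴*-[suc] : ∀ F n → (s ^ 4 * F) [ 4 ℕ.+ n ] ≡ F [ n ]
  s⁴*-[suc] F n = trans ([]-cong (solve 2 (λ s F → s :^ 4 :* F := s :* (s :* (s :* (s :* F)))) ≈-refl s F) (4 ℕ.+ n))
    (trans ([]-s* _ _) (trans ([]-s* _ _) (trans ([]-s* _ _) ([]-s* _ _))))

  s⁴*-[0] : ∀ F → (s ^ 4 * F) [ 0 ] ≡ 0ℤ
  s⁴*-[0] F = trans ([]-cong (*-assoc s _ F) 0) ([0]-s* _)

  E-inverse : (ι 1ℤ - s ^ 4) * E ≈ ι 1ℤ
  E-inverse = ≈-trans
    (solve 4 (λ s I I′ J → (:1 :- s :^ 4) :* (I :* I′ :* J) :=
      :1 :* ((:1 :+ s) :* I) :^ 1 :* ((:1 :- s) :* I′) :^ 1 :* ((:1 :+ s :* s) :* J) :^ 1) ≈-refl s I I′ J)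
    (≈-trans (cancel 1 1+s²-inverse) (≈-trans (cancel 1 1-s-inverse) (cancel 1 1+s-inverse)))

  -- E = 1 + s⁴ E reduces this to Pascal's rule.
  []-E^ : ∀ r k → (E ^ suc r) [ k ℕ.* 4 ] ≡ + ((k ℕ.+ r) choose r)
  []-E^ r k = trans ([]-split (k ℕ.* 4) step) (lemma r k)
    where
    step : E ^ suc r ≈ E ^ r + s ^ 4 * E ^ suc r
    step = ≈-trans (solve 3 (λ s E F → E :* F := F :* ((:1 :- s :^ 4) :* E) :^ 1 :+ s :^ 4 :* (E :* F)) ≈-refl s E (E ^ r))
      (+-congʳ (cancel 1 E-inverse))
    lemma : ∀ r k → (E ^ r) [ k ℕ.* 4 ] ℤ.+ (s ^ 4 * E ^ suc r) [ k ℕ.* 4 ] ≡ + ((k ℕ.+ r) choose r)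
    lemma zero zero = cong₂ ℤ._+_ [0]-1# (s⁴*-[0] _)
    lemma zero (suc k) = trans (cong₂ ℤ._+_ ([]-1# _) (trans (s⁴*-[suc] _ (k ℕ.* 4)) ([]-E^ zero k))) refl
    lemma (suc r) zero = trans (cong₂ ℤ._+_ ([]-E^ r 0) (s⁴*-[0] _))
      (trans (ℤₚ.+-identityʳ _) (cong +_ (trans (nCn≡1 r) (sym (nCn≡1 (suc r))))))
    lemma (suc r) (suc k) = trans
      (cong₂ ℤ._+_ ([]-E^ r (suc k)) (trans (s⁴*-[suc] _ (k ℕ.* 4)) ([]-E^ (suc r) k)))
      (cong +_ (trans (cong (λ x → (suc k ℕ.+ r) choose r ℕ.+ x choose suc r) (ℕₚ.+-suc k r))
        (trans (nCk+nC[k+1]≡[n+1]C[k+1] (suc k ℕ.+ r) r) (cong (λ x → suc x choose suc r) (sym (ℕₚ.+-suc k r))))))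

  s⁴^*-≤ : ∀ k n F → ((s ^ 4) ^ k * F) [ (k ℕ.+ n) ℕ.* 4 ] ≡ F [ n ℕ.* 4 ]
  s⁴^*-≤ zero n F = []-cong (*-identityˡ F) _
  s⁴^*-≤ (suc k) n F = trans ([]-cong (*-assoc _ _ F) _) (trans (s⁴*-[suc] _ _) (s⁴^*-≤ k n F))

  s⁴^*-> : ∀ k n F → n < k → ((s ^ 4) ^ k * F) [ n ℕ.* 4 ] ≡ 0ℤ
  s⁴^*-> (suc k) zero F _ = trans ([]-cong (*-assoc _ _ F) 0) (s⁴*-[0] _)
  s⁴^*-> (suc k) (suc n) F (s≤s n<k) = trans ([]-cong (*-assoc _ _ F) _) (trans (s⁴*-[suc] _ _) (s⁴^*-> k n F n<k))

  -- The pole at 0, read off directly. It gives the same ψ that `residue-word` finds at y = 1, and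
  -- this makes the two sides of MacWilliams comparable.
  []-s⁴^*E^ : ∀ M k → 1 ≤ M → ((s ^ 4) ^ k * E ^ suc (M ℕ.* 4)) [ M ℕ.* 4 ] ≡ + ψ M k
  []-s⁴^*E^ M k 1≤M with ℕₚ.≤-<-connex k M
  ... | inj₁ k≤M = trans (cong (λ x → ((s ^ 4) ^ k * E ^ suc (M ℕ.* 4)) [ x ℕ.* 4 ]) (sym (ℕₚ.m+[n∸m]≡n k≤M)))
    (trans (s⁴^*-≤ k (M ∸ k) _) (trans ([]-E^ (M ℕ.* 4) (M ∸ k)) (cong +_ (sym (ψ-≤ M k k≤M)))))
  ... | inj₂ M<k = trans (s⁴^*-> k M _ M<k) (cong +_ (sym (ψ-> M k 1≤M M<k)))

  eval : List ℤ → Carrier → Carrier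
  eval [] x = ι 0ℤ
  eval (q ∷ qs) x = ι q + x * eval qs x

  -- The linear functional zⁱ ↦ f i, applied to z^k q(z).
  dot : List ℤ → (ℕ → ℤ) → ℕ → ℤ
  dot [] f k = 0ℤ
  dot (q ∷ qs) f k = q ℤ.* f k ℤ.+ dot qs f (suc k)

  []-eval : ∀ {x F n} f → (∀ k → (x ^ k * F) [ n ] ≡ f k) → ∀ q k → (x ^ k * (eval q x * F)) [ n ] ≡ dot q f k
  []-eval {x} {F} {n} f p [] k = trans ([]-cong (solve 2 (λ y F → y :* (con 0ℤ :* F) := con 0ℤ) ≈-refl (x ^ k) F) n) (trans ([]-cong ι-0 n) ([]-0# n))
  []-eval {x} {F} {n} f p (q ∷ qs) k = trans
    ([]-split n (solve 5 (λ q x y e F → y :* ((q :+ x :* e) :* F) := q :* (y :* F) :+ x :* y :* (e :* F)) ≈-refl (ι q) x (x ^ k) (eval qs x) F))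
    (cong₂ ℤ._+_ (trans ([]-ι* q _ n) (cong (q ℤ.*_) (p k))) ([]-eval f p qs (suc k)))

-- Words, weights and linear codes

⊕-involutive : ∀ {n} (x y : Word n) → (x ⊕ y) ⊕ y ≡ x
⊕-involutive [] [] = refl
⊕-involutive (x ∷ xs) (y ∷ ys) = cong₂ _∷_
  (trans (𝔹ₚ.xor-assoc x y y) (trans (cong (x xor_) (𝔹ₚ.xor-same y)) (𝔹ₚ.xor-identityʳ x))) (⊕-involutive xs ys)

⟨,⟩-⊕ʳ : ∀ {n} (u x y : Word n) → ⟨ u , x ⊕ y ⟩ ≡ ⟨ u , x ⟩ xor ⟨ u , y ⟩
⟨,⟩-⊕ʳ [] [] [] = refl
⟨,⟩-⊕ʳ (u ∷ us) (x ∷ xs) (y ∷ ys) = trans (cong ((u ∧ (x xor y)) xor_) (⟨,⟩-⊕ʳ us xs ys)) (lemma u x y _ _)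
  where
  lemma : ∀ u x y a b → (u ∧ (x xor y)) xor (a xor b) ≡ ((u ∧ x) xor a) xor ((u ∧ y) xor b)
  lemma false x y a b = refl
  lemma true x y a b = interchange x y a b

find : ∀ {n} (p : Word n → Bool) → (∃ λ c → p c ≡ true) ⊎ (∀ c → p c ≡ false)
find {zero} p with p [] in eq
... | true = inj₁ ([] , eq)
... | false = inj₂ λ { [] → eq }
find {suc n} p with find (p ∘ (false ∷_)) | find (p ∘ (true ∷_))
... | inj₁ (c , q) | _ = inj₁ (false ∷ c , q)
... | inj₂ _ | inj₁ (c , q) = inj₁ (true ∷ c , q)
... | inj₂ f | inj₂ g = inj₂ λ { (false ∷ c) → f c ; (true ∷ c) → g c }

odd : ℕ → Bool
odd zero = false
odd (suc n) = not (odd n)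

parity : ∀ {n} (v : Word n) → foldr _ _xor_ false v ≡ odd (wt v)
parity [] = refl
parity (false ∷ v) = parity v
parity (true ∷ v) = cong not (parity v)

odd-4* : ∀ k → odd (k ℕ.* 4) ≡ false
odd-4* zero = refl
odd-4* (suc k) = trans (𝔹ₚ.not-involutive _) (trans (𝔹ₚ.not-involutive _) (odd-4* k))

ones : ∀ {n} → Word n
ones = Vec.replicate _ true

ones-∧ : ∀ {n} (c : Word n) → zipWith _∧_ ones c ≡ c
ones-∧ [] = refl
ones-∧ (x ∷ c) = cong (x ∷_) (ones-∧ c)

wt-complement : ∀ {n} (c : Word n) → wt c ℕ.+ wt (c ⊕ ones) ≡ n
wt-complement [] = refl
wt-complement (false ∷ c) = trans (ℕₚ.+-suc (wt c) _) (cong suc (wt-complement c))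
wt-complement (true ∷ c) = cong suc (wt-complement c)

wt-zero⇒zeroWord : ∀ {n} (c : Word n) → wt c ≡ 0 → c ≡ zeroWord
wt-zero⇒zeroWord [] _ = refl
wt-zero⇒zeroWord (false ∷ c) p = cong (false ∷_) (wt-zero⇒zeroWord c p)

wt-zeroWord : ∀ n → wt (zeroWord {n}) ≡ 0
wt-zeroWord zero = refl
wt-zeroWord (suc n) = wt-zeroWord n

Bool-iff : ∀ {a b} → (a ≡ true → b ≡ true) → (b ≡ true → a ≡ true) → a ≡ b
Bool-iff {false} {false} _ _ = refl
Bool-iff {false} {true} _ g = g refl
Bool-iff {true} {false} f _ = sym (f refl)
Bool-iff {true} {true} _ _ = refl

linear-shift : ∀ {n} {C : Code n} → IsLinear C → ∀ {v} → v ∈C C → ∀ c → C (c ⊕ v) ≡ C c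
linear-shift {C = C} (_ , add) {v} v∈ c = Bool-iff
  (λ p → subst (λ w → C w ≡ true) (⊕-involutive c v) (add (c ⊕ v) v p v∈))
  (λ p → add c v p v∈)

false≢true : false ≢ true
false≢true ()

-- Sums over all words

module WordSum {a ℓ} (R : CommutativeSemiring a ℓ) where
  open CommutativeSemiring R renaming (refl to ≈-refl; sym to ≈-sym; trans to ≈-trans)
  open import Algebra.Properties.CommutativeSemigroup +-commutativeSemigroup using () renaming (interchange to +-interchange)

  ∑ : ∀ {n} → (Word n → Carrier) → Carrier
  ∑ {zero} f = f []
  ∑ {suc n} f = ∑ (f ∘ (false ∷_)) + ∑ (f ∘ (true ∷_))

  χ : Bool → Carrier
  χ true = 1#
  χ false = 0#

  ∑-cong : ∀ {n} {f g : Word n → Carrier} → (∀ c → f c ≈ g c) → ∑ f ≈ ∑ g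
  ∑-cong {zero} p = p []
  ∑-cong {suc n} p = +-cong (∑-cong (p ∘ (false ∷_))) (∑-cong (p ∘ (true ∷_)))

  ∑-+ : ∀ {n} (f g : Word n → Carrier) → ∑ (λ c → f c + g c) ≈ ∑ f + ∑ g
  ∑-+ {zero} f g = ≈-refl
  ∑-+ {suc n} f g = ≈-trans (+-cong (∑-+ (f ∘ (false ∷_)) (g ∘ (false ∷_))) (∑-+ (f ∘ (true ∷_)) (g ∘ (true ∷_))))
    (+-interchange _ _ _ _)

  ∑-*ˡ : ∀ {n} x (f : Word n → Carrier) → ∑ (λ c → x * f c) ≈ x * ∑ f
  ∑-*ˡ {zero} x f = ≈-refl
  ∑-*ˡ {suc n} x f = ≈-trans (+-cong (∑-*ˡ x (f ∘ (false ∷_))) (∑-*ˡ x (f ∘ (true ∷_)))) (≈-sym (distribˡ x _ _))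

  ∑-*ʳ : ∀ {n} x (f : Word n → Carrier) → ∑ (λ c → f c * x) ≈ ∑ f * x
  ∑-*ʳ x f = ≈-trans (∑-cong (λ c → *-comm (f c) x)) (≈-trans (∑-*ˡ x f) (*-comm x _))

  ∑-0 : ∀ {n} → ∑ {n} (λ _ → 0#) ≈ 0#
  ∑-0 {zero} = ≈-refl
  ∑-0 {suc n} = ≈-trans (+-cong (∑-0 {n}) (∑-0 {n})) (+-identityˡ 0#)

  ∑-swap : ∀ {m n} (f : Word m → Word n → Carrier) → ∑ (λ x → ∑ (λ y → f x y)) ≈ ∑ (λ y → ∑ (λ x → f x y))
  ∑-swap {zero} f = ≈-refl
  ∑-swap {suc m} f = ≈-trans (+-cong (∑-swap (f ∘ (false ∷_))) (∑-swap (f ∘ (true ∷_)))) (≈-sym (∑-+ (λ y → ∑ (λ x → f (false ∷ x) y)) (λ y → ∑ (λ x → f (true ∷ x) y))))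

  ∑-shift : ∀ {n} (v : Word n) (f : Word n → Carrier) → ∑ (λ c → f (c ⊕ v)) ≈ ∑ f
  ∑-shift [] f = ≈-refl
  ∑-shift (false ∷ v) f = +-cong (∑-shift v (f ∘ (false ∷_))) (∑-shift v (f ∘ (true ∷_)))
  ∑-shift (true ∷ v) f = ≈-trans (+-cong (∑-shift v (f ∘ (true ∷_))) (∑-shift v (f ∘ (false ∷_)))) (+-comm _ _)

  ∑-wt0 : ∀ n → ∑ {n} (λ c → χ (wt c ℕ.≡ᵇ 0)) ≈ 1#
  ∑-wt0 zero = ≈-refl
  ∑-wt0 (suc n) = ≈-trans (+-cong (∑-wt0 n) (∑-0 {n})) (+-identityʳ 1#)

  χ-*-cong : ∀ b {x y} → (b ≡ true → x ≈ y) → χ b * x ≈ χ b * y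
  χ-*-cong true p = *-congˡ (p refl)
  χ-*-cong false p = ≈-trans (zeroˡ _) (≈-sym (zeroˡ _))

open WordSum ℕₚ.+-*-commutativeSemiring using () renaming (∑ to ∑ᴺ; χ to χᴺ)

sumWith : ∀ {A : Set} → (A → ℕ) → List A → ℕ
sumWith f [] = 0
sumWith f (x ∷ xs) = f x ℕ.+ sumWith f xs

sumWith-++ : ∀ {A : Set} (f : A → ℕ) xs ys → sumWith f (xs List.++ ys) ≡ sumWith f xs ℕ.+ sumWith f ys
sumWith-++ f [] ys = refl
sumWith-++ f (x ∷ xs) ys = trans (cong (f x ℕ.+_) (sumWith-++ f xs ys)) (sym (ℕₚ.+-assoc (f x) _ _))

sumWith-map : ∀ {A B : Set} (f : B → ℕ) (g : A → B) xs → sumWith f (List.map g xs) ≡ sumWith (f ∘ g) xs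
sumWith-map f g [] = refl
sumWith-map f g (x ∷ xs) = cong (f (g x) ℕ.+_) (sumWith-map f g xs)

sumWith-filterᵇ : ∀ {A : Set} (f : A → ℕ) p xs → sumWith f (filterᵇ p xs) ≡ sumWith (λ x → χᴺ (p x) ℕ.* f x) xs
sumWith-filterᵇ f p [] = refl
sumWith-filterᵇ f p (x ∷ xs) with p x
... | true = cong₂ ℕ._+_ (sym (ℕₚ.*-identityˡ (f x))) (sumWith-filterᵇ f p xs)
... | false = sumWith-filterᵇ f p xs

length-filterᵇ : ∀ {A : Set} p (xs : List A) → length (filterᵇ p xs) ≡ sumWith (χᴺ ∘ p) xs
length-filterᵇ p [] = refl
length-filterᵇ p (x ∷ xs) with p x
... | true = cong suc (length-filterᵇ p xs)
... | false = length-filterᵇ p xs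

sumWith-allWords : ∀ n (f : Word n → ℕ) → sumWith f (allWords n) ≡ ∑ᴺ f
sumWith-allWords zero f = ℕₚ.+-identityʳ (f [])
sumWith-allWords (suc n) f = trans (sumWith-++ f (List.map (false ∷_) (allWords n)) _) (cong₂ ℕ._+_
  (trans (sumWith-map f (false ∷_) (allWords n)) (sumWith-allWords n _))
  (trans (sumWith-map f (true ∷_) (allWords n)) (sumWith-allWords n _)))

module Σℕ = WordSum ℕₚ.+-*-commutativeSemiring
module Σℤ = WordSum ℤₚ.+-*-commutativeSemiring

-- The MacWilliams identity

module Duality where
  open Series
  open Residue
  open import Algebra.Properties.CommutativeSemiring.Exp commutativeSemiring using (_^_)
  open import Relation.Binary.Reasoning.Setoid setoid
  open WordSum commutativeSemiring

  mon : ∀ {n} → Carrier → Carrier → Word n → Carrier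
  mon x y [] = ι 1ℤ
  mon x y (false ∷ c) = x * mon x y c
  mon x y (true ∷ c) = y * mon x y c

  sgn : Bool → Carrier
  sgn false = ι 1ℤ
  sgn true = - ι 1ℤ

  sgn-xor : ∀ a b → sgn (a xor b) ≈ sgn a * sgn b
  sgn-xor false b = solve 1 (λ x → x := :1 :* x) ≈-refl (sgn b)
  sgn-xor true false = solve 0 (:- :1 := :- :1 :* :1) ≈-refl
  sgn-xor true true = solve 0 (:1 := :- :1 :* :- :1) ≈-refl

  -- When the product over the coordinates is expanded, u records where the term with y is chosen,
  -- and each such place inside c contributes a sign.
  mon-expand : ∀ {n} x y (c : Word n) → mon (x + y) (x - y) c ≈ ∑ (λ u → sgn ⟨ u , c ⟩ * mon x y u)
  mon-expand x y [] = solve 0 (:1 := :1 :* :1) ≈-refl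
  mon-expand x y (b ∷ c) = begin
    mon (x + y) (x - y) (b ∷ c) ≈⟨ head b ⟩
    (x + sgn b * y) * mon (x + y) (x - y) c ≈⟨ *-congˡ (mon-expand x y c) ⟩
    (x + sgn b * y) * ∑ F ≈⟨ distribʳ _ _ _ ⟩
    x * ∑ F + sgn b * y * ∑ F ≈⟨ +-cong (≈-sym (∑-*ˡ x F)) (≈-sym (∑-*ˡ (sgn b * y) F)) ⟩
    ∑ (λ u → x * F u) + ∑ (λ u → sgn b * y * F u)
      ≈⟨ +-cong (∑-cong λ u → solve 3 (λ x f m → x :* (f :* m) := f :* (x :* m)) ≈-refl x (sgn ⟨ u , c ⟩) (mon x y u))
           (∑-cong λ u → ≈-trans
             (solve 4 (λ y b f m → b :* y :* (f :* m) := b :* f :* (y :* m)) ≈-refl y (sgn b) (sgn ⟨ u , c ⟩) (mon x y u))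
             (*-congʳ (≈-sym (sgn-xor b ⟨ u , c ⟩)))) ⟩
    ∑ (λ u → sgn ⟨ u , b ∷ c ⟩ * mon x y u) ∎
    where
    F : _ → Carrier
    F u = sgn ⟨ u , c ⟩ * mon x y u
    head : ∀ b → mon (x + y) (x - y) (b ∷ c) ≈ (x + sgn b * y) * mon (x + y) (x - y) c
    head false = solve 3 (λ x y m → (x :+ y) :* m := (x :+ :1 :* y) :* m) ≈-refl x y _
    head true = solve 3 (λ x y m → (x :- y) :* m := (x :+ :- :1 :* y) :* m) ≈-refl x y _

  neg-fixed⇒0 : ∀ f → f ≈ - f → f ≈ 0#
  neg-fixed⇒0 f p = ext λ n → trans (lemma _ (trans ([]-cong p n) ([]-neg f n))) (sym ([]-0# n))
    where
    lemma : ∀ z → z ≡ ℤ.- z → z ≡ 0ℤ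
    lemma (+ zero) _ = refl
    lemma (+ suc n) ()
    lemma -[1+ n ] ()

  -- Orthogonality of characters. For u outside C, self-duality provides v in C with ⟨ u , v ⟩ = 1;
  -- translation by v negates the sum, and over ℤ a series equal to its negative is 0.
  character-sum : ∀ {n} {C : Code n} → IsLinear C → IsSelfDual C → ∀ u →
    ∑ (λ c → χ (C c) * sgn ⟨ u , c ⟩) ≈ χ (C u) * ∑ (λ c → χ (C c))
  character-sum {C = C} lin dual u with C u in u?
  ... | true = ≈-trans (∑-cong λ c → ≈-trans
      (χ-*-cong (C c) λ c∈ → ≈-trans (≈-reflexive (cong sgn (Equivalence.to (dual u) u? c c∈))) ι-1) (*-identityʳ _))
    (≈-sym (*-identityˡ _))
  ... | false with find (λ c → C c ∧ ⟨ u , c ⟩)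
  ...   | inj₂ none = ⊥-elim (false≢true (trans (sym u?) (Equivalence.from (dual u) λ c c∈ → trans (sym (cong (_∧ ⟨ u , c ⟩) c∈)) (none c))))
  ...   | inj₁ (v , q) with C v in v∈
  ...     | true = ≈-trans (neg-fixed⇒0 _ (begin
    ∑ F ≈⟨ ≈-sym (∑-shift v F) ⟩
    ∑ (λ c → F (c ⊕ v)) ≈⟨ (∑-cong λ c → ≈-trans
         (*-cong (≈-reflexive (cong χ (linear-shift {C = C} lin v∈ c)))
           (≈-trans (≈-reflexive (cong sgn (trans (⟨,⟩-⊕ʳ u c v) (cong (⟨ u , c ⟩ xor_) q)))) (sgn-xor ⟨ u , c ⟩ true)))
         (solve 2 (λ x y → x :* (y :* :- :1) := :- :1 :* (x :* y)) ≈-refl (χ (C c)) (sgn ⟨ u , c ⟩))) ⟩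
    ∑ (λ c → - ι 1ℤ * F c) ≈⟨ ∑-*ˡ (- ι 1ℤ) F ⟩
    - ι 1ℤ * ∑ F ≈⟨ solve 1 (λ x → :- :1 :* x := :- x) ≈-refl (∑ F) ⟩
    - ∑ F ∎)) (≈-sym (zeroˡ _))
    where
    F : _ → Carrier
    F c = χ (C c) * sgn ⟨ u , c ⟩

  MacWilliams : ∀ {n} {C : Code n} → IsLinear C → IsSelfDual C → ∀ x y →
    ∑ (λ c → χ (C c) * mon (x + y) (x - y) c) ≈ ∑ (λ c → χ (C c)) * ∑ (λ u → χ (C u) * mon x y u)
  MacWilliams {n} {C} lin dual x y = begin
    ∑ (λ c → χ (C c) * mon (x + y) (x - y) c)
      ≈⟨ (∑-cong λ c → ≈-trans (*-congˡ (mon-expand x y c)) (≈-sym (∑-*ˡ (χ (C c)) λ u → sgn ⟨ u , c ⟩ * mon x y u))) ⟩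
    ∑ (λ c → ∑ (λ u → χ (C c) * (sgn ⟨ u , c ⟩ * mon x y u)))
      ≈⟨ ∑-swap {n} {n} (λ c u → χ (C c) * (sgn ⟨ u , c ⟩ * mon x y u)) ⟩
    ∑ (λ u → ∑ (λ c → χ (C c) * (sgn ⟨ u , c ⟩ * mon x y u)))
      ≈⟨ (∑-cong λ u → ≈-trans (∑-cong λ c → ≈-sym (*-assoc (χ (C c)) (sgn ⟨ u , c ⟩) (mon x y u)))
           (≈-trans (∑-*ʳ (mon x y u) λ c → χ (C c) * sgn ⟨ u , c ⟩) (*-congʳ (character-sum lin dual u)))) ⟩
    ∑ (λ u → χ (C u) * ∑ (λ c → χ (C c)) * mon x y u)
      ≈⟨ (∑-cong λ u → solve 3 (λ x y z → x :* y :* z := y :* (x :* z)) ≈-refl (χ (C u)) (∑ (λ c → χ (C c))) (mon x y u)) ⟩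
    ∑ (λ u → ∑ (λ c → χ (C c)) * (χ (C u) * mon x y u)) ≈⟨ ∑-*ˡ (∑ (λ c → χ (C c))) (λ u → χ (C u) * mon x y u) ⟩
    ∑ (λ c → χ (C c)) * ∑ (λ u → χ (C u) * mon x y u) ∎

  ∑-ι : ∀ {n} (p : Word n → Bool) → ∑ (λ c → χ (p c)) ≈ ι (+ Σℕ.∑ (λ c → Σℕ.χ (p c)))
  ∑-ι {zero} p with p []
  ... | true = ≈-sym ι-1
  ... | false = ≈-sym ι-0
  ∑-ι {suc n} p = ≈-trans (+-cong (∑-ι (p ∘ (false ∷_))) (∑-ι (p ∘ (true ∷_)))) (≈-sym (ι-+ _ _))

  []-∑ : ∀ {n} (f : Word n → Carrier) k → ∑ f [ k ] ≡ Σℤ.∑ (λ c → f c [ k ])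
  []-∑ {zero} f k = refl
  []-∑ {suc n} f k = trans ([]-+ _ _ k) (cong₂ ℤ._+_ ([]-∑ (f ∘ (false ∷_)) k) ([]-∑ (f ∘ (true ∷_)) k))

  []-χ : ∀ b f k → (χ b * f) [ k ] ≡ Σℤ.χ b ℤ.* f [ k ]
  []-χ true f k = trans ([]-cong (*-congʳ (≈-sym ι-1)) k) ([]-ι* 1ℤ f k)
  []-χ false f k = trans ([]-cong (*-congʳ (≈-sym ι-0)) k) ([]-ι* 0ℤ f k)

  mon-1-s : ∀ {n} (c : Word n) → mon (ι 1ℤ) s c ≈ s ^ wt c
  mon-1-s [] = ι-1
  mon-1-s (false ∷ c) = ≈-trans (solve 1 (λ x → :1 :* x := x) ≈-refl _) (mon-1-s c)
  mon-1-s (true ∷ c) = *-congˡ (mon-1-s c)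

  mon-wt : ∀ {n} x y z (c : Word n) → y ≈ x * z → mon x y c ≈ x ^ n * z ^ wt c
  mon-wt x y z [] p = ≈-trans ι-1 (≈-sym (*-identityˡ 1#))
  mon-wt x y z (false ∷ c) p = ≈-trans (*-congˡ (mon-wt x y z c p)) (≈-sym (*-assoc _ _ _))
  mon-wt {suc n} x y z (true ∷ c) p = ≈-trans (*-cong p (mon-wt x y z c p))
    (solve 4 (λ x z u v → x :* z :* (u :* v) := x :* u :* (z :* v)) ≈-refl x z (x ^ n) (z ^ wt c))

  1-s≈ : 1-s ≈ 1+s * (1-s * I)
  1-s≈ = ≈-trans (≈-sym (cancel 1 1+s-inverse)) (solve 3 (λ a b I → b :* (a :* I) :^ 1 := a :* (b :* I)) ≈-refl 1+s 1-s I)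

-- The linear relation between the weight counts

module WeightRelations where
  open Series
  open Residue
  open Coefficients
  open Duality
  open import Algebra.Properties.CommutativeSemiring.Exp commutativeSemiring using (_^_; ^-congˡ; ^-congʳ; ^-homo-*; ^-assocʳ; ^-distrib-*)
  open import Relation.Binary.Reasoning.Setoid setoid using (begin_; step-≈-⟩; _∎)
  open WordSum commutativeSemiring

  dot-++ : ∀ p q f k → dot (p ++ q) f k ≡ dot p f k ℤ.+ dot q f (length p ℕ.+ k)
  dot-++ [] q f k = sym (ℤₚ.+-identityˡ _)
  dot-++ (x ∷ p) q f k = trans (cong (λ z → x ℤ.* f k ℤ.+ z) (trans (dot-++ p q f (suc k)) (cong (λ i → dot p f (suc k) ℤ.+ dot q f i) (ℕₚ.+-suc (length p) k))))
    (sym (ℤₚ.+-assoc (x ℤ.* f k) _ _))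

  -- Reversing q reflects the indices: a coefficient that meets f at x meets g at y, with x + y
  -- constant.
  dot-reverse : ∀ q f g k l → (∀ x y → suc (x ℕ.+ y) ≡ k ℕ.+ l ℕ.+ length q → f x ≡ g y) →
    dot (reverse q) f k ≡ dot q g l
  dot-reverse [] f g k l p = refl
  dot-reverse (z ∷ q) f g k l p = begin′
    dot (reverse (z ∷ q)) f k ≡⟨ cong (λ r → dot r f k) (Listₚ.unfold-reverse z q) ⟩
    dot (reverse q ∷ʳ z) f k ≡⟨ dot-++ (reverse q) (z ∷ []) f k ⟩
    dot (reverse q) f k ℤ.+ (z ℤ.* f (length (reverse q) ℕ.+ k) ℤ.+ 0ℤ)
      ≡⟨ cong₂ ℤ._+_
           (dot-reverse q f g k (suc l) λ x y e → p x y (trans e (trans (cong (ℕ._+ length q) (ℕₚ.+-suc k l)) (sym (ℕₚ.+-suc (k ℕ.+ l) (length q))))))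
           (trans (ℤₚ.+-identityʳ _) (cong (z ℤ.*_) (p _ l (trans (cong (λ i → suc (i ℕ.+ k ℕ.+ l)) (Listₚ.length-reverse q)) (index (length q) k l))))) ⟩
    dot q g (suc l) ℤ.+ z ℤ.* g l ≡⟨ ℤₚ.+-comm (dot q g (suc l)) _ ⟩
    dot (z ∷ q) g l ∎′
    where
    open ≡-Reasoning renaming (begin_ to begin′_; _∎ to _∎′)
    index : ∀ n k l → suc (n ℕ.+ k ℕ.+ l) ≡ k ℕ.+ l ℕ.+ suc n
    index = ℕSolver.solve-∀

  dot-scale-+ : ∀ q z f g k → dot q (λ i → z ℤ.* + (f i ℕ.+ g i)) k ≡ z ℤ.* (dot q (+_ ∘ f) k ℤ.+ dot q (+_ ∘ g) k)
  dot-scale-+ [] z f g k = sym (ℤₚ.*-zeroʳ z)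
  dot-scale-+ (x ∷ q) z f g k = trans (cong (λ d → x ℤ.* (z ℤ.* + (f k ℕ.+ g k)) ℤ.+ d) (dot-scale-+ q z f g (suc k)))
    (lemma x z (+ f k) (+ g k) _ _)
    where
    lemma : ∀ x z a b c d → x ℤ.* (z ℤ.* (a ℤ.+ b)) ℤ.+ z ℤ.* (c ℤ.+ d) ≡ z ℤ.* ((x ℤ.* a ℤ.+ c) ℤ.+ (x ℤ.* b ℤ.+ d))
    lemma = ℤSolver.solve-∀

  ones-∈ : ∀ {n} {C : Code n} → IsSelfDual C → IsDoublyEven C → ones ∈C C
  ones-∈ dual even = Equivalence.from (dual ones) λ c c∈ →
    trans (cong (foldr _ _xor_ false) (ones-∧ c)) (trans (parity c) (lemma (wt c) (even c c∈)))
    where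
    lemma : ∀ w → 4 ∣ w → odd w ≡ false
    lemma _ (divides k refl) = odd-4* k

  -- D is the degree of Q in y⁴, and 6m + D = 6M + 1 is a quarter of the degree 24M + 4 of W Q.
  -- `semi` says that Q(1 + s, 1 - s) = -4^D Q(1, s): leaving out the division by √2 costs √2 to the
  -- power 4D.
  module WeightRelation (M m D : ℕ) (q : List ℤ) (1≤M : 1 ≤ M) (deg : 6 ℕ.* m ℕ.+ D ≡ suc (6 ℕ.* M))
    (len : length q ≡ suc D) (palindrome : reverse q ≡ q)
    (semi : ι (ℤ.- ((+ 4) ℤ.^ D)) * eval q (s ^ 4) ≈ eval q t * U ^ D) where

    K : Carrier
    K = eval q (s ^ 4) * E ^ suc (M ℕ.* 4)

    ε : ℤ
    ε = ℤ.- ((+ 4) ℤ.^ D)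

    U^*E^ : U ^ (6 ℕ.* m) * U ^ D * E ^ suc (M ℕ.* 4) ≈ t̄ ^ suc M * (ρ * H ^ (M ℕ.* 4))
    U^*E^ = begin
      U ^ (6 ℕ.* m) * U ^ D * (E * E ^ (M ℕ.* 4))
        ≈⟨ *-cong (≈-trans (≈-sym (^-homo-* U (6 ℕ.* m) D)) (≈-trans (^-congʳ U deg) (*-congˡ (≈-sym (^-assocʳ U 6 M)))))
             (*-congˡ (≈-trans (^-congʳ E (ℕₚ.*-comm M 4)) (≈-sym (^-assocʳ E 4 M)))) ⟩
      U * (U ^ 6) ^ M * (E * (E ^ 4) ^ M)
        ≈⟨ solve 4 (λ u v e f → u :* v :* (e :* f) := (u :* e) :* (v :* f)) ≈-refl U ((U ^ 6) ^ M) E ((E ^ 4) ^ M) ⟩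
      (U * E) * ((U ^ 6) ^ M * (E ^ 4) ^ M)
        ≈⟨ *-cong U*E (≈-trans (≈-sym (^-distrib-* (U ^ 6) (E ^ 4) M)) (≈-trans (^-congˡ M U⁶*E⁴) (^-distrib-* t̄ (H ^ 4) M))) ⟩
      t̄ * ρ * (t̄ ^ M * (H ^ 4) ^ M)
        ≈⟨ *-congˡ (*-congˡ (≈-trans (^-assocʳ H 4 M) (^-congʳ H (ℕₚ.*-comm 4 M)))) ⟩
      t̄ * ρ * (t̄ ^ M * H ^ (M ℕ.* 4))
        ≈⟨ solve 4 (λ u r v h → u :* r :* (v :* h) := u :* v :* (r :* h)) ≈-refl t̄ ρ (t̄ ^ M) (H ^ (M ℕ.* 4)) ⟩
      t̄ ^ suc M * (ρ * H ^ (M ℕ.* 4)) ∎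

    -- The left side carries the residue at y = 1 of the form attached to the word c; the right side yields its
    -- residues at y = 0 and y = ∞ (ψ and ω in residue-word).
    transformed : ∀ (c : Word (24 ℕ.* m)) j → wt c ≡ j ℕ.* 4 →
      ι ε * (mon 1+s 1-s c * K) ≈ t ^ j * (eval q t * (t̄ ^ suc M * (ρ * H ^ (M ℕ.* 4))))
    transformed c j wt≡ = begin
      ι ε * (mon 1+s 1-s c * K)
        ≈⟨ *-congˡ (*-congʳ (≈-trans (mon-wt 1+s 1-s (1-s * I) c 1-s≈)
             (*-cong (≈-trans (^-congʳ 1+s (24m m)) (≈-sym (^-assocʳ 1+s 4 (6 ℕ.* m))))
               (≈-trans (^-congʳ (1-s * I) (trans wt≡ (ℕₚ.*-comm j 4))) (≈-sym (^-assocʳ (1-s * I) 4 j)))))) ⟩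
      ι ε * (U ^ (6 ℕ.* m) * t ^ j * K)
        ≈⟨ solve 5 (λ ε u t q e → ε :* (u :* t :* (q :* e)) := t :* u :* (ε :* q) :* e) ≈-refl
             (ι ε) (U ^ (6 ℕ.* m)) (t ^ j) (eval q (s ^ 4)) (E ^ suc (M ℕ.* 4)) ⟩
      t ^ j * U ^ (6 ℕ.* m) * (ι ε * eval q (s ^ 4)) * E ^ suc (M ℕ.* 4)
        ≈⟨ *-congʳ (*-congˡ semi) ⟩
      t ^ j * U ^ (6 ℕ.* m) * (eval q t * U ^ D) * E ^ suc (M ℕ.* 4)
        ≈⟨ solve 5 (λ t u q v e → t :* u :* (q :* v) :* e := t :* (q :* (u :* v :* e))) ≈-refl
             (t ^ j) (U ^ (6 ℕ.* m)) (eval q t) (U ^ D) (E ^ suc (M ℕ.* 4)) ⟩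
      t ^ j * (eval q t * (U ^ (6 ℕ.* m) * U ^ D * E ^ suc (M ℕ.* 4)))
        ≈⟨ *-congˡ (*-congˡ U^*E^) ⟩
      t ^ j * (eval q t * (t̄ ^ suc M * (ρ * H ^ (M ℕ.* 4)))) ∎
      where
      24m : ∀ m → 24 ℕ.* m ≡ 4 ℕ.* (6 ℕ.* m)
      24m = ℕSolver.solve-∀

    R : ℕ → ℤ
    R j = dot q (λ k → + ψ M k) j

    N : ℕ
    N = M ℕ.* 4

    -- The ω-part at j is the ψ-part at the complementary weight j′. Indices paired by the
    -- palindrome q have the sum 6m + D = 6M + 1, and this is the reflection that exchanges ψ and ω.
    []-transformed : ∀ (c : Word (24 ℕ.* m)) j j′ → wt c ≡ j ℕ.* 4 → j ℕ.+ j′ ≡ 6 ℕ.* m →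
      (ι ε * (mon 1+s 1-s c * K)) [ N ] ≡ (+ 8) ℤ.^ N ℤ.* (R j ℤ.+ R j′)
    []-transformed c j j′ wt≡ jj′ = trans ([]-cong (transformed c j wt≡) N)
      (trans ([]-eval _ (λ k → residue-word M k 1≤M) q j)
        (trans (dot-scale-+ q ((+ 8) ℤ.^ N) (ψ M) (ω M) j) (cong (λ x → (+ 8) ℤ.^ N ℤ.* (R j ℤ.+ x)) (sym reflected))))
      where
      reflected : R j′ ≡ dot q (λ k → + ω M k) j
      reflected = trans (cong (λ r → dot r (λ k → + ψ M k) j′) (sym palindrome))
        (dot-reverse q _ _ j′ j λ x y e → cong +_ (ψ-reflect M x y (ℕₚ.suc-injective (trans e
          (trans (cong₂ ℕ._+_ (trans (ℕₚ.+-comm j′ j) jj′) len) (trans (ℕₚ.+-suc _ D) (cong suc (trans deg (6M+1 M)))))))))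
        where
        6M+1 : ∀ M → suc (6 ℕ.* M) ≡ M ℕ.* 5 ℕ.+ suc M
        6M+1 = ℕSolver.solve-∀

    []-original : ∀ (c : Word (24 ℕ.* m)) j → wt c ≡ j ℕ.* 4 → (mon (ι 1ℤ) s c * K) [ N ] ≡ R j
    []-original c j wt≡ = trans
      ([]-cong (*-congʳ (≈-trans (mon-1-s c) (≈-trans (^-congʳ s (trans wt≡ (ℕₚ.*-comm j 4))) (≈-sym (^-assocʳ s 4 j))))) N)
      ([]-eval _ (λ k → []-s⁴^*E^ M k 1≤M) q j)

    module _ {C : Code (24 ℕ.* m)} (lin : IsLinear C) (dual : IsSelfDual C) (even : IsDoublyEven C)
      (dim : HasDimension C (12 ℕ.* m)) where

      quarter : Word (24 ℕ.* m) → ℕ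
      quarter c = wt c ℕ./ 4

      wt-quarter : ∀ c → c ∈C C → wt c ≡ quarter c ℕ.* 4
      wt-quarter c c∈ = lemma (wt c) (even c c∈)
        where
        lemma : ∀ w → 4 ∣ w → w ≡ w ℕ./ 4 ℕ.* 4
        lemma _ (divides k refl) = cong (ℕ._* 4) (sym (m*n/n≡m k 4))

      size≡ : Σℕ.∑ (λ c → Σℕ.χ (C c)) ≡ 2 ℕ.^ (12 ℕ.* m)
      size≡ = trans (sym (sumWith-allWords (24 ℕ.* m) (Σℕ.χ ∘ C))) (trans (sym (length-filterᵇ C (allWords (24 ℕ.* m)))) dim)

      X Y : ℤ
      X = Σℤ.∑ (λ c → Σℤ.χ (C c) ℤ.* R (quarter c))
      Y = Σℤ.∑ (λ c → Σℤ.χ (C c) ℤ.* R (quarter (c ⊕ ones)))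

      1∈ : ones ∈C C
      1∈ = ones-∈ {C = C} dual even

      -- Complementation permutes C, since the all-one word is orthogonal to every word of even
      -- weight and so lies in C.
      Y≡X : Y ≡ X
      Y≡X = trans (Σℤ.∑-cong λ c → cong (λ b → Σℤ.χ b ℤ.* R (quarter (c ⊕ ones))) (sym (linear-shift {C = C} lin 1∈ c)))
        (Σℤ.∑-shift ones (λ c → Σℤ.χ (C c) ℤ.* R (quarter c)))

      quarters : ∀ c → c ∈C C → quarter c ℕ.+ quarter (c ⊕ ones) ≡ 6 ℕ.* m
      quarters c c∈ = ℕₚ.*-cancelʳ-≡ _ _ 4 (trans (ℕₚ.*-distribʳ-+ 4 (quarter c) _)
        (trans (cong₂ ℕ._+_ (sym (wt-quarter c c∈)) (sym (wt-quarter (c ⊕ ones) (trans (linear-shift {C = C} lin 1∈ c) c∈))))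
          (trans (wt-complement c) (24m m))))
        where
        24m : ∀ m → 24 ℕ.* m ≡ 6 ℕ.* m ℕ.* 4
        24m = ℕSolver.solve-∀

      left right : Carrier
      left = ∑ (λ c → χ (C c) * (ι ε * (mon 1+s 1-s c * K)))
      right = ι ε * (ι (+ (2 ℕ.^ (12 ℕ.* m))) * ∑ (λ c → χ (C c) * (mon (ι 1ℤ) s c * K)))

      left≈right : left ≈ right
      left≈right = begin
        left ≈⟨ (∑-cong λ c → solve 4 (λ x e m k → x :* (e :* (m :* k)) := x :* m :* (e :* k)) ≈-refl (χ (C c)) (ι ε) (mon 1+s 1-s c) K) ⟩
        ∑ (λ c → χ (C c) * mon 1+s 1-s c * (ι ε * K)) ≈⟨ ∑-*ʳ (ι ε * K) (λ c → χ (C c) * mon 1+s 1-s c) ⟩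
        ∑ (λ c → χ (C c) * mon 1+s 1-s c) * (ι ε * K) ≈⟨ *-congʳ (MacWilliams {C = C} lin dual (ι 1ℤ) s) ⟩
        ∑ (λ c → χ (C c)) * ∑ (λ c → χ (C c) * mon (ι 1ℤ) s c) * (ι ε * K)
          ≈⟨ *-congʳ (*-congʳ (≈-trans (∑-ι C) (≈-reflexive (cong (ι ∘ +_) size≡)))) ⟩
        ι (+ (2 ℕ.^ (12 ℕ.* m))) * ∑ (λ c → χ (C c) * mon (ι 1ℤ) s c) * (ι ε * K)
          ≈⟨ solve 4 (λ p x e k → p :* x :* (e :* k) := e :* (p :* (x :* k))) ≈-refl _ (∑ (λ c → χ (C c) * mon (ι 1ℤ) s c)) (ι ε) K ⟩
        ι ε * (ι (+ (2 ℕ.^ (12 ℕ.* m))) * (∑ (λ c → χ (C c) * mon (ι 1ℤ) s c) * K))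
          ≈⟨ *-congˡ (*-congˡ (≈-trans (≈-sym (∑-*ʳ K λ c → χ (C c) * mon (ι 1ℤ) s c)) (∑-cong λ c → *-assoc (χ (C c)) (mon (ι 1ℤ) s c) K))) ⟩
        right ∎

      left-[] : left [ N ] ≡ (+ 8) ℤ.^ N ℤ.* (X ℤ.+ X)
      left-[] = trans ([]-∑ (λ c → χ (C c) * (ι ε * (mon 1+s 1-s c * K))) N) (trans
        (Σℤ.∑-cong λ c → trans ([]-χ (C c) _ N) (trans
          (Σℤ.χ-*-cong (C c) λ c∈ → []-transformed c (quarter c) (quarter (c ⊕ ones)) (wt-quarter c c∈) (quarters c c∈))
          (rearrange (Σℤ.χ (C c)) ((+ 8) ℤ.^ N) (R (quarter c)) (R (quarter (c ⊕ ones))))))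
        (trans (Σℤ.∑-*ˡ ((+ 8) ℤ.^ N) (λ c → Σℤ.χ (C c) ℤ.* R (quarter c) ℤ.+ Σℤ.χ (C c) ℤ.* R (quarter (c ⊕ ones))))
          (cong ((+ 8) ℤ.^ N ℤ.*_) (trans (Σℤ.∑-+ (λ c → Σℤ.χ (C c) ℤ.* R (quarter c)) (λ c → Σℤ.χ (C c) ℤ.* R (quarter (c ⊕ ones))))
            (cong (λ y → X ℤ.+ y) Y≡X)))))
        where
        rearrange : ∀ x e a b → x ℤ.* (e ℤ.* (a ℤ.+ b)) ≡ e ℤ.* (x ℤ.* a ℤ.+ x ℤ.* b)
        rearrange = ℤSolver.solve-∀

      right-[] : right [ N ] ≡ ε ℤ.* (+ (2 ℕ.^ (12 ℕ.* m)) ℤ.* X)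
      right-[] = trans ([]-ι* ε _ N) (cong (ε ℤ.*_) (trans ([]-ι* _ _ N) (cong (λ x → + (2 ℕ.^ (12 ℕ.* m)) ℤ.* x)
        (trans ([]-∑ (λ c → χ (C c) * (mon (ι 1ℤ) s c * K)) N) (Σℤ.∑-cong λ c → trans ([]-χ (C c) _ N) (Σℤ.χ-*-cong (C c) λ c∈ → []-original c (quarter c) (wt-quarter c c∈)))))))

      -- As 2D + 12m = 12M + 2, the powers of 2 agree with 8^(4M) up to a factor 4, one for each of
      -- the poles y⁴ = 1.
      ε-size : ε ℤ.* + (2 ℕ.^ (12 ℕ.* m)) ≡ ℤ.- ((+ 4) ℤ.* (+ 8) ℤ.^ N)
      ε-size = trans (sym (ℤₚ.neg-distribˡ-* ((+ 4) ℤ.^ D) (+ (2 ℕ.^ (12 ℕ.* m))))) (cong ℤ.-_ powers)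
        where
        pos-^ : ∀ b k → + (b ℕ.^ k) ≡ (+ b) ℤ.^ k
        pos-^ b zero = refl
        pos-^ b (suc k) = trans (ℤₚ.pos-* b _) (cong (+ b ℤ.*_) (pos-^ b k))
        exponents : ∀ m D M → 2 ℕ.* D ℕ.+ 12 ℕ.* m ≡ 2 ℕ.* (6 ℕ.* m ℕ.+ D)
        exponents = ℕSolver.solve-∀
        exponents′ : ∀ M → 2 ℕ.* suc (6 ℕ.* M) ≡ 2 ℕ.+ 3 ℕ.* (M ℕ.* 4)
        exponents′ = ℕSolver.solve-∀
        powers : (+ 4) ℤ.^ D ℤ.* + (2 ℕ.^ (12 ℕ.* m)) ≡ (+ 4) ℤ.* (+ 8) ℤ.^ N
        powers = begin′
          (+ 4) ℤ.^ D ℤ.* + (2 ℕ.^ (12 ℕ.* m)) ≡⟨ cong₂ ℤ._*_ (ℤₚ.^-*-assoc (+ 2) 2 D) (pos-^ 2 (12 ℕ.* m)) ⟩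
          (+ 2) ℤ.^ (2 ℕ.* D) ℤ.* (+ 2) ℤ.^ (12 ℕ.* m) ≡⟨ sym (ℤₚ.^-distribˡ-+-* (+ 2) (2 ℕ.* D) (12 ℕ.* m)) ⟩
          (+ 2) ℤ.^ (2 ℕ.* D ℕ.+ 12 ℕ.* m) ≡⟨ cong ((+ 2) ℤ.^_) (trans (exponents m D M) (trans (cong (2 ℕ.*_) deg) (exponents′ M))) ⟩
          (+ 2) ℤ.^ (2 ℕ.+ 3 ℕ.* N) ≡⟨ ℤₚ.^-distribˡ-+-* (+ 2) 2 (3 ℕ.* N) ⟩
          (+ 4) ℤ.* (+ 2) ℤ.^ (3 ℕ.* N) ≡⟨ cong ((+ 4) ℤ.*_) (sym (ℤₚ.^-*-assoc (+ 2) 3 N)) ⟩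
          (+ 4) ℤ.* (+ 8) ℤ.^ N ∎′
          where open ≡-Reasoning renaming (begin_ to begin′_; _∎ to _∎′)

      -- Comparing the two evaluations gives 8^(4M) 2X = -4 · 8^(4M) X: two poles 0 and ∞ on one
      -- side, four poles y⁴ = 1 on the other. Hence 8^(4M) 6X = 0.
      weight-relation : X ≡ 0ℤ
      weight-relation = ℤₚ.*-cancelˡ-≡ (+ 6) X 0ℤ (nonzero-cancel (trans
        (rearrange ((+ 8) ℤ.^ N) X) (trans (cong (λ x → (+ 8) ℤ.^ N ℤ.* (X ℤ.+ X) ℤ.- x) (trans (sym 
          (trans (sym (ℤₚ.*-assoc ε _ X)) (cong (ℤ._* X) ε-size))) (sym (trans (sym left-[]) (trans ([]-cong left≈right N) right-[])))))
          (ℤₚ.+-inverseʳ ((+ 8) ℤ.^ N ℤ.* (X ℤ.+ X))))))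
        where
        rearrange : ∀ e x → e ℤ.* ((+ 6) ℤ.* x) ≡ e ℤ.* (x ℤ.+ x) ℤ.- (ℤ.- ((+ 4) ℤ.* e) ℤ.* x)
        rearrange = ℤSolver.solve-∀
        nonzero-cancel : (+ 8) ℤ.^ N ℤ.* ((+ 6) ℤ.* X) ≡ 0ℤ → (+ 6) ℤ.* X ≡ 0ℤ
        nonzero-cancel p with ℤₚ.i*j≡0⇒i≡0∨j≡0 ((+ 8) ℤ.^ N) p
        ... | inj₂ r = r
        ... | inj₁ r = ⊥-elim (8^≢0 N r)
          where
          8^≢0 : ∀ k → (+ 8) ℤ.^ k ≡ 0ℤ → ⊥
          8^≢0 (suc k) e with ℤₚ.i*j≡0⇒i≡0∨j≡0 (+ 8) e
          ... | inj₂ e′ = 8^≢0 k e′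

-- Semi-invariants of degrees 28 and 52

module SemiInvariants where
  open Series
  open Residue
  open Coefficients
  open import Algebra.Properties.CommutativeSemiring.Exp commutativeSemiring using (_^_; ^-congˡ)
  open import Relation.Binary.Reasoning.Setoid setoid using (begin_; step-≈-⟩; _∎)

  -- In z = y⁴: g is the weight enumerator of the [8,4,4] Hamming code, h is the semi-invariant x¹² - 33 x⁸ y⁴ - 33 x⁴ y⁸ + y¹²,
  -- which changes sign under the MacWilliams transform, q₁ = g² h and q₂ = g⁵ h.
  g h q₁ q₂ : List ℤ
  g = + 1 ∷ + 14 ∷ + 1 ∷ []
  h = + 1 ∷ -[1+ 32 ] ∷ -[1+ 32 ] ∷ + 1 ∷ []
  q₁ = + 1 ∷ -[1+ 4 ] ∷ -[1+ 758 ] ∷ -[1+ 7428 ] ∷ -[1+ 7428 ] ∷ -[1+ 758 ] ∷ -[1+ 4 ] ∷ + 1 ∷ []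
  q₂ = + 1 ∷ + 37 ∷ -[1+ 377 ] ∷ -[1+ 39433 ] ∷ -[1+ 781564 ] ∷ -[1+ 6852680 ] ∷ -[1+ 25880411 ] ∷
       -[1+ 25880411 ] ∷ -[1+ 6852680 ] ∷ -[1+ 781564 ] ∷ -[1+ 39433 ] ∷ -[1+ 377 ] ∷ + 37 ∷ + 1 ∷ []

  :eval : ∀ {n} → List ℤ → Polynomial n → Polynomial n
  :eval [] x = con 0ℤ
  :eval (q ∷ qs) x = con q :+ x :* :eval qs x

  -- The factor U² clears the denominators of t, and the invariance of g becomes a polynomial
  -- identity in s.
  semi-g : eval g t * U ^ 2 ≈ ι (+ 16) * eval g (s ^ 4)
  semi-g = begin
    eval g t * U ^ 2 ≈⟨ solve 2 (λ t U → :eval g t :* U :^ 2 := U :^ 2 :+ con (+ 14) :* (t :* U) :* U :+ (t :* U) :^ 2) ≈-refl t U ⟩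
    U ^ 2 + ι (+ 14) * (t * U) * U + (t * U) ^ 2 ≈⟨ +-cong (+-congˡ (*-congʳ (*-congˡ t*U))) (^-congˡ 2 t*U) ⟩
    U ^ 2 + ι (+ 14) * 1-s ^ 4 * U + (1-s ^ 4) ^ 2
      ≈⟨ solve 1 (λ s → ((:1 :+ s) :^ 4) :^ 2 :+ con (+ 14) :* (:1 :- s) :^ 4 :* (:1 :+ s) :^ 4 :+ ((:1 :- s) :^ 4) :^ 2
           := con (+ 16) :* :eval g (s :^ 4)) ≈-refl s ⟩
    ι (+ 16) * eval g (s ^ 4) ∎

  semi-h : eval h t * U ^ 3 ≈ ι -[1+ 63 ] * eval h (s ^ 4)
  semi-h = begin
    eval h t * U ^ 3
      ≈⟨ solve 2 (λ t U → :eval h t :* U :^ 3 :=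
           U :^ 3 :- con (+ 33) :* (t :* U) :* U :^ 2 :- con (+ 33) :* (t :* U) :^ 2 :* U :+ (t :* U) :^ 3) ≈-refl t U ⟩
    U ^ 3 - ι (+ 33) * (t * U) * U ^ 2 - ι (+ 33) * (t * U) ^ 2 * U + (t * U) ^ 3
      ≈⟨ +-cong (+-cong (+-congˡ (-‿cong (*-congʳ (*-congˡ t*U)))) (-‿cong (*-congʳ (*-congˡ (^-congˡ 2 t*U))))) (^-congˡ 3 t*U) ⟩
    U ^ 3 - ι (+ 33) * 1-s ^ 4 * U ^ 2 - ι (+ 33) * (1-s ^ 4) ^ 2 * U + (1-s ^ 4) ^ 3
      ≈⟨ solve 1 (λ s → let a = (:1 :+ s) :^ 4 ; b = (:1 :- s) :^ 4 in
           a :^ 3 :- con (+ 33) :* b :* a :^ 2 :- con (+ 33) :* b :^ 2 :* a :+ b :^ 3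
           := con -[1+ 63 ] :* :eval h (s :^ 4)) ≈-refl s ⟩
    ι -[1+ 63 ] * eval h (s ^ 4) ∎

  q₁-factors : ∀ x → eval q₁ x ≈ eval g x ^ 2 * eval h x
  q₁-factors = solve 1 (λ x → :eval q₁ x := :eval g x :^ 2 :* :eval h x) ≈-refl

  q₂-factors : ∀ x → eval q₂ x ≈ eval g x ^ 5 * eval h x
  q₂-factors = solve 1 (λ x → :eval q₂ x := :eval g x :^ 5 :* :eval h x) ≈-refl

  semi-q₁ : ι (ℤ.- ((+ 4) ℤ.^ 7)) * eval q₁ (s ^ 4) ≈ eval q₁ t * U ^ 7
  semi-q₁ = ≈-sym (begin
    eval q₁ t * U ^ 7 ≈⟨ *-congʳ (q₁-factors t) ⟩
    eval g t ^ 2 * eval h t * U ^ 7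
      ≈⟨ solve 3 (λ g h U → g :^ 2 :* h :* U :^ 7 := (g :* U :^ 2) :^ 2 :* (h :* U :^ 3)) ≈-refl (eval g t) (eval h t) U ⟩
    (eval g t * U ^ 2) ^ 2 * (eval h t * U ^ 3) ≈⟨ *-cong (^-congˡ 2 semi-g) semi-h ⟩
    (ι (+ 16) * eval g (s ^ 4)) ^ 2 * (ι -[1+ 63 ] * eval h (s ^ 4))
      ≈⟨ solve 2 (λ g h → (con (+ 16) :* g) :^ 2 :* (con -[1+ 63 ] :* h) := con (ℤ.- ((+ 4) ℤ.^ 7)) :* (g :^ 2 :* h)) ≈-refl (eval g (s ^ 4)) (eval h (s ^ 4)) ⟩
    ι (ℤ.- ((+ 4) ℤ.^ 7)) * (eval g (s ^ 4) ^ 2 * eval h (s ^ 4)) ≈⟨ *-congˡ (≈-sym (q₁-factors (s ^ 4))) ⟩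
    ι (ℤ.- ((+ 4) ℤ.^ 7)) * eval q₁ (s ^ 4) ∎)

  semi-q₂ : ι (ℤ.- ((+ 4) ℤ.^ 13)) * eval q₂ (s ^ 4) ≈ eval q₂ t * U ^ 13
  semi-q₂ = ≈-sym (begin
    eval q₂ t * U ^ 13 ≈⟨ *-congʳ (q₂-factors t) ⟩
    eval g t ^ 5 * eval h t * U ^ 13
      ≈⟨ solve 3 (λ g h U → g :^ 5 :* h :* U :^ 13 := (g :* U :^ 2) :^ 5 :* (h :* U :^ 3)) ≈-refl (eval g t) (eval h t) U ⟩
    (eval g t * U ^ 2) ^ 5 * (eval h t * U ^ 3) ≈⟨ *-cong (^-congˡ 5 semi-g) semi-h ⟩
    (ι (+ 16) * eval g (s ^ 4)) ^ 5 * (ι -[1+ 63 ] * eval h (s ^ 4))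
      ≈⟨ solve 2 (λ g h → (con (+ 16) :* g) :^ 5 :* (con -[1+ 63 ] :* h) := con (ℤ.- ((+ 4) ℤ.^ 13)) :* (g :^ 5 :* h)) ≈-refl (eval g (s ^ 4)) (eval h (s ^ 4)) ⟩
    ι (ℤ.- ((+ 4) ℤ.^ 13)) * (eval g (s ^ 4) ^ 5 * eval h (s ^ 4)) ≈⟨ *-congˡ (≈-sym (q₂-factors (s ^ 4))) ⟩
    ι (ℤ.- ((+ 4) ℤ.^ 13)) * eval q₂ (s ^ 4) ∎)

-- The numbers of words of weights 4m + 4 and 4m + 8

module WeightCounts where
  open Coefficients
  open WeightRelations
  open SemiInvariants

  tail : List ℤ → List ℤ
  tail [] = []
  tail (_ ∷ q) = q

  hasWeight : ∀ {n} → Code n → ℕ → Word n → Bool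
  hasWeight C w c = C c ∧ ⌊ wt c ℕ.≟ w ⌋

  weightCount : ∀ {n} → Code n → ℕ → ℕ
  weightCount C w = Σℕ.∑ (λ c → Σℕ.χ (hasWeight C w c))

  ∑ℤ-χ* : ∀ {n} (p : Word n → Bool) x → Σℤ.∑ (λ c → Σℤ.χ (p c) ℤ.* x) ≡ + Σℕ.∑ (λ c → Σℕ.χ (p c)) ℤ.* x
  ∑ℤ-χ* p x = trans (Σℤ.∑-*ʳ x (λ c → Σℤ.χ (p c))) (cong (ℤ._* x) (∑-pos p))
    where
    ∑-pos : ∀ {n} (p : Word n → Bool) → Σℤ.∑ (λ c → Σℤ.χ (p c)) ≡ + Σℕ.∑ (λ c → Σℕ.χ (p c))
    ∑-pos {zero} p with p Vec.[]
    ... | true = refl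
    ... | false = refl
    ∑-pos {suc n} p = cong₂ ℤ._+_ (∑-pos (λ c → p (false Vec.∷ c))) (∑-pos (λ c → p (true Vec.∷ c)))

  dot-0 : ∀ q f k → (∀ i → k ≤ i → f i ≡ 0ℤ) → dot q f k ≡ 0ℤ
  dot-0 [] f k p = refl
  dot-0 (x ∷ q) f k p = trans (cong₂ ℤ._+_ (trans (cong (x ℤ.*_) (p k ℕₚ.≤-refl)) (ℤₚ.*-zeroʳ x)) (dot-0 q f (suc k) λ i k<i → p i (ℕₚ.<⇒≤ k<i))) refl

  ψ-diagonal : ∀ M → ψ M M ≡ 1
  ψ-diagonal M = trans (ψ-≤ M M ℕₚ.≤-refl) (trans (cong (λ d → (d ℕ.+ M ℕ.* 4) choose (M ℕ.* 4)) (ℕₚ.n∸n≡0 M)) (nCn≡1 (M ℕ.* 4)))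

  [1+n]Cn≡1+n : ∀ n → suc n choose n ≡ suc n
  [1+n]Cn≡1+n zero = refl
  [1+n]Cn≡1+n (suc n) = trans (sym (nCk+nC[k+1]≡[n+1]C[k+1] (suc n) n))
    (trans (cong₂ ℕ._+_ ([1+n]Cn≡1+n n) (nCn≡1 (suc n))) (ℕₚ.+-comm (suc n) 1))

  ψ-subdiagonal : ∀ M → ψ (suc M) M ≡ 1 ℕ.+ suc M ℕ.* 4
  ψ-subdiagonal M = trans (ψ-≤ (suc M) M (ℕₚ.n≤1+n M))
    (trans (cong (λ d → (d ℕ.+ suc M ℕ.* 4) choose (suc M ℕ.* 4)) (trans (ℕₚ.+-∸-assoc 1 (ℕₚ.≤-refl {M})) (cong suc (ℕₚ.n∸n≡0 M))))
      ([1+n]Cn≡1+n (suc M ℕ.* 4)))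

  module Extremal {m : ℕ} {C : Code (24 ℕ.* m)} (ext : IsExtremalDESD m C) where
    lin : IsLinear C
    lin = proj₁ ext
    dual : IsSelfDual C
    dual = proj₁ (proj₂ ext)
    even : IsDoublyEven C
    even = proj₁ (proj₂ (proj₂ ext))
    dim : HasDimension C (12 ℕ.* m)
    dim = proj₁ (proj₂ (proj₂ (proj₂ ext)))
    minWeight : HasMinWeight C (4 ℕ.* m ℕ.+ 4)
    minWeight = proj₂ (proj₂ (proj₂ (proj₂ ext)))

    d d₂ : ℕ
    d = 4 ℕ.* m ℕ.+ 4
    d₂ = 4 ℕ.* m ℕ.+ 8

    zero-weight : ∀ c → wt c ≡ 0 → C c ≡ true
    zero-weight c e = subst (λ v → C v ≡ true) (sym (wt-zero⇒zeroWord c e)) (proj₁ lin)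

    -- The possible values of a quarter of a codeword's weight. Above m + 2 the functional R
    -- vanishes for both M = m + 1 and M = m + 2.
    data Weight (j : ℕ) : Set where
      is-0 : j ≡ 0 → Weight j
      is-m+1 : j ≡ suc m → Weight j
      is-m+2 : j ≡ suc (suc m) → Weight j
      above : suc (suc m) < j → Weight j

    d≡ : d ≡ suc m ℕ.* 4
    d≡ = lemma m
      where
      lemma : ∀ m → 4 ℕ.* m ℕ.+ 4 ≡ suc m ℕ.* 4
      lemma = ℕSolver.solve-∀

    d₂≡ : d₂ ≡ suc (suc m) ℕ.* 4
    d₂≡ = lemma m
      where
      lemma : ∀ m → 4 ℕ.* m ℕ.+ 8 ≡ suc (suc m) ℕ.* 4
      lemma = ℕSolver.solve-∀

    weights : ∀ c → c ∈C C → ∀ j → wt c ≡ j ℕ.* 4 → Weight j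
    weights c c∈ zero e = is-0 refl
    weights c c∈ j@(suc _) e with ℕₚ.m≤n⇒m<n∨m≡n m<j
      where
      m<j : suc m ≤ j
      m<j = ℕₚ.*-cancelʳ-≤ (suc m) j 4 (subst (ℕ._≤ j ℕ.* 4) d≡ (subst (d ≤_) e
        (proj₂ minWeight c c∈ λ c≡0 → ℕₚ.1+n≢0 (trans (sym e) (trans (cong wt c≡0) (wt-zeroWord (24 ℕ.* m)))))))
    ... | inj₂ e′ = is-m+1 (sym e′)
    ... | inj₁ m+1<j with ℕₚ.m≤n⇒m<n∨m≡n m+1<j
    ...   | inj₂ e′ = is-m+2 (sym e′)
    ...   | inj₁ m+2<j = above m+2<j

    ≟-yes : ∀ {a b} → a ≡ b → ⌊ a ℕ.≟ b ⌋ ≡ true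
    ≟-yes {a} {b} p with a ℕ.≟ b
    ... | yes _ = refl
    ... | no ¬p = ⊥-elim (¬p p)

    ≟-no : ∀ {a b} → a ≢ b → ⌊ a ℕ.≟ b ⌋ ≡ false
    ≟-no {a} {b} ¬p with a ℕ.≟ b
    ... | yes p = ⊥-elim (¬p p)
    ... | no _ = refl

    ≡ᵇ0-no : ∀ {a} → a ≢ 0 → (a ℕ.≡ᵇ 0) ≡ false
    ≡ᵇ0-no {zero} p = ⊥-elim (p refl)
    ≡ᵇ0-no {suc a} p = refl

    module _ (f : ℕ → ℤ) (above-0 : ∀ j → suc (suc m) < j → f j ≡ 0ℤ) where
      combine : Bool → Bool → Bool → ℤ
      combine b₀ b₁ b₂ = Σℤ.χ b₀ ℤ.* f 0 ℤ.+ (Σℤ.χ b₁ ℤ.* f (suc m) ℤ.+ Σℤ.χ b₂ ℤ.* f (suc (suc m)))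

      combine-cong : ∀ {a₀ b₀ a₁ b₁ a₂ b₂} → a₀ ≡ b₀ → a₁ ≡ b₁ → a₂ ≡ b₂ → combine a₀ a₁ a₂ ≡ combine b₀ b₁ b₂
      combine-cong refl refl refl = refl

      ≟-scaled : ∀ {w j e k} → w ≡ j ℕ.* 4 → e ≡ k ℕ.* 4 → j ≢ k → ⌊ w ℕ.≟ e ⌋ ≡ false
      ≟-scaled {j = j} {k = k} p q j≢k = ≟-no λ r → j≢k (ℕₚ.*-cancelʳ-≡ j k 4 (trans (sym p) (trans r q)))

      split-at : ∀ c j {b₀ b₁ b₂} → c ∈C C → wt c ≡ j ℕ.* 4 →
        (wt c ℕ.≡ᵇ 0) ≡ b₀ → ⌊ wt c ℕ.≟ d ⌋ ≡ b₁ → ⌊ wt c ℕ.≟ d₂ ⌋ ≡ b₂ → f j ≡ combine b₀ b₁ b₂ →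
        Σℤ.χ (C c) ℤ.* f (wt c ℕ./ 4) ≡ combine (wt c ℕ.≡ᵇ 0) (hasWeight C d c) (hasWeight C d₂ c)
      split-at c j c∈ e p₀ p₁ p₂ q = trans
        (cong₂ (λ b k → Σℤ.χ b ℤ.* f k) c∈ (trans (cong (ℕ._/ 4) e) (m*n/n≡m j 4)))
        (trans (ℤₚ.*-identityˡ (f j)) (trans q (sym (combine-cong p₀ (cong₂ _∧_ c∈ p₁) (cong₂ _∧_ c∈ p₂)))))

      split : ∀ c → Σℤ.χ (C c) ℤ.* f (wt c ℕ./ 4) ≡ combine (wt c ℕ.≡ᵇ 0) (hasWeight C d c) (hasWeight C d₂ c)
      split c = cases (C c) refl
        where
        cases : ∀ b → C c ≡ b → Σℤ.χ (C c) ℤ.* f (wt c ℕ./ 4) ≡ combine (wt c ℕ.≡ᵇ 0) (hasWeight C d c) (hasWeight C d₂ c)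
        cases false c∉ = trans (cong (λ b → Σℤ.χ b ℤ.* f (wt c ℕ./ 4)) c∉)
          (sym (combine-cong (≡ᵇ0-no λ e → false≢true (trans (sym c∉) (zero-weight c e)))
            (cong (_∧ ⌊ wt c ℕ.≟ d ⌋) c∉) (cong (_∧ ⌊ wt c ℕ.≟ d₂ ⌋) c∉)))
        cases true c∈ with even c c∈
        ... | divides j e with weights c c∈ j e
        ...   | is-0 refl = split-at c j c∈ e (cong (ℕ._≡ᵇ 0) e) (≟-scaled e d≡ (ℕₚ.0≢1+n {m})) (≟-scaled e d₂≡ (ℕₚ.0≢1+n {suc m}))
                  (sym (trans (ℤₚ.+-identityʳ _) (ℤₚ.*-identityˡ (f 0))))
        ...   | is-m+1 refl = split-at c j c∈ e (cong (ℕ._≡ᵇ 0) e) (≟-yes (trans e (sym d≡))) (≟-scaled e d₂≡ (ℕₚ.1+n≢n {suc m} ∘ sym))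
                  (sym (trans (ℤₚ.+-identityˡ _) (trans (ℤₚ.+-identityʳ _) (ℤₚ.*-identityˡ (f (suc m))))))
        ...   | is-m+2 refl = split-at c j c∈ e (cong (ℕ._≡ᵇ 0) e) (≟-scaled e d≡ (ℕₚ.1+n≢n {suc m})) (≟-yes (trans e (sym d₂≡)))
                  (sym (trans (ℤₚ.+-identityˡ _) (trans (ℤₚ.+-identityˡ _) (ℤₚ.*-identityˡ (f (suc (suc m)))))))
        ...   | above lt = split-at c j c∈ e
                  (≡ᵇ0-no λ p → ℕₚ.n≮0 (ℕₚ.<-≤-trans lt (ℕₚ.≤-reflexive (ℕₚ.*-cancelʳ-≡ j 0 4 (trans (sym e) p)))))
                  (≟-scaled e d≡ (ℕₚ.<⇒≢ (ℕₚ.<-trans (ℕₚ.n<1+n (suc m)) lt) ∘ sym)) (≟-scaled e d₂≡ (ℕₚ.<⇒≢ lt ∘ sym)) (above-0 j lt)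

      ∑-split : Σℤ.∑ (λ c → Σℤ.χ (C c) ℤ.* f (wt c ℕ./ 4)) ≡
        f 0 ℤ.+ (+ weightCount C d ℤ.* f (suc m) ℤ.+ + weightCount C d₂ ℤ.* f (suc (suc m)))
      ∑-split = trans (Σℤ.∑-cong split) (trans
        (Σℤ.∑-+ {24 ℕ.* m} (λ c → Σℤ.χ (wt c ℕ.≡ᵇ 0) ℤ.* f 0) (λ c → Σℤ.χ (hasWeight C d c) ℤ.* f (suc m) ℤ.+ Σℤ.χ (hasWeight C d₂ c) ℤ.* f (suc (suc m))))
        (cong₂ ℤ._+_ zero-term
          (trans (Σℤ.∑-+ {24 ℕ.* m} (λ c → Σℤ.χ (hasWeight C d c) ℤ.* f (suc m)) (λ c → Σℤ.χ (hasWeight C d₂ c) ℤ.* f (suc (suc m))))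
            (cong₂ ℤ._+_ (∑ℤ-χ* (hasWeight C d) (f (suc m))) (∑ℤ-χ* (hasWeight C d₂) (f (suc (suc m))))))))
        where
        zero-term : Σℤ.∑ {24 ℕ.* m} (λ c → Σℤ.χ (wt c ℕ.≡ᵇ 0) ℤ.* f 0) ≡ f 0
        zero-term = trans (Σℤ.∑-*ʳ {24 ℕ.* m} (f 0) (λ c → Σℤ.χ (wt c ℕ.≡ᵇ 0)))
          (trans (cong (ℤ._* f 0) (Σℤ.∑-wt0 (24 ℕ.* m))) (ℤₚ.*-identityˡ (f 0)))

    -- For M = m + 1 the functional R is 1 at M and 0 beyond, so only the zero word and the words of
    -- minimum weight enter.
    minimum-count : + weightCount C d ≡ ℤ.- dot q₁ (λ k → + ψ (suc m) k) 0
    minimum-count = isolate _ _ (trans (sym simplified) (weight-relation {C = C} lin dual even dim))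
      where
      M = suc m
      deg : ∀ m → 6 ℕ.* m ℕ.+ 7 ≡ suc (6 ℕ.* suc m)
      deg = ℕSolver.solve-∀
      open WeightRelation M m 7 q₁ (s≤s z≤n) (deg m) refl refl semi-q₁ using (R; weight-relation)
      above-M : ∀ j → M < j → R j ≡ 0ℤ
      above-M j M<j = dot-0 q₁ _ j λ i j≤i → cong +_ (ψ-> M i (s≤s z≤n) (ℕₚ.<-≤-trans M<j j≤i))
      at-M : R M ≡ 1ℤ
      at-M = cong₂ (λ x y → 1ℤ ℤ.* + x ℤ.+ y) (ψ-diagonal M)
        (dot-0 (tail q₁) _ (suc M) λ i M<i → cong +_ (ψ-> M i (s≤s z≤n) M<i))
      simplified : Σℤ.∑ (λ c → Σℤ.χ (C c) ℤ.* R (wt c ℕ./ 4)) ≡ R 0 ℤ.+ + weightCount C d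
      simplified = trans (∑-split R (λ j lt → above-M j (ℕₚ.<-trans (ℕₚ.n<1+n M) lt)))
        (cong (λ x → R 0 ℤ.+ x) (trans (cong₂ ℤ._+_ (trans (cong (λ x → + weightCount C d ℤ.* x) at-M) (ℤₚ.*-identityʳ (+ weightCount C d)))
          (trans (cong (λ x → + weightCount C d₂ ℤ.* x) (above-M (suc M) (ℕₚ.n<1+n M))) (ℤₚ.*-zeroʳ (+ weightCount C d₂)))) (ℤₚ.+-identityʳ (+ weightCount C d))))
      isolate : ∀ x y → x ℤ.+ y ≡ 0ℤ → y ≡ ℤ.- x
      isolate x y p = trans (lemma x y) (trans (cong (λ z → ℤ.- x ℤ.+ z) p) (ℤₚ.+-identityʳ _))
        where
        lemma : ∀ x y → y ≡ ℤ.- x ℤ.+ (x ℤ.+ y)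
        lemma = ℤSolver.solve-∀

    second-count : dot q₂ (λ k → + ψ (suc (suc m)) k) 0 ℤ.+ (+ weightCount C d ℤ.* + (4 ℕ.* m ℕ.+ 46) ℤ.+ + weightCount C d₂) ≡ 0ℤ
    second-count = trans (sym simplified) (weight-relation {C = C} lin dual even dim)
      where
      M = suc (suc m)
      deg : ∀ m → 6 ℕ.* m ℕ.+ 13 ≡ suc (6 ℕ.* suc (suc m))
      deg = ℕSolver.solve-∀
      open WeightRelation M m 13 q₂ (s≤s z≤n) (deg m) refl refl semi-q₂ using (R; weight-relation)
      above-M : ∀ j → M < j → R j ≡ 0ℤ
      above-M j M<j = dot-0 q₂ _ j λ i j≤i → cong +_ (ψ-> M i (s≤s z≤n) (ℕₚ.<-≤-trans M<j j≤i))
      beyond : ∀ q → dot q (λ k → + ψ M k) (suc M) ≡ 0ℤ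
      beyond q = dot-0 q _ (suc M) λ i M<i → cong +_ (ψ-> M i (s≤s z≤n) M<i)
      at-M : R M ≡ 1ℤ
      at-M = cong₂ (λ x y → 1ℤ ℤ.* + x ℤ.+ y) (ψ-diagonal M) (beyond (tail q₂))
      -- The constant coefficient of `q₂` contributes ψ (m + 2) (m + 1) = 4(m + 2) + 1, and its
      -- linear coefficient contributes 37.
      below-M : R (suc m) ≡ + (4 ℕ.* m ℕ.+ 46)
      below-M = trans (cong₂ (λ x y → 1ℤ ℤ.* + x ℤ.+ y) (ψ-subdiagonal (suc m))
        (cong₂ (λ x y → + 37 ℤ.* + x ℤ.+ y) (ψ-diagonal M) (beyond (tail (tail q₂)))))
        (trans (cong (ℤ._+ + 37) (ℤₚ.*-identityˡ (+ (1 ℕ.+ M ℕ.* 4)))) (cong +_ (lemma m)))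
        where
        lemma : ∀ m → 1 ℕ.+ suc (suc m) ℕ.* 4 ℕ.+ 37 ≡ 4 ℕ.* m ℕ.+ 46
        lemma = ℕSolver.solve-∀
      simplified : Σℤ.∑ (λ c → Σℤ.χ (C c) ℤ.* R (wt c ℕ./ 4)) ≡ R 0 ℤ.+ (+ weightCount C d ℤ.* + (4 ℕ.* m ℕ.+ 46) ℤ.+ + weightCount C d₂)
      simplified = trans (∑-split R above-M)
        (cong (λ x → R 0 ℤ.+ x) (cong₂ ℤ._+_ (cong (λ x → + weightCount C d ℤ.* x) below-M)
          (trans (cong (λ x → + weightCount C d₂ ℤ.* x) at-M) (ℤₚ.*-identityʳ _))))

-- Lengths with m ≥ 154: the count for weight 4m + 8 is negative

module LargeLengths where
  open Coefficients using (ψ; ψ-≤; dot)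
  open SemiInvariants using (q₁; q₂)

  -- C(n + j, n), parametrised without subtraction: for M = l + j it gives ψ M l with n = 4M.
  binomial : ℕ → ℕ → ℕ
  binomial n j = (j ℕ.+ n) choose n

  binomial-pascal : ∀ n j → binomial (suc n) (suc j) ≡ binomial n (suc j) ℕ.+ binomial (suc n) j
  binomial-pascal n j = trans (sym (nCk+nC[k+1]≡[n+1]C[k+1] (j ℕ.+ suc n) n))
    (cong (λ i → i choose n ℕ.+ binomial (suc n) j) (ℕₚ.+-suc j n))

  binomial-0ʳ : ∀ n → binomial n 0 ≡ 1
  binomial-0ʳ = nCn≡1

  mutual
    binomial-sucʳ : ∀ n j → suc j ℕ.* binomial n (suc j) ≡ (n ℕ.+ suc j) ℕ.* binomial n j
    binomial-sucʳ zero j = refl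
    binomial-sucʳ (suc n) j = begin
      suc j ℕ.* binomial (suc n) (suc j) ≡⟨ cong (suc j ℕ.*_) (binomial-pascal n j) ⟩
      suc j ℕ.* (binomial n (suc j) ℕ.+ binomial (suc n) j) ≡⟨ ℕₚ.*-distribˡ-+ (suc j) (binomial n (suc j)) _ ⟩
      suc j ℕ.* binomial n (suc j) ℕ.+ suc j ℕ.* binomial (suc n) j
        ≡⟨ cong (ℕ._+ suc j ℕ.* binomial (suc n) j) (trans (binomial-sucʳ n j) (sym (binomial-sucˡ n j))) ⟩
      suc n ℕ.* binomial (suc n) j ℕ.+ suc j ℕ.* binomial (suc n) j ≡⟨ sym (ℕₚ.*-distribʳ-+ (binomial (suc n) j) (suc n) (suc j)) ⟩
      (suc n ℕ.+ suc j) ℕ.* binomial (suc n) j ∎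
      where open ≡-Reasoning

    binomial-sucˡ : ∀ n j → suc n ℕ.* binomial (suc n) j ≡ (n ℕ.+ suc j) ℕ.* binomial n j
    binomial-sucˡ n zero = trans (cong (suc n ℕ.*_) (binomial-0ʳ (suc n)))
      (cong₂ ℕ._*_ (ℕₚ.+-comm 1 n) (sym (binomial-0ʳ n)))
    binomial-sucˡ n (suc j) = begin
      suc n ℕ.* binomial (suc n) (suc j) ≡⟨ cong (suc n ℕ.*_) (binomial-pascal n j) ⟩
      suc n ℕ.* (binomial n (suc j) ℕ.+ binomial (suc n) j) ≡⟨ ℕₚ.*-distribˡ-+ (suc n) (binomial n (suc j)) _ ⟩
      suc n ℕ.* binomial n (suc j) ℕ.+ suc n ℕ.* binomial (suc n) j
        ≡⟨ cong (suc n ℕ.* binomial n (suc j) ℕ.+_) (trans (binomial-sucˡ n j) (sym (binomial-sucʳ n j))) ⟩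
      suc n ℕ.* binomial n (suc j) ℕ.+ suc j ℕ.* binomial n (suc j) ≡⟨ index n j (binomial n (suc j)) ⟩
      (n ℕ.+ suc (suc j)) ℕ.* binomial n (suc j) ∎
      where
      open ≡-Reasoning
      index : ∀ n j b → suc n ℕ.* b ℕ.+ suc j ℕ.* b ≡ (n ℕ.+ suc (suc j)) ℕ.* b
      index = ℕSolver.solve-∀

  -- One unit moves from j to n while the upper index n + j stays fixed. Four such moves lead from n
  -- = 4(m + 1) to n = 4(m + 2), that is, from the first relation to the second.
  binomial-shift : ∀ n j → suc j ℕ.* binomial n (suc j) ≡ suc n ℕ.* binomial (suc n) j
  binomial-shift n j = trans (binomial-sucʳ n j) (sym (binomial-sucˡ n j))

  binomial>0 : ∀ n j → 1 ≤ binomial n j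
  binomial>0 n zero = ℕₚ.≤-reflexive (sym (binomial-0ʳ n))
  binomial>0 zero (suc j) = s≤s z≤n
  binomial>0 (suc n) (suc j) = subst (1 ≤_) (sym (binomial-pascal n j)) (ℕₚ.≤-trans (binomial>0 n (suc j)) (ℕₚ.m≤m+n _ _))

  ψ-binomial : ∀ M l j → M ≡ l ℕ.+ j → ψ M l ≡ binomial (M ℕ.* 4) j
  ψ-binomial M l j refl = trans (ψ-≤ M l (ℕₚ.m≤m+n l j)) (cong (λ i → binomial (M ℕ.* 4) i) (ℕₚ.m+n∸m≡n l j))

  dot-cong : ∀ q f g k → (∀ i → i < length q ℕ.+ k → f i ≡ g i) → dot q f k ≡ dot q g k
  dot-cong [] f g k p = refl
  dot-cong (c ∷ q) f g k p = cong₂ (λ x y → c ℤ.* x ℤ.+ y) (p k (s≤s (ℕₚ.m≤n+m k (length q))))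
    (dot-cong q f g (suc k) λ i i< → p i (subst (i <_) (ℕₚ.+-suc (length q) k) i<))

  dot-pad : ∀ q f k n → dot (q ++ List.replicate n 0ℤ) f k ≡ dot q f k
  dot-pad [] f k zero = refl
  dot-pad [] f k (suc n) = trans (ℤₚ.+-identityˡ _) (dot-pad [] f (suc k) n)
  dot-pad (c ∷ q) f k n = cong (λ x → c ℤ.* f k ℤ.+ x) (dot-pad q f (suc k) n)

  Poly : Set
  Poly = List ℤ

  abstract
    ⟦_⟧ : Poly → ℤ → ℤ
    ⟦ [] ⟧ k = 0ℤ
    ⟦ c ∷ p ⟧ k = c ℤ.+ k ℤ.* ⟦ p ⟧ k

    ⟦[]⟧ : ∀ k → ⟦ [] ⟧ k ≡ 0ℤ
    ⟦[]⟧ k = refl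

    ⟦∷⟧ : ∀ c p k → ⟦ c ∷ p ⟧ k ≡ c ℤ.+ k ℤ.* ⟦ p ⟧ k
    ⟦∷⟧ c p k = refl

  ⟦constant⟧ : ∀ c k → ⟦ c ∷ [] ⟧ k ≡ c
  ⟦constant⟧ c k = trans (⟦∷⟧ c [] k) (trans (cong (λ x → c ℤ.+ k ℤ.* x) (⟦[]⟧ k)) (trans (cong (λ x → c ℤ.+ x) (ℤₚ.*-zeroʳ k)) (ℤₚ.+-identityʳ c)))

  infixl 6 _⊞_
  infixr 7 _⊡_
  _⊞_ : Poly → Poly → Poly
  [] ⊞ q = q
  (c ∷ p) ⊞ [] = c ∷ p
  (c ∷ p) ⊞ (d ∷ q) = c ℤ.+ d ∷ p ⊞ q

  _⊡_ : ℤ → Poly → Poly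
  a ⊡ [] = []
  a ⊡ (c ∷ p) = a ℤ.* c ∷ a ⊡ p

  ⟦⊞⟧ : ∀ p q k → ⟦ p ⊞ q ⟧ k ≡ ⟦ p ⟧ k ℤ.+ ⟦ q ⟧ k
  ⟦⊞⟧ [] q k = trans (sym (ℤₚ.+-identityˡ _)) (cong (ℤ._+ ⟦ q ⟧ k) (sym (⟦[]⟧ k)))
  ⟦⊞⟧ (c ∷ p) [] k = trans (sym (ℤₚ.+-identityʳ _)) (cong (λ x → ⟦ c ∷ p ⟧ k ℤ.+ x) (sym (⟦[]⟧ k)))
  ⟦⊞⟧ (c ∷ p) (d ∷ q) k = trans (⟦∷⟧ (c ℤ.+ d) (p ⊞ q) k) (trans (cong (λ x → c ℤ.+ d ℤ.+ k ℤ.* x) (⟦⊞⟧ p q k))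
    (trans (lemma c d k (⟦ p ⟧ k) (⟦ q ⟧ k)) (sym (cong₂ ℤ._+_ (⟦∷⟧ c p k) (⟦∷⟧ d q k)))))
    where
    lemma : ∀ c d k x y → c ℤ.+ d ℤ.+ k ℤ.* (x ℤ.+ y) ≡ c ℤ.+ k ℤ.* x ℤ.+ (d ℤ.+ k ℤ.* y)
    lemma = ℤSolver.solve-∀

  ⟦⊡⟧ : ∀ a p k → ⟦ a ⊡ p ⟧ k ≡ a ℤ.* ⟦ p ⟧ k
  ⟦⊡⟧ a [] k = trans (⟦[]⟧ k) (trans (sym (ℤₚ.*-zeroʳ a)) (cong (a ℤ.*_) (sym (⟦[]⟧ k))))
  ⟦⊡⟧ a (c ∷ p) k = trans (⟦∷⟧ (a ℤ.* c) (a ⊡ p) k) (trans (cong (λ x → a ℤ.* c ℤ.+ k ℤ.* x) (⟦⊡⟧ a p k))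
    (trans (lemma a c k (⟦ p ⟧ k)) (cong (a ℤ.*_) (sym (⟦∷⟧ c p k)))))
    where
    lemma : ∀ a c k x → a ℤ.* c ℤ.+ k ℤ.* (a ℤ.* x) ≡ a ℤ.* (c ℤ.+ k ℤ.* x)
    lemma = ℤSolver.solve-∀

  Linear : Set
  Linear = ℤ × ℤ

  at : ℤ → Linear → ℤ
  at k (u , v) = u ℤ.+ v ℤ.* k

  mul : Linear → Poly → Poly
  mul (u , v) p = u ⊡ p ⊞ (0ℤ ∷ v ⊡ p)

  ⟦mul⟧ : ∀ a p k → ⟦ mul a p ⟧ k ≡ at k a ℤ.* ⟦ p ⟧ k
  ⟦mul⟧ (u , v) p k = trans (⟦⊞⟧ (u ⊡ p) _ k)
    (trans (cong₂ ℤ._+_ (⟦⊡⟧ u p k) (trans (⟦∷⟧ 0ℤ (v ⊡ p) k) (cong (λ y → 0ℤ ℤ.+ k ℤ.* y) (⟦⊡⟧ v p k)))) (lemma u v k (⟦ p ⟧ k)))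
    where
    lemma : ∀ u v k x → u ℤ.* x ℤ.+ (0ℤ ℤ.+ k ℤ.* (v ℤ.* x)) ≡ (u ℤ.+ v ℤ.* k) ℤ.* x
    lemma = ℤSolver.solve-∀

  product : List Linear → Poly
  product [] = 1ℤ ∷ []
  product (a ∷ as) = mul a (product as)

  Ratios : Set
  Ratios = List (Linear × Linear)

  denominators numerators : Ratios → Poly
  denominators [] = 1ℤ ∷ []
  denominators ((a , _) ∷ r) = mul a (denominators r)
  numerators [] = 1ℤ ∷ []
  numerators ((_ , b) ∷ r) = mul b (numerators r)

  -- The numerator of Σ qₗ xₗ over a common denominator, where aₗ xₗ = bₗ xₗ₊₁.
  combined : List ℤ → Ratios → Poly
  combined [] _ = []
  combined (q ∷ _) [] = q ∷ []
  combined (q ∷ qs) r@((a , _) ∷ r′) = q ⊡ numerators r ⊞ mul a (combined qs r′)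

  Chain : ℤ → Ratios → (ℕ → ℤ) → ℕ → Set
  Chain k [] x l = ⊤
  Chain k ((a , b) ∷ r) x l = (at k a ℤ.* x l ≡ at k b ℤ.* x (suc l)) × Chain k r x (suc l)

  numerators-chain : ∀ k r x l → Chain k r x l → ⟦ denominators r ⟧ k ℤ.* x l ≡ ⟦ numerators r ⟧ k ℤ.* x (length r ℕ.+ l)
  numerators-chain k [] x l _ = refl
  numerators-chain k ((a , b) ∷ r) x l (p , ps) = begin
    ⟦ mul a (denominators r) ⟧ k ℤ.* x l ≡⟨ cong (ℤ._* x l) (⟦mul⟧ a (denominators r) k) ⟩
    at k a ℤ.* ⟦ denominators r ⟧ k ℤ.* x l ≡⟨ swap (at k a) (⟦ denominators r ⟧ k) (x l) ⟩
    ⟦ denominators r ⟧ k ℤ.* (at k a ℤ.* x l) ≡⟨ cong (⟦ denominators r ⟧ k ℤ.*_) p ⟩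
    ⟦ denominators r ⟧ k ℤ.* (at k b ℤ.* x (suc l)) ≡⟨ swap′ (at k b) (⟦ denominators r ⟧ k) (x (suc l)) ⟩
    at k b ℤ.* (⟦ denominators r ⟧ k ℤ.* x (suc l)) ≡⟨ cong (at k b ℤ.*_) (numerators-chain k r x (suc l) ps) ⟩
    at k b ℤ.* (⟦ numerators r ⟧ k ℤ.* x (length r ℕ.+ suc l)) ≡⟨ sym (ℤₚ.*-assoc (at k b) (⟦ numerators r ⟧ k) _) ⟩
    at k b ℤ.* ⟦ numerators r ⟧ k ℤ.* x (length r ℕ.+ suc l)
      ≡⟨ cong₂ (λ y i → y ℤ.* x i) (sym (⟦mul⟧ b (numerators r) k)) (ℕₚ.+-suc (length r) l) ⟩
    ⟦ mul b (numerators r) ⟧ k ℤ.* x (suc (length r ℕ.+ l)) ∎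
    where
    open ≡-Reasoning
    swap : ∀ a d x → a ℤ.* d ℤ.* x ≡ d ℤ.* (a ℤ.* x)
    swap = ℤSolver.solve-∀
    swap′ : ∀ b d x → d ℤ.* (b ℤ.* x) ≡ b ℤ.* (d ℤ.* x)
    swap′ = ℤSolver.solve-∀

  combined-chain : ∀ k q r x l → length q ≡ suc (length r) → Chain k r x l →
    ⟦ denominators r ⟧ k ℤ.* dot q x l ≡ ⟦ combined q r ⟧ k ℤ.* x (length r ℕ.+ l)
  combined-chain k (q ∷ []) [] x l _ _ = trans (cong₂ ℤ._*_ (⟦constant⟧ 1ℤ k) (ℤₚ.+-identityʳ (q ℤ.* x l)))
    (trans (ℤₚ.*-identityˡ _) (cong (ℤ._* x l) (sym (⟦constant⟧ q k))))
  combined-chain k (q ∷ qs) r@((a , b) ∷ r′) x l e c@(_ , c′) = begin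
    ⟦ denominators r ⟧ k ℤ.* (q ℤ.* x l ℤ.+ dot qs x (suc l)) ≡⟨ expand (⟦ denominators r ⟧ k) q (x l) (dot qs x (suc l)) ⟩
    q ℤ.* (⟦ denominators r ⟧ k ℤ.* x l) ℤ.+ ⟦ denominators r ⟧ k ℤ.* dot qs x (suc l)
      ≡⟨ cong₂ (λ y z → q ℤ.* y ℤ.+ z) (numerators-chain k r x l c)
           (trans (cong (ℤ._* dot qs x (suc l)) (⟦mul⟧ a (denominators r′) k)) (trans (ℤₚ.*-assoc (at k a) (⟦ denominators r′ ⟧ k) _)
             (cong (at k a ℤ.*_) (combined-chain k qs r′ x (suc l) (ℕₚ.suc-injective e) c′)))) ⟩
    q ℤ.* (⟦ numerators r ⟧ k ℤ.* x (length r ℕ.+ l)) ℤ.+ at k a ℤ.* (⟦ combined qs r′ ⟧ k ℤ.* x (length r′ ℕ.+ suc l))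
      ≡⟨ cong (λ i → q ℤ.* (⟦ numerators r ⟧ k ℤ.* x (length r ℕ.+ l)) ℤ.+ at k a ℤ.* (⟦ combined qs r′ ⟧ k ℤ.* x i)) (ℕₚ.+-suc (length r′) l) ⟩
    q ℤ.* (⟦ numerators r ⟧ k ℤ.* x (length r ℕ.+ l)) ℤ.+ at k a ℤ.* (⟦ combined qs r′ ⟧ k ℤ.* x (length r ℕ.+ l))
      ≡⟨ collect q (⟦ numerators r ⟧ k) (at k a) (⟦ combined qs r′ ⟧ k) (x (length r ℕ.+ l)) ⟩
    (q ℤ.* ⟦ numerators r ⟧ k ℤ.+ at k a ℤ.* ⟦ combined qs r′ ⟧ k) ℤ.* x (length r ℕ.+ l)
      ≡⟨ cong (ℤ._* x (length r ℕ.+ l)) (sym (trans (⟦⊞⟧ (q ⊡ numerators r) (mul a (combined qs r′)) k) (cong₂ ℤ._+_ (⟦⊡⟧ q (numerators r) k) (⟦mul⟧ a (combined qs r′) k)))) ⟩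
    ⟦ combined (q ∷ qs) r ⟧ k ℤ.* x (length r ℕ.+ l) ∎
    where
    open ≡-Reasoning
    expand : ∀ d q x y → d ℤ.* (q ℤ.* x ℤ.+ y) ≡ q ℤ.* (d ℤ.* x) ℤ.+ d ℤ.* y
    expand = ℤSolver.solve-∀
    collect : ∀ q n a c x → q ℤ.* (n ℤ.* x) ℤ.+ a ℤ.* (c ℤ.* x) ≡ (q ℤ.* n ℤ.+ a ℤ.* c) ℤ.* x
    collect = ℤSolver.solve-∀

  nonNegative-⟦⟧ : ∀ p k → All (0ℤ ℤ.≤_) p → 0ℤ ℤ.≤ ⟦ p ⟧ (+ k)
  nonNegative-⟦⟧ [] k [] = ℤₚ.≤-reflexive (sym (⟦[]⟧ (+ k)))
  nonNegative-⟦⟧ (c ∷ p) k (0≤c ∷ ps) = subst (0ℤ ℤ.≤_) (sym (⟦∷⟧ c p (+ k))) (ℤₚ.+-mono-≤ 0≤c (subst (ℤ._≤ + k ℤ.* ⟦ p ⟧ (+ k)) (ℤₚ.*-zeroʳ (+ k)) (ℤₚ.*-monoˡ-≤-nonNeg (+ k) (nonNegative-⟦⟧ p k ps))))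

  -- The quotients (M - l) / (5M - l) of ψ M (l + 1) by ψ M l, as linear functions of k; each step
  -- in l lowers both constant terms by 1.
  descending : ℕ → ℤ → ℤ → ℤ → ℤ → Ratios
  descending zero _ _ _ _ = []
  descending (suc n) a v b w = ((a , v) , (b , w)) ∷ descending n (a ℤ.- 1ℤ) v (b ℤ.- 1ℤ) w

  -- Ratios of consecutive terms for m = 154 + k: of ψ (m + 2) l, and of ψ (m + 1) l
  -- continued by C(5m-2, 4m+5), C(5m-2, 4m+6), C(5m-2, 4m+7), C(5m-2, 4m+8), C(5m-3, 4m+8).
  ratios₂ bridge ratios₁ : Ratios
  ratios₂ = descending 13 (+ 156) 1ℤ (+ 780) (+ 5)
  bridge =
    ((+ 148 , 1ℤ) , (+ 621 , + 4)) ∷ ((+ 147 , 1ℤ) , (+ 622 , + 4)) ∷ ((+ 146 , 1ℤ) , (+ 623 , + 4)) ∷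
    ((+ 145 , 1ℤ) , (+ 624 , + 4)) ∷ ((+ 144 , 1ℤ) , (+ 768 , + 5)) ∷ []
  ratios₁ = descending 7 (+ 155) 1ℤ (+ 775) (+ 5) ++ bridge

  -- The zeros meet the five bridge terms and leave the sum as it was.
  q₁′ : List ℤ
  q₁′ = q₁ ++ List.replicate 5 0ℤ

  -- With u = 4m + 46 and v the extra factor of the second denominator, this is the numerator of R₂
  -- - u R₁ over the common denominator. By the two weight relations this difference is minus the
  -- number of words of weight 4m + 8.
  gap : Linear → Linear → Poly → Poly → Poly
  gap u v p₁ p₂ = p₂ ⊞ -[1+ 0 ] ⊡ mul u (mul v p₁)

  ⟦gap⟧ : ∀ u v p₁ p₂ k → ⟦ gap u v p₁ p₂ ⟧ k ≡ ⟦ p₂ ⟧ k ℤ.+ -[1+ 0 ] ℤ.* (at k u ℤ.* (at k v ℤ.* ⟦ p₁ ⟧ k))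
  ⟦gap⟧ u v p₁ p₂ k = trans (⟦⊞⟧ p₂ (-[1+ 0 ] ⊡ mul u (mul v p₁)) k)
    (cong (λ x → ⟦ p₂ ⟧ k ℤ.+ x) (trans (⟦⊡⟧ -[1+ 0 ] (mul u (mul v p₁)) k)
      (cong (-[1+ 0 ] ℤ.*_) (trans (⟦mul⟧ u (mul v p₁) k) (cong (at k u ℤ.*_) (⟦mul⟧ v p₁ k))))))

  _⊟1 : Poly → Poly
  p ⊟1 = p ⊞ (-[1+ 0 ] ∷ [])

  -- Expanded in k = m - 154, the gap has nonnegative coefficients. One is taken off the constant
  -- term so that nonnegativity of the rest yields strict positivity.
  gap-positive : All (0ℤ ℤ.≤_) (gap (+ 662 , + 4) (+ 156 , 1ℤ) (combined q₁′ ratios₁) (combined q₂ ratios₂) ⊟1)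
  gap-positive = from-yes (All.all? (0ℤ ℤ.≤?_) (gap (+ 662 , + 4) (+ 156 , 1ℤ) (combined q₁′ ratios₁) (combined q₂ ratios₂) ⊟1))

  denominators₂-nonNegative : All (0ℤ ℤ.≤_) (denominators ratios₂)
  denominators₂-nonNegative = from-yes (All.all? (0ℤ ℤ.≤?_) (denominators ratios₂))

  -- The products are (156 + k) ... (144 + k) and (155 + k) ... (144 + k): the bridge continues the
  -- first chain to the same last linear factor.
  denominators₂ : denominators ratios₂ ≡ mul (+ 156 , 1ℤ) (denominators ratios₁)
  denominators₂ = refl

  module Comparison (k : ℕ) (u v : Linear) (q₁ q₂ : List ℤ) (r₁ r₂ : Ratios) (x₁ x₂ : ℕ → ℤ) (b : ℕ) (1≤b : 1 ≤ b)
    (length₁ : length q₁ ≡ suc (length r₁)) (length₂ : length q₂ ≡ suc (length r₂))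
    (chain₁ : Chain (+ k) r₁ x₁ 0) (chain₂ : Chain (+ k) r₂ x₂ 0)
    (last₁ : x₁ (length r₁ ℕ.+ 0) ≡ + b) (last₂ : x₂ (length r₂ ℕ.+ 0) ≡ + b)
    (common : denominators r₂ ≡ mul v (denominators r₁))
    (denominators≥0 : All (0ℤ ℤ.≤_) (denominators r₂))
    (gap>0 : All (0ℤ ℤ.≤_) (gap u v (combined q₁ r₁) (combined q₂ r₂) ⊟1)) where

    R₁ R₂ D₁ D₂ C₁ C₂ U V G : ℤ
    R₁ = dot q₁ x₁ 0
    R₂ = dot q₂ x₂ 0
    D₁ = ⟦ denominators r₁ ⟧ (+ k)
    D₂ = ⟦ denominators r₂ ⟧ (+ k)
    C₁ = ⟦ combined q₁ r₁ ⟧ (+ k)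
    C₂ = ⟦ combined q₂ r₂ ⟧ (+ k)
    U = at (+ k) u
    V = at (+ k) v
    G = ⟦ gap u v (combined q₁ r₁) (combined q₂ r₂) ⊟1 ⟧ (+ k)

    R₁-combined : D₁ ℤ.* R₁ ≡ C₁ ℤ.* + b
    R₁-combined = trans (combined-chain (+ k) q₁ r₁ x₁ 0 length₁ chain₁) (cong (C₁ ℤ.*_) last₁)

    R₂-combined : D₂ ℤ.* R₂ ≡ C₂ ℤ.* + b
    R₂-combined = trans (combined-chain (+ k) q₂ r₂ x₂ 0 length₂ chain₂) (cong (C₂ ℤ.*_) last₂)

    D₂≡ : D₂ ≡ V ℤ.* D₁
    D₂≡ = trans (cong (λ p → ⟦ p ⟧ (+ k)) common) (⟦mul⟧ v (denominators r₁) (+ k))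

    G≡ : G ℤ.+ 1ℤ ≡ C₂ ℤ.+ -[1+ 0 ] ℤ.* (U ℤ.* (V ℤ.* C₁))
    G≡ = trans (cong (ℤ._+ 1ℤ) (trans (⟦⊞⟧ (gap u v (combined q₁ r₁) (combined q₂ r₂)) (-[1+ 0 ] ∷ []) (+ k))
        (cong₂ ℤ._+_ (⟦gap⟧ u v (combined q₁ r₁) (combined q₂ r₂) (+ k)) (⟦constant⟧ -[1+ 0 ] (+ k)))))
      (minus-one (C₂ ℤ.+ -[1+ 0 ] ℤ.* (U ℤ.* (V ℤ.* C₁))))
      where
      minus-one : ∀ x → x ℤ.+ -[1+ 0 ] ℤ.+ 1ℤ ≡ x
      minus-one = ℤSolver.solve-∀

    G-b : (G ℤ.+ 1ℤ) ℤ.* + b ≡ D₂ ℤ.* (R₂ ℤ.- U ℤ.* R₁)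
    G-b = begin
      (G ℤ.+ 1ℤ) ℤ.* + b ≡⟨ cong (ℤ._* + b) G≡ ⟩
      (C₂ ℤ.+ -[1+ 0 ] ℤ.* (U ℤ.* (V ℤ.* C₁))) ℤ.* + b ≡⟨ distribute C₂ U V C₁ (+ b) ⟩
      C₂ ℤ.* + b ℤ.- U ℤ.* (V ℤ.* (C₁ ℤ.* + b)) ≡⟨ cong₂ (λ x y → x ℤ.- U ℤ.* (V ℤ.* y)) (sym R₂-combined) (sym R₁-combined) ⟩
      D₂ ℤ.* R₂ ℤ.- U ℤ.* (V ℤ.* (D₁ ℤ.* R₁)) ≡⟨ cong (λ x → x ℤ.* R₂ ℤ.- U ℤ.* (V ℤ.* (D₁ ℤ.* R₁))) D₂≡ ⟩
      V ℤ.* D₁ ℤ.* R₂ ℤ.- U ℤ.* (V ℤ.* (D₁ ℤ.* R₁)) ≡⟨ factor V D₁ R₂ U R₁ ⟩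
      V ℤ.* D₁ ℤ.* (R₂ ℤ.- U ℤ.* R₁) ≡⟨ cong (ℤ._* (R₂ ℤ.- U ℤ.* R₁)) (sym D₂≡) ⟩
      D₂ ℤ.* (R₂ ℤ.- U ℤ.* R₁) ∎
      where
      open ≡-Reasoning
      distribute : ∀ c u v d b → (c ℤ.+ -[1+ 0 ] ℤ.* (u ℤ.* (v ℤ.* d))) ℤ.* b ≡ c ℤ.* b ℤ.- u ℤ.* (v ℤ.* (d ℤ.* b))
      distribute = ℤSolver.solve-∀
      factor : ∀ v d r u t → v ℤ.* d ℤ.* r ℤ.- u ℤ.* (v ℤ.* (d ℤ.* t)) ≡ v ℤ.* d ℤ.* (r ℤ.- u ℤ.* t)
      factor = ℤSolver.solve-∀

    -- Multiplied by the denominator D₂, the relation says (G + 1) b + D₂ A′ = 0, although G, D₂ and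
    -- A′ are nonnegative and b ≥ 1.
    impossible : ∀ A A′ → A ≡ ℤ.- R₁ → R₂ ℤ.+ (A ℤ.* U ℤ.+ + A′) ≡ 0ℤ → ⊥
    impossible A A′ A≡ relation = positive G D₂ 1≤b (nonNegative-⟦⟧ _ k gap>0) (nonNegative-⟦⟧ _ k denominators≥0) (begin
      (G ℤ.+ 1ℤ) ℤ.* + b ℤ.+ D₂ ℤ.* + A′ ≡⟨ cong (ℤ._+ D₂ ℤ.* + A′) G-b ⟩
      D₂ ℤ.* (R₂ ℤ.- U ℤ.* R₁) ℤ.+ D₂ ℤ.* + A′ ≡⟨ collect D₂ R₂ U R₁ (+ A′) ⟩
      D₂ ℤ.* (R₂ ℤ.+ (ℤ.- R₁ ℤ.* U ℤ.+ + A′)) ≡⟨ cong (λ x → D₂ ℤ.* (R₂ ℤ.+ (x ℤ.* U ℤ.+ + A′))) (sym A≡) ⟩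
      D₂ ℤ.* (R₂ ℤ.+ (A ℤ.* U ℤ.+ + A′)) ≡⟨ cong (D₂ ℤ.*_) relation ⟩
      D₂ ℤ.* 0ℤ ≡⟨ ℤₚ.*-zeroʳ D₂ ⟩
      0ℤ ∎)
      where
      open ≡-Reasoning
      collect : ∀ d r u t a → d ℤ.* (r ℤ.- u ℤ.* t) ℤ.+ d ℤ.* a ≡ d ℤ.* (r ℤ.+ (ℤ.- t ℤ.* u ℤ.+ a))
      collect = ℤSolver.solve-∀
      positive : ∀ x d {b} → 1 ≤ b → 0ℤ ℤ.≤ x → 0ℤ ℤ.≤ d → (x ℤ.+ 1ℤ) ℤ.* + b ℤ.+ d ℤ.* + A′ ≡ 0ℤ → ⊥
      positive (+ x) (+ d) {suc b} _ _ _ p with x ℕ.+ 1 | ℕₚ.+-comm x 1 | + d ℤ.* + A′ | ℤₚ.pos-* d A′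
      ... | _ | refl | _ | refl with p
      ...   | ()

  ψ-ratio : ∀ M l → l < M → (+ M ℤ.- + l) ℤ.* + ψ M l ≡ (+ (M ℕ.* 5) ℤ.- + l) ℤ.* + ψ M (suc l)
  ψ-ratio M l l<M = trans (cong₂ ℤ._*_ (difference M l (suc j) M≡) (cong +_ (ψ-binomial M l (suc j) M≡)))
    (trans (trans (sym (ℤₚ.pos-* (suc j) (binomial (M ℕ.* 4) (suc j)))) (trans (cong +_ (binomial-sucʳ (M ℕ.* 4) j)) (ℤₚ.pos-* (M ℕ.* 4 ℕ.+ suc j) (binomial (M ℕ.* 4) j))))
      (sym (cong₂ ℤ._*_ (difference (M ℕ.* 5) l (M ℕ.* 4 ℕ.+ suc j) 5M≡) (cong +_ (ψ-binomial M (suc l) j (trans M≡ (ℕₚ.+-suc l j)))))))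
    where
    j : ℕ
    j = M ∸ suc l
    M≡ : M ≡ l ℕ.+ suc j
    M≡ = trans (sym (ℕₚ.m+[n∸m]≡n l<M)) (sym (ℕₚ.+-suc l j))
    5M≡ : M ℕ.* 5 ≡ l ℕ.+ (M ℕ.* 4 ℕ.+ suc j)
    5M≡ = trans (ℕₚ.*-suc M 4) (trans (cong (ℕ._+ M ℕ.* 4) M≡) (lemma l (suc j) (M ℕ.* 4)))
      where
      lemma : ∀ x y z → x ℕ.+ y ℕ.+ z ≡ x ℕ.+ (z ℕ.+ y)
      lemma = ℕSolver.solve-∀
    difference : ∀ n l r → n ≡ l ℕ.+ r → + n ℤ.- + l ≡ + r
    difference _ l r refl = lemma (+ l) (+ r)
      where
      lemma : ∀ x y → x ℤ.+ y ℤ.- x ≡ y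
      lemma = ℤSolver.solve-∀

  chain-descending : ∀ M k n l a b → at k (a , 1ℤ) ≡ + M ℤ.- + l → at k (b , + 5) ≡ + (M ℕ.* 5) ℤ.- + l → n ℕ.+ l ≤ M →
    (x : ℕ → ℤ) → (∀ i → i ≤ n ℕ.+ l → x i ≡ + ψ M i) → Chain k (descending n a 1ℤ b (+ 5)) x l
  chain-descending M k zero l a b p q n+l≤M x x≡ = tt
  chain-descending M k (suc n) l a b p q n+l≤M x x≡ =
    trans (cong₂ ℤ._*_ p (x≡ l (ℕₚ.m≤n+m l (suc n))))
      (trans (ψ-ratio M l (ℕₚ.≤-trans (s≤s (ℕₚ.m≤n+m l n)) n+l≤M))
        (sym (cong₂ ℤ._*_ q (x≡ (suc l) (s≤s (ℕₚ.m≤n+m l n)))))) ,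
    chain-descending M k n (suc l) (a ℤ.- 1ℤ) (b ℤ.- 1ℤ) (decrement a 1ℤ k (+ M) (+ l) p) (decrement b (+ 5) k (+ (M ℕ.* 5)) (+ l) q)
      (subst (ℕ._≤ M) (sym (ℕₚ.+-suc n l)) n+l≤M) x (λ i i≤ → x≡ i (subst (i ≤_) (ℕₚ.+-suc n l) i≤))
    where
    decrement : ∀ a v k M l → a ℤ.+ v ℤ.* k ≡ M ℤ.- l → a ℤ.- 1ℤ ℤ.+ v ℤ.* k ≡ M ℤ.- (1ℤ ℤ.+ l)
    decrement a v k M l p = trans (lemma a v k) (trans (cong (ℤ._- 1ℤ) p) (lemma′ M l))
      where
      lemma : ∀ a v k → a ℤ.- 1ℤ ℤ.+ v ℤ.* k ≡ a ℤ.+ v ℤ.* k ℤ.- 1ℤ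
      lemma = ℤSolver.solve-∀
      lemma′ : ∀ M l → M ℤ.- l ℤ.- 1ℤ ≡ M ℤ.- (1ℤ ℤ.+ l)
      lemma′ = ℤSolver.solve-∀

  chain-++ : ∀ k r r′ x l → Chain k r x l → Chain k r′ x (length r ℕ.+ l) → Chain k (r ++ r′) x l
  chain-++ k [] r′ x l _ c = c
  chain-++ k (_ ∷ r) r′ x l (p , ps) c = p , chain-++ k r r′ x (suc l) ps (subst (Chain k r′ x) (sym (ℕₚ.+-suc (length r) l)) c)

  -- Here m = 10 + j = 154 + k.
  module LargeLength (k j : ℕ) (j≡ : j ≡ 144 ℕ.+ k) where
    -- n = 4(m + 1). The bridge reaches ψ (m + 2) 12 = C(5m - 2, 4m + 8), whose complementary lower
    -- index is m - 10 = j.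
    n : ℕ
    n = (11 ℕ.+ j) ℕ.* 4

    +j≡ : + j ≡ + 144 ℤ.+ + k
    +j≡ = cong +_ j≡

    y : ℕ → ℤ
    y 8 = + binomial (1 ℕ.+ n) (3 ℕ.+ j)
    y 9 = + binomial (2 ℕ.+ n) (2 ℕ.+ j)
    y 10 = + binomial (3 ℕ.+ n) (1 ℕ.+ j)
    y 11 = + binomial (4 ℕ.+ n) j
    y 12 = + ψ (12 ℕ.+ j) 13
    y l = + ψ (11 ℕ.+ j) l

    y≡ψ : ∀ l → l ≤ 7 → y l ≡ + ψ (11 ℕ.+ j) l
    y≡ψ 0 _ = refl
    y≡ψ 1 _ = refl
    y≡ψ 2 _ = refl
    y≡ψ 3 _ = refl
    y≡ψ 4 _ = refl
    y≡ψ 5 _ = refl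
    y≡ψ 6 _ = refl
    y≡ψ 7 _ = refl
    y≡ψ (suc (suc (suc (suc (suc (suc (suc (suc l)))))))) (s≤s (s≤s (s≤s (s≤s (s≤s (s≤s (s≤s ())))))))

    scaled : ∀ a b → + (a ℕ.* k ℕ.+ b) ≡ + b ℤ.+ + a ℤ.* + k
    scaled a b = trans (cong (ℤ._+ + b) (ℤₚ.pos-* a k)) (ℤₚ.+-comm (+ a ℤ.* + k) (+ b))

    shift : ∀ a b i c d v e w → suc i ≡ v ℕ.* k ℕ.+ c → suc a ≡ w ℕ.* k ℕ.+ d →
      b ≡ binomial a (suc i) → e ≡ binomial (suc a) i → at (+ k) (+ c , + v) ℤ.* + b ≡ at (+ k) (+ d , + w) ℤ.* + e
    shift a b i c d v e w p q refl refl = trans (cong (ℤ._* + b) (trans (sym (scaled v c)) (cong +_ (sym p))))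
      (trans (trans (sym (ℤₚ.pos-* (suc i) (binomial a (suc i)))) (trans (cong +_ (binomial-shift a i)) (ℤₚ.pos-* (suc a) (binomial (suc a) i))))
        (cong (ℤ._* + e) (trans (cong +_ q) (scaled w d))))

    1*k+ : ∀ c → c ℕ.+ j ≡ 1 ℕ.* k ℕ.+ (c ℕ.+ 144)
    1*k+ c = trans (cong (c ℕ.+_) j≡) (lemma c 144 k)
      where
      lemma : ∀ a b k → a ℕ.+ (b ℕ.+ k) ≡ 1 ℕ.* k ℕ.+ (a ℕ.+ b)
      lemma = ℕSolver.solve-∀

    n+ : ∀ c → c ℕ.+ n ≡ 4 ℕ.* k ℕ.+ (c ℕ.+ 620)
    n+ c = trans (cong (λ i → c ℕ.+ (11 ℕ.+ i) ℕ.* 4) j≡) (lemma c 11 144 k)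
      where
      lemma : ∀ c a b k → c ℕ.+ (a ℕ.+ (b ℕ.+ k)) ℕ.* 4 ≡ 4 ℕ.* k ℕ.+ (c ℕ.+ (a ℕ.+ b) ℕ.* 4)
      lemma = ℕSolver.solve-∀

    13≤ : 13 ≤ 12 ℕ.+ j
    13≤ = ℕₚ.+-monoʳ-≤ 12 (subst (1 ≤_) (sym j≡) (s≤s z≤n))

    +M : ∀ c → + (c ℕ.+ j) ≡ + c ℤ.+ (+ 144 ℤ.+ + k)
    +M c = cong (λ i → + c ℤ.+ i) +j≡

    +5M : ∀ c → + ((c ℕ.+ j) ℕ.* 5) ≡ (+ c ℤ.+ (+ 144 ℤ.+ + k)) ℤ.* + 5
    +5M c = trans (ℤₚ.pos-* (c ℕ.+ j) 5) (cong (ℤ._* + 5) (+M c))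

    chain₂ : Chain (+ k) ratios₂ (λ l → + ψ (12 ℕ.+ j) l) 0
    chain₂ = chain-descending (12 ℕ.+ j) (+ k) 13 0 (+ 156) (+ 780)
      (trans (lemma (+ k)) (cong (ℤ._- 0ℤ) (sym (+M 12)))) (trans (lemma′ (+ k)) (cong (ℤ._- 0ℤ) (sym (+5M 12))))
      13≤ _ (λ _ _ → refl)
      where
      lemma : ∀ k → + 156 ℤ.+ 1ℤ ℤ.* k ≡ + 12 ℤ.+ (+ 144 ℤ.+ k) ℤ.- 0ℤ
      lemma = ℤSolver.solve-∀
      lemma′ : ∀ k → + 780 ℤ.+ + 5 ℤ.* k ≡ (+ 12 ℤ.+ (+ 144 ℤ.+ k)) ℤ.* + 5 ℤ.- 0ℤ
      lemma′ = ℤSolver.solve-∀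

    chain₁ : Chain (+ k) ratios₁ y 0
    chain₁ = chain-++ (+ k) (descending 7 (+ 155) 1ℤ (+ 775) (+ 5)) bridge y 0
      (chain-descending (11 ℕ.+ j) (+ k) 7 0 (+ 155) (+ 775)
        (trans (lemma (+ k)) (cong (ℤ._- 0ℤ) (sym (+M 11)))) (trans (lemma′ (+ k)) (cong (ℤ._- 0ℤ) (sym (+5M 11))))
        (ℕₚ.m≤m+n 7 (4 ℕ.+ j)) y (λ i i≤7 → y≡ψ i i≤7))
      ( shift n (ψ (11 ℕ.+ j) 7) (3 ℕ.+ j) 148 621 1 (binomial (1 ℕ.+ n) (3 ℕ.+ j)) 4 (1*k+ 4) (n+ 1) (ψ-binomial (11 ℕ.+ j) 7 (4 ℕ.+ j) refl) refl
      , shift (1 ℕ.+ n) (binomial (1 ℕ.+ n) (3 ℕ.+ j)) (2 ℕ.+ j) 147 622 1 (binomial (2 ℕ.+ n) (2 ℕ.+ j)) 4 (1*k+ 3) (n+ 2) refl refl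
      , shift (2 ℕ.+ n) (binomial (2 ℕ.+ n) (2 ℕ.+ j)) (1 ℕ.+ j) 146 623 1 (binomial (3 ℕ.+ n) (1 ℕ.+ j)) 4 (1*k+ 2) (n+ 3) refl refl
      , shift (3 ℕ.+ n) (binomial (3 ℕ.+ n) (1 ℕ.+ j)) j 145 624 1 (binomial (4 ℕ.+ n) j) 4 (1*k+ 1) (n+ 4) refl refl
      , trans (cong₂ ℤ._*_ (trans (lemma″ (+ k)) (cong (ℤ._- + 12) (sym (+M 12)))) (cong +_ (sym (ψ-binomial (12 ℕ.+ j) 12 j refl))))
          (trans (ψ-ratio (12 ℕ.+ j) 12 13≤)
            (cong (ℤ._* + ψ (12 ℕ.+ j) 13) (trans (cong (ℤ._- + 12) (+5M 12)) (lemma‴ (+ k)))))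
      , tt )
      where
      lemma : ∀ k → + 155 ℤ.+ 1ℤ ℤ.* k ≡ + 11 ℤ.+ (+ 144 ℤ.+ k) ℤ.- 0ℤ
      lemma = ℤSolver.solve-∀
      lemma′ : ∀ k → + 775 ℤ.+ + 5 ℤ.* k ≡ (+ 11 ℤ.+ (+ 144 ℤ.+ k)) ℤ.* + 5 ℤ.- 0ℤ
      lemma′ = ℤSolver.solve-∀
      lemma″ : ∀ k → + 144 ℤ.+ 1ℤ ℤ.* k ≡ + 12 ℤ.+ (+ 144 ℤ.+ k) ℤ.- + 12
      lemma″ = ℤSolver.solve-∀
      lemma‴ : ∀ k → (+ 12 ℤ.+ (+ 144 ℤ.+ k)) ℤ.* + 5 ℤ.- + 12 ≡ + 768 ℤ.+ + 5 ℤ.* k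
      lemma‴ = ℤSolver.solve-∀

    1≤β : 1 ≤ ψ (12 ℕ.+ j) 13
    1≤β = subst (1 ≤_) (sym (ψ-binomial (12 ℕ.+ j) 13 (12 ℕ.+ j ∸ 13) (sym (ℕₚ.m+[n∸m]≡n 13≤)))) (binomial>0 ((12 ℕ.+ j) ℕ.* 4) (12 ℕ.+ j ∸ 13))

    4m+46 : + (4 ℕ.* (10 ℕ.+ j) ℕ.+ 46) ≡ at (+ k) (+ 662 , + 4)
    4m+46 = trans (cong +_ (trans (cong (λ i → 4 ℕ.* (10 ℕ.+ i) ℕ.+ 46) j≡) (lemma 10 144 k))) (scaled 4 662)
      where
      lemma : ∀ a b k → 4 ℕ.* (a ℕ.+ (b ℕ.+ k)) ℕ.+ 46 ≡ 4 ℕ.* k ℕ.+ (4 ℕ.* (a ℕ.+ b) ℕ.+ 46)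
      lemma = ℕSolver.solve-∀

    open Comparison k (+ 662 , + 4) (+ 156 , 1ℤ) q₁′ q₂ ratios₁ ratios₂ y (λ l → + ψ (12 ℕ.+ j) l) (ψ (12 ℕ.+ j) 13) 1≤β
      refl refl chain₁ chain₂ refl refl denominators₂ denominators₂-nonNegative gap-positive using (impossible)

    large-impossible : ∀ A A′ → + A ≡ ℤ.- dot q₁ (λ l → + ψ (11 ℕ.+ j) l) 0 →
      dot q₂ (λ l → + ψ (12 ℕ.+ j) l) 0 ℤ.+ (+ A ℤ.* + (4 ℕ.* (10 ℕ.+ j) ℕ.+ 46) ℤ.+ + A′) ≡ 0ℤ → ⊥
    large-impossible A A′ A≡ relation = impossible (+ A) A′ (trans A≡ (cong ℤ.-_ padded))
      (trans (cong (λ u → dot q₂ (λ l → + ψ (12 ℕ.+ j) l) 0 ℤ.+ (+ A ℤ.* u ℤ.+ + A′)) (sym 4m+46)) relation)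
      where
      padded : dot q₁ (λ l → + ψ (11 ℕ.+ j) l) 0 ≡ dot q₁′ y 0
      padded = trans (sym (dot-cong q₁ y (λ l → + ψ (11 ℕ.+ j) l) 0 λ i i<8 → y≡ψ i (ℕₚ.≤-pred i<8))) (sym (dot-pad q₁ y 0 5))

-- Lengths with m ≤ 153: integrality of λ

module SmallLengths where
  open Coefficients using (ψ; dot)
  open SemiInvariants using (q₁)
  open import Data.Nat using (_+_; _*_)

  -- By `minimum-count` the sum is minus a number of codewords, so the absolute value is that
  -- number.
  minimumCount : ℕ → ℕ
  minimumCount m = ℤ.∣ dot q₁ (λ k → + ψ (suc m) k) 0 ∣

  exceptions : List ℕ
  exceptions = 8 ∷ 42 ∷ 63 ∷ 75 ∷ 130 ∷ []

  Excluded : ℕ → Set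
  Excluded m = ¬ ((24 * m) choose 8 ∣ minimumCount m * ((4 * m + 4) choose 8))

  excluded? : ∀ i → Dec (Excluded (suc i) ⊎ suc i ∈ exceptions)
  excluded? i = ¬? (_ ∣? _) ⊎-dec (suc i ∈? exceptions)

  excluded : All (λ i → Excluded (suc i) ⊎ suc i ∈ exceptions) (upTo 153)
  excluded = from-yes (All.all? excluded? (upTo 153))

-- Counting pairs of a block and an 8-subset

module DoubleCounting where
  open WeightCounts using (hasWeight; weightCount)
  open import Data.Nat using (_+_; _*_)
  open Σℕ using (∑; χ; ∑-cong; ∑-+; ∑-*ˡ; ∑-*ʳ; ∑-0; ∑-swap)

  _∩_ _∖_ : ∀ {n} → Word n → Word n → Word n
  b ∩ c = zipWith _∧_ b c
  b ∖ c = zipWith (λ x y → x ∧ not y) b c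

  -- Holds when T has exactly j points in c and l points outside c; both counters are used up along
  -- the coordinates.
  meets : ∀ {n} → Word n → Word n → ℕ → ℕ → Bool
  meets [] [] zero zero = true
  meets [] [] zero (suc l) = false
  meets [] [] (suc j) l = false
  meets (x ∷ c) (false ∷ T) j l = meets c T j l
  meets (true ∷ c) (true ∷ T) zero l = false
  meets (true ∷ c) (true ∷ T) (suc j) l = meets c T j l
  meets (false ∷ c) (true ∷ T) j zero = false
  meets (false ∷ c) (true ∷ T) j (suc l) = meets c T j l

  meets⇒size : ∀ {n} (c T : Word n) j l → meets c T j l ≡ true → wt T ≡ j + l
  meets⇒size [] [] zero zero _ = refl
  meets⇒size (x ∷ c) (false ∷ T) j l p = meets⇒size c T j l p
  meets⇒size (true ∷ c) (true ∷ T) (suc j) l p = cong suc (meets⇒size c T j l p)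
  meets⇒size (false ∷ c) (true ∷ T) j (suc l) p = trans (cong suc (meets⇒size c T j l p)) (sym (ℕₚ.+-suc j l))

  subsetCount : ∀ {n} → Word n → Word n → ℕ → ℕ → ℕ
  subsetCount b c j l = ∑ (λ T → χ (does (T ⊆? b)) * χ (meets c T j l))

  ∑-zero : ∀ {n} (f : Word n → ℕ) → (∀ T → f T ≡ 0) → ∑ f ≡ 0
  ∑-zero {n} f p = trans (∑-cong p) (∑-0 {n})

  -- T ⊆ b is chosen independently inside and outside c; each point of b gives one instance of
  -- Pascal's rule.
  subsetCount≡ : ∀ {n} (b c : Word n) j l → subsetCount b c j l ≡ (wt (b ∩ c) choose j) * (wt (b ∖ c) choose l)
  subsetCount≡ [] [] zero zero = refl
  subsetCount≡ [] [] zero (suc l) = refl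
  subsetCount≡ [] [] (suc j) l = refl
  subsetCount≡ (false ∷ b) (x ∷ c) j l = trans
    (cong₂ _+_ (subsetCount≡ b c j l) (∑-zero (λ T → χ (does ((true ∷ T) ⊆? (false ∷ b))) * χ (meets (x ∷ c) (true ∷ T) j l)) (λ T → refl)))
    (ℕₚ.+-identityʳ _)
  subsetCount≡ (true ∷ b) (true ∷ c) zero l = trans
    (cong₂ _+_ (subsetCount≡ b c zero l) (∑-zero (λ T → χ (does (T ⊆? b)) * 0) (λ T → ℕₚ.*-zeroʳ (χ (does (T ⊆? b))))))
    (ℕₚ.+-identityʳ _)
  subsetCount≡ (true ∷ b) (true ∷ c) (suc j) l = trans
    (cong₂ _+_ (subsetCount≡ b c (suc j) l) (subsetCount≡ b c j l))
    (trans (sym (ℕₚ.*-distribʳ-+ (wt (b ∖ c) choose l) (wt (b ∩ c) choose suc j) (wt (b ∩ c) choose j)))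
      (cong (_* (wt (b ∖ c) choose l)) (trans (ℕₚ.+-comm (wt (b ∩ c) choose suc j) _) (nCk+nC[k+1]≡[n+1]C[k+1] (wt (b ∩ c)) j))))
  subsetCount≡ (true ∷ b) (false ∷ c) j zero = trans
    (cong₂ _+_ (subsetCount≡ b c j zero) (∑-zero (λ T → χ (does (T ⊆? b)) * 0) (λ T → ℕₚ.*-zeroʳ (χ (does (T ⊆? b))))))
    (ℕₚ.+-identityʳ _)
  subsetCount≡ (true ∷ b) (false ∷ c) j (suc l) = trans
    (cong₂ _+_ (subsetCount≡ b c j (suc l)) (subsetCount≡ b c j l))
    (trans (sym (ℕₚ.*-distribˡ-+ (wt (b ∩ c) choose j) (wt (b ∖ c) choose suc l) (wt (b ∖ c) choose l)))
      (cong ((wt (b ∩ c) choose j) *_) (trans (ℕₚ.+-comm (wt (b ∖ c) choose suc l) _) (nCk+nC[k+1]≡[n+1]C[k+1] (wt (b ∖ c)) l))))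

  wt-∩-∖ : ∀ {n} (b c : Word n) → wt (b ∩ c) + wt (b ∖ c) ≡ wt b
  wt-∩-∖ [] [] = refl
  wt-∩-∖ (false ∷ b) (x ∷ c) = wt-∩-∖ b c
  wt-∩-∖ (true ∷ b) (true ∷ c) = cong suc (wt-∩-∖ b c)
  wt-∩-∖ (true ∷ b) (false ∷ c) = trans (ℕₚ.+-suc _ _) (cong suc (wt-∩-∖ b c))

  wt-ones : ∀ n → wt (ones {n}) ≡ n
  wt-ones zero = refl
  wt-ones (suc n) = cong suc (wt-ones n)

  wt-∖ : ∀ {n} (b c : Word n) → wt (b ∖ c) ≡ wt b ∸ wt (b ∩ c)
  wt-∖ b c = sym (trans (cong (_∸ wt (b ∩ c)) (sym (wt-∩-∖ b c))) (ℕₚ.m+n∸m≡n (wt (b ∩ c)) _))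

  meetsCount : ∀ {n} (c : Word n) j l → ∑ (λ T → χ (meets c T j l)) ≡ (wt c choose j) * ((n ∸ wt c) choose l)
  meetsCount {n} c j l = trans
    (∑-cong λ T → sym (trans (cong (λ b → χ b * χ (meets c T j l)) (dec-true (T ⊆? ones) ⊆⊤)) (ℕₚ.*-identityˡ (χ (meets c T j l)))))
    (trans (subsetCount≡ ones c j l) (cong₂ (λ x y → (x choose j) * (y choose l)) (cong wt (ones-∧ c))
      (trans (wt-∖ ones c) (cong₂ _∸_ (wt-ones n) (cong wt (ones-∧ c))))))

  -- Σⱼ eⱼ C(x, j) C(y, 8 - j), when called with j = 0 and l = 8.
  form : List ℕ → ℕ → ℕ → ℕ → ℕ → ℕ
  form [] j l x y = 0
  form (e ∷ es) j zero x y = e * ((x choose j) * (y choose 0))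
  form (e ∷ es) j (suc l) x y = e * ((x choose j) * (y choose suc l)) + form es (suc j) l x y

  hasWeight⇒ : ∀ {n} {C : Code n} {w} b → hasWeight C w b ≡ true → (b ∈C C) × wt b ≡ w
  hasWeight⇒ {C = C} {w} b p with C b | wt b ℕ.≟ w
  ... | true | yes q = refl , q

  module _ {n} {C : Code n} {w lam : ℕ} (design : ∀ T → ∣ T ∣ ≡ 8 → blocksContaining (supportBlocks C w) T ≡ lam) where

    blocks : ∀ T → blocksContaining (supportBlocks C w) T ≡ ∑ (λ b → χ (hasWeight C w b) * χ (does (T ⊆? b)))
    blocks T = trans (length-filterᵇ (λ b → ⌊ T ⊆? b ⌋) (supportBlocks C w))
      (trans (sumWith-map (χ ∘ (λ b → ⌊ T ⊆? b ⌋)) supp (filterᵇ (hasWeight C w) (allWords n)))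
        (trans (sumWith-filterᵇ (χ ∘ (λ b → ⌊ T ⊆? b ⌋)) (hasWeight C w) (allWords n))
          (trans (sumWith-allWords n (λ b → χ (hasWeight C w b) * χ ⌊ T ⊆? b ⌋))
            (∑-cong λ b → cong (λ v → χ (hasWeight C w b) * χ v) (isYes≗does (T ⊆? b))))))

    doubleCount : ∀ c j l → j + l ≡ 8 →
      ∑ (λ b → χ (hasWeight C w b) * ((wt (b ∩ c) choose j) * (wt (b ∖ c) choose l))) ≡
      lam * ((wt c choose j) * ((n ∸ wt c) choose l))
    doubleCount c j l j+l≡8 = begin
      ∑ (λ b → h b * ((wt (b ∩ c) choose j) * (wt (b ∖ c) choose l)))
        ≡⟨ (∑-cong λ b → trans (cong (h b *_) (sym (subsetCount≡ b c j l))) (sym (∑-*ˡ (h b) (λ T → s T b * p T)))) ⟩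
      ∑ (λ b → ∑ (λ T → h b * (s T b * p T))) ≡⟨ ∑-swap {n} {n} (λ b T → h b * (s T b * p T)) ⟩
      ∑ (λ T → ∑ (λ b → h b * (s T b * p T)))
        ≡⟨ (∑-cong λ T → trans (∑-cong λ b → sym (ℕₚ.*-assoc (h b) (s T b) (p T))) (∑-*ʳ (p T) (λ b → h b * s T b))) ⟩
      ∑ (λ T → ∑ (λ b → h b * s T b) * p T) ≡⟨ ∑-cong constant ⟩
      ∑ (λ T → lam * p T) ≡⟨ ∑-*ˡ lam p ⟩
      lam * ∑ p ≡⟨ cong (lam *_) (meetsCount c j l) ⟩
      lam * ((wt c choose j) * ((n ∸ wt c) choose l)) ∎
      where
      open ≡-Reasoning
      h : Word n → ℕ
      h b = χ (hasWeight C w b)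
      s : Word n → Word n → ℕ
      s T b = χ (does (T ⊆? b))
      p : Word n → ℕ
      p T = χ (meets c T j l)
      constant : ∀ T → ∑ (λ b → h b * s T b) * p T ≡ lam * p T
      constant T with meets c T j l in eq
      -- A set T counted by `meets` has j + l = 8 points, so the design condition applies to it.
      ... | true = cong (_* 1) (trans (sym (blocks T)) (design T (trans (meets⇒size c T j l eq) j+l≡8)))
      ... | false = trans (ℕₚ.*-zeroʳ (∑ (λ b → h b * s T b))) (sym (ℕₚ.*-zeroʳ lam))

    doubleCount-* : ∀ c e j l → j + l ≡ 8 →
      ∑ (λ b → χ (hasWeight C w b) * (e * ((wt (b ∩ c) choose j) * (wt (b ∖ c) choose l)))) ≡
      lam * (e * ((wt c choose j) * ((n ∸ wt c) choose l)))
    doubleCount-* c e j l j+l≡8 = trans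
      (∑-cong λ b → swap (χ (hasWeight C w b)) e ((wt (b ∩ c) choose j) * (wt (b ∖ c) choose l)))
      (trans (∑-*ˡ e (λ b → χ (hasWeight C w b) * ((wt (b ∩ c) choose j) * (wt (b ∖ c) choose l))))
        (trans (cong (e *_) (doubleCount c j l j+l≡8)) (swap e lam ((wt c choose j) * ((n ∸ wt c) choose l)))))
      where
      swap : ∀ x y z → x * (y * z) ≡ y * (x * z)
      swap = ℕSolver.solve-∀

    doubleCount-form : ∀ c es j l → j + l ≡ 8 →
      ∑ (λ b → χ (hasWeight C w b) * form es j l (wt (b ∩ c)) (wt (b ∖ c))) ≡ lam * form es j l (wt c) (n ∸ wt c)
    doubleCount-form c [] j l _ = trans (∑-zero (λ b → χ (hasWeight C w b) * 0) (λ b → ℕₚ.*-zeroʳ (χ (hasWeight C w b)))) (sym (ℕₚ.*-zeroʳ lam))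
    doubleCount-form c (e ∷ es) j zero j+l≡8 = doubleCount-* c e j zero j+l≡8
    doubleCount-form c (e ∷ es) j (suc l) j+l≡8 = trans
      (∑-cong λ b → ℕₚ.*-distribˡ-+ (χ (hasWeight C w b)) (e * ((wt (b ∩ c) choose j) * (wt (b ∖ c) choose suc l))) (form es (suc j) l (wt (b ∩ c)) (wt (b ∖ c))))
      (trans (∑-+ (λ b → χ (hasWeight C w b) * (e * ((wt (b ∩ c) choose j) * (wt (b ∖ c) choose suc l))))
                  (λ b → χ (hasWeight C w b) * form es (suc j) l (wt (b ∩ c)) (wt (b ∖ c))))
        (trans (cong₂ _+_ (doubleCount-* c e j (suc l) j+l≡8) (doubleCount-form c es (suc j) l (trans (sym (ℕₚ.+-suc j l)) j+l≡8)))
          (sym (ℕₚ.*-distribˡ-+ lam (e * ((wt c choose j) * ((n ∸ wt c) choose suc l))) (form es (suc j) l (wt c) (n ∸ wt c))))))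

    block-identity : weightCount C w * (w choose 8) ≡ lam * (n choose 8)
    block-identity = trans (sym (∑-*ʳ (w choose 8) (λ b → χ (hasWeight C w b)))) (trans
      (∑-cong λ b → Σℕ.χ-*-cong (hasWeight C w b) λ p → sym (trans
        (cong₂ (λ x y → (x choose 0) * (y choose 8)) (wt-∩-zero b) (trans (wt-∖ b zeroWord) (trans (cong (wt b ∸_) (wt-∩-zero b)) (proj₂ (hasWeight⇒ {C = C} {w} b p)))))
        (ℕₚ.*-identityˡ (w choose 8))))
      (trans (doubleCount zeroWord 0 8 refl) (cong (lam *_) (trans
        (cong (λ x → (x choose 0) * ((n ∸ x) choose 8)) (wt-zeroWord n)) (ℕₚ.*-identityˡ (n choose 8))))))
      where
      wt-∩-zero : ∀ {n} (b : Word n) → wt (b ∩ zeroWord) ≡ 0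
      wt-∩-zero [] = refl
      wt-∩-zero (false ∷ b) = wt-∩-zero b
      wt-∩-zero (true ∷ b) = wt-∩-zero b

    module _ (dual : IsSelfDual C) (c : Word n) (c∈ : c ∈C C) where

      even-∩ : ∀ b → b ∈C C → ∃ λ k → wt (b ∩ c) ≡ k * 2
      even-∩ b b∈ = half (wt (b ∩ c)) (trans (sym (parity (b ∩ c))) (Equivalence.to (dual b) b∈ c c∈))
        where
        half : ∀ i → odd i ≡ false → ∃ λ k → i ≡ k * 2
        half zero _ = 0 , refl
        half (suc (suc i)) p with half i (trans (sym (𝔹ₚ.not-involutive (odd i))) p)
        ... | k , refl = suc k , refl

      -- A block meets c in an even number 2k ≤ w of points and has w - 2k points outside.
      -- Divisibility of the combination at these arguments passes to the sum over the blocks, hence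
      -- to its value by the double count.
      divisible : ∀ P es h → w ≡ h * 2 → (∀ k → k ≤ h → P ∣ form es 0 8 (k * 2) (w ∸ k * 2)) →
        P ∣ lam * form es 0 8 (wt c) (n ∸ wt c)
      divisible P es h w≡ all = subst (P ∣_) (doubleCount-form c es 0 8 refl) (∑-∣ _ term)
        where
        ∑-∣ : ∀ {n} (f : Word n → ℕ) → (∀ b → P ∣ f b) → P ∣ ∑ f
        ∑-∣ {zero} f p = p []
        ∑-∣ {suc n} f p = ∣m∣n⇒∣m+n (∑-∣ (f ∘ (false ∷_)) (p ∘ (false ∷_))) (∑-∣ (f ∘ (true ∷_)) (p ∘ (true ∷_)))
        term : ∀ b → P ∣ χ (hasWeight C w b) * form es 0 8 (wt (b ∩ c)) (wt (b ∖ c))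
        term b with hasWeight C w b in eq
        ... | false = P ∣0
        ... | true with hasWeight⇒ {C = C} {w} b eq
        ...   | b∈ , wt≡ with even-∩ b b∈
        ...     | k , i≡ = subst (P ∣_)
          (sym (trans (ℕₚ.*-identityˡ _) (cong₂ (form es 0 8) i≡ (trans (wt-∖ b c) (cong₂ _∸_ wt≡ i≡)))))
          (all k (ℕₚ.*-cancelʳ-≤ k h 2 (subst₂ _≤_ i≡ (trans wt≡ w≡) (ℕₚ.≤-trans (ℕₚ.m≤m+n (wt (b ∩ c)) (wt (b ∖ c))) (ℕₚ.≤-reflexive (wt-∩-∖ b c))))))

-- The exceptional lengths and the conclusion

open Coefficients using (ψ; dot)
open SemiInvariants using (q₁; q₂)
open WeightCounts using (hasWeight; weightCount; module Extremal)
open LargeLengths using (module LargeLength)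
open SmallLengths
open DoubleCounting
open import Data.Nat using (_+_; _*_)

-- A finite certificate against a codeword of weight w. The blocks have 4m + 4 = 2(2m + 2) points,
-- so k runs from 0 to 2m + 2. The second field is multiplied by C(24m, 8), because λ C(24m, 8) = A
-- C(4m + 4, 8) then removes λ without a division.
record Obstruction (m w P : ℕ) (es : List ℕ) : Set where
  constructor obstruction
  field
    blocks-divisible : All (λ k → P ∣ form es 0 8 (k * 2) ((4 * m + 4) ∸ k * 2)) (upTo (2 * m + 3))
    total-indivisible : ¬ (P * ((24 * m) choose 8) ∣ minimumCount m * ((4 * m + 4) choose 8) * form es 0 8 w (24 * m ∸ w))

obstruction? : ∀ m w P es → Dec (Obstruction m w P es)
obstruction? m w P es = Dec.map′ (λ (p , q) → obstruction p q) (λ (obstruction p q) → p , q)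
  (All.all? (λ k → _ ∣? _) (upTo (2 * m + 3)) ×-dec ¬? (_ ∣? _))

-- The coefficients modulo P of 2ᵇ f(i) in the basis C(i, j) C(4m + 4 - i, 8 - j), where f is integer valued on
-- even i: f(i) = C(i/2, 8) for m = 63 and m = 75, f(i) = C(i, 2) C(i/2 - 1, 6) for m = 42, and
-- f(i) = C(i, 2) C(i/2 - 1, 4) for m = 8 and m = 130.
es₈ es₄₂ es₆₃ es₇₅ es₁₃₀ : List ℕ
es₈ = 0 ∷ 0 ∷ 0 ∷ 283 ∷ 624 ∷ 226 ∷ 24 ∷ 189 ∷ 0 ∷ []
es₄₂ = 0 ∷ 0 ∷ 0 ∷ 787 ∷ 784 ∷ 626 ∷ 936 ∷ 645 ∷ 0 ∷ []
es₆₃ = 0 ∷ 2797 ∷ 12464 ∷ 1885 ∷ 3008 ∷ 5357 ∷ 9648 ∷ 7197 ∷ 0 ∷ []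
es₇₅ = 0 ∷ 633 ∷ 2640 ∷ 1321 ∷ 64 ∷ 2169 ∷ 1360 ∷ 745 ∷ 0 ∷ []
es₁₃₀ = 0 ∷ 0 ∷ 0 ∷ 15 ∷ 208 ∷ 42 ∷ 8 ∷ 41 ∷ 0 ∷ []

obstruction₈ : Obstruction 8 (4 * 8 + 4) 1024 es₈
obstruction₈ = from-yes (obstruction? 8 (4 * 8 + 4) 1024 es₈)

obstruction₄₂ : Obstruction 42 (4 * 42 + 4) 1024 es₄₂
obstruction₄₂ = from-yes (obstruction? 42 (4 * 42 + 4) 1024 es₄₂)

obstruction₆₃ : Obstruction 63 (4 * 63 + 8) 16384 es₆₃
obstruction₆₃ = from-yes (obstruction? 63 (4 * 63 + 8) 16384 es₆₃)

obstruction₇₅ : Obstruction 75 (4 * 75 + 4) 4096 es₇₅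
obstruction₇₅ = from-yes (obstruction? 75 (4 * 75 + 4) 4096 es₇₅)

obstruction₁₃₀ : Obstruction 130 (4 * 130 + 4) 256 es₁₃₀
obstruction₁₃₀ = from-yes (obstruction? 130 (4 * 130 + 4) 256 es₁₃₀)

record Balance (r : ℤ) (a u a′ : ℕ) : Set where
  constructor balance
  field balanced : r ℤ.+ (+ a ℤ.* + u ℤ.+ + a′) ≡ 0ℤ

balance? : ∀ r a u a′ → Dec (Balance r a u a′)
balance? r a u a′ = Dec.map′ balance Balance.balanced (_ ℤ.≟ 0ℤ)

-- The second weight relation with no words of weight 4m + 8. Refuting it supplies a codeword of
-- that weight, which the obstruction for m = 63 needs.
NoSecondWeight : ℕ → Set
NoSecondWeight m = Balance (dot q₂ (λ k → + ψ (suc (suc m)) k) 0) (minimumCount m) (4 * m + 46) 0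

secondWeight₆₃ : ¬ NoSecondWeight 63
secondWeight₆₃ = from-yes (¬? (balance? (dot q₂ (λ k → + ψ 65 k) 0) (minimumCount 63) (4 * 63 + 46) 0))

module _ {m : ℕ} {C : Code (24 * m)} (extremal : IsExtremalDESD m C) where
  open Extremal {m} {C} extremal

  weightCount≡ : weightCount C d ≡ minimumCount m
  weightCount≡ = trans (cong ℤ.∣_∣ minimum-count) (ℤₚ.∣-i∣≡∣i∣ (dot q₁ (λ k → + ψ (suc m) k) 0))

  codeword-or-none : (∃ λ c → (c ∈C C) × wt c ≡ 4 * m + 8) ⊎ weightCount C d₂ ≡ 0
  codeword-or-none with find (hasWeight C d₂)
  ... | inj₁ (c , p) = inj₁ (c , hasWeight⇒ {C = C} {d₂} c p)
  ... | inj₂ none = inj₂ (∑-zero (λ c → Σℕ.χ (hasWeight C d₂ c)) (λ c → cong Σℕ.χ (none c)))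

  second-codeword : ¬ NoSecondWeight m → ∃ λ c → (c ∈C C) × wt c ≡ 4 * m + 8
  second-codeword nonzero = [ id , (λ none → ⊥-elim (nonzero
    (subst₂ (λ a a′ → Balance (dot q₂ (λ k → + ψ (suc (suc m)) k) 0) a (4 * m + 46) a′) weightCount≡ none (balance second-count)))) ]′ codeword-or-none

  module _ (design : IsTDesign 8 (supportBlocks C (4 * m + 4))) where
    lam : ℕ
    lam = proj₁ design

    identity : minimumCount m * ((4 * m + 4) choose 8) ≡ lam * ((24 * m) choose 8)
    identity = trans (cong (_* ((4 * m + 4) choose 8)) (sym weightCount≡)) (block-identity {C = C} {4 * m + 4} (proj₂ design))

    not-excluded : Excluded m → ⊥
    not-excluded ¬div = ¬div (divides lam identity)

    not-obstructed : ∀ w P es → Obstruction m w P es → ∀ c → c ∈C C → wt c ≡ w → ⊥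
    not-obstructed w P es (obstruction all ¬div) c c∈ refl = ¬div (subst (P * ((24 * m) choose 8) ∣_) regroup
      (*-monoˡ-∣ ((24 * m) choose 8) (divisible {C = C} {4 * m + 4} (proj₂ design) dual c c∈ P es (2 * m + 2) (halves m)
        λ k k≤ → All.lookup all (∈-upTo⁺ (subst (k <_) (sym (ℕₚ.+-suc (2 * m) 2)) (s≤s k≤))))))
      where
      halves : ∀ m → 4 * m + 4 ≡ (2 * m + 2) * 2
      halves = ℕSolver.solve-∀
      swap : ∀ x y z → x * y * z ≡ x * z * y
      swap = ℕSolver.solve-∀
      regroup : lam * form es 0 8 w (24 * m ∸ w) * ((24 * m) choose 8) ≡
        minimumCount m * ((4 * m + 4) choose 8) * form es 0 8 w (24 * m ∸ w)
      regroup = trans (swap lam _ ((24 * m) choose 8)) (cong (_* form es 0 8 w (24 * m ∸ w)) (sym identity))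

    not-obstructed-d : ∀ P es → Obstruction m (4 * m + 4) P es → ⊥
    not-obstructed-d P es o = (λ (c , c∈ , _ , wt≡) → not-obstructed (4 * m + 4) P es o c c∈ wt≡) (proj₁ minWeight)

    not-obstructed-d₂ : ¬ NoSecondWeight m → ∀ P es → Obstruction m (4 * m + 8) P es → ⊥
    not-obstructed-d₂ nonzero P es o =
      (λ (c , c∈ , wt≡) → not-obstructed (4 * m + 8) P es o c c∈ wt≡) (second-codeword nonzero)

-- Here the code itself is contradictory, as its number of words of weight 4m + 8 would be negative.
no-long-code : ∀ m k → m ≡ 154 + k → (C : Code (24 * m)) → ¬ IsExtremalDESD m C
no-long-code m k m≡ = subst (λ m → (C : Code (24 * m)) → ¬ IsExtremalDESD m C) (sym (trans m≡ (154≡ k))) (lemma (144 + k) refl)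
  where
  154≡ : ∀ k → 154 + k ≡ 10 + (144 + k)
  154≡ k = refl
  lemma : ∀ j → j ≡ 144 + k → (C : Code (24 * (10 + j))) → ¬ IsExtremalDESD (10 + j) C
  lemma j j≡ C extremal = large-impossible (weightCount C d) (weightCount C d₂) minimum-count second-count
    where
    open Extremal {10 + j} {C} extremal
    open LargeLength k j j≡

no-small-design : ∀ {m} {C : Code (24 * m)} → IsExtremalDESD m C → IsTDesign 8 (supportBlocks C (4 * m + 4)) →
  ¬ (Excluded m ⊎ m ∈ exceptions)
no-small-design {m} {C} e D (inj₁ ¬div) = not-excluded {m} {C} e D ¬div
no-small-design {C = C} e D (inj₂ (here refl)) = not-obstructed-d {8} {C} e D 1024 es₈ obstruction₈
no-small-design {C = C} e D (inj₂ (there (here refl))) = not-obstructed-d {42} {C} e D 1024 es₄₂ obstruction₄₂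
no-small-design {C = C} e D (inj₂ (there (there (here refl)))) = not-obstructed-d₂ {63} {C} e D secondWeight₆₃ 16384 es₆₃ obstruction₆₃
no-small-design {C = C} e D (inj₂ (there (there (there (here refl))))) = not-obstructed-d {75} {C} e D 4096 es₇₅ obstruction₇₅
no-small-design {C = C} e D (inj₂ (there (there (there (there (here refl)))))) = not-obstructed-d {130} {C} e D 256 es₁₃₀ obstruction₁₃₀

theorem6 : (m : ℕ) → 1 ≤ m → (C : Code (24 * m)) → IsExtremalDESD m C →
    ¬ IsTDesign 8 (supportBlocks C (4 * m + 4))
theorem6 (suc i) _ C extremal design = [
  -- With m = i + 1, the bound i < 153 means m ≤ 153.
  (λ i<153 → no-small-design {suc i} {C} extremal design (All.lookup excluded {i} (∈-upTo⁺ {153} {i} i<153))) ,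
  (λ 153≤i → no-long-code (suc i) (i ∸ 153) (cong suc (sym (ℕₚ.m+[n∸m]≡n 153≤i))) C extremal) ]′ (ℕₚ.<-≤-connex i 153)
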